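{- For all integers $n,k\ge 1$, $$\frac{1}{(n+k)!}\sum_{w\in\mathfrak{S}_{n+k}}B_w(x)\,E_{\ell_w}(x)=\frac{1}{n!\,k!}\sum_{\pi\in\mathfrak{S}_n,\ \sigma\in\mathfrak{S}_k}B_\pi(x)\,B_\sigma(x)\,E_{\ell_\pi+\ell_\sigma}(x).$$ In other words, $$\sum_{w\in\mathfrak{S}_{n+k}}B_w(x)\,E_{\ell_w}(x)=\binom{n+k}{n}\sum_{\pi\in\mathfrak{S}_n,\ \sigma\in\mathfrak{S}_k}B_\pi(x)\,B_\sigma(x)\,E_{\ell_\pi+\ell_\sigma}(x).$$
   Context: $\mathfrak{S}_n$ is the symmetric group on $\{1,\ldots,n\}$. The Eulerian polynomial is $E_n(x)=\sum_{w\in\mathfrak{S}_n}x^{\operatorname{des}(w)}$, where $\operatorname{des}(w)=|\{i: w_i>w_{i+1}\}|$. The type B Narayana polynomial is $B_n(x)=\sum_{k=0}^{n-1}\binom{n-1}{k}^2x^k$. For a permutation $w$ with cycle type $(\lambda_1,\ldots,\lambda_\ell)$ (fixed points counted as cycles), $\ell_w=\ell$ is the number of cycles of $w$ and $B_w(x)=B_{\lambda_1}(x)\cdots B_{\lambda_\ell}(x)$. -}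

module Defs where

open import Data.Fin using (Fin; zero; suc; toℕ; inject₁)
import Data.Fin as Fin
import Data.Fin.Properties as Fin
open import Data.Fin.Permutation
  using (Permutation′; _⟨$⟩ʳ_; insert; remove; insert-remove)
  renaming (_≈_ to _≗ₚ_; id to idₚ)
import Data.Integer as ℤ
open import Data.List using (List; []; _∷_; map; foldr; filter; length; allFin;
  cartesianProductWith; replicate; _++_; upTo)
open import Data.List.Membership.Propositional.Properties using (∈-allFin)
open import Data.List.Relation.Unary.Any using (Any; here)
import Data.List.Relation.Unary.Any.Properties as Any
open import Data.List.Relation.Unary.AllPairs using ([]; _∷_)
open import Data.List.Relation.Unary.All using ([])
open import Data.List.Relation.Unary.Unique.Propositional.Properties using (allFin⁺)
open import Data.List.Relation.Unary.Unique.Setoid using (Unique)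
import Data.List.Relation.Unary.Unique.Setoid.Properties as Unique
open import Data.Nat using (ℕ; zero; suc; _+_; _*_; _∸_; _^_; _≤_; _<_; NonZero; >-nonZero)
import Data.Nat.Properties as ℕ
open import Data.Nat.Combinatorics using (_C_)
open import Data.Nat.DivMod using (_%_; _/_; m≡m%n+[m/n]*n; m%n<n)
open import Data.Nat.GeneralisedArithmetic using (fold; fold-+)
open import Data.Product using (∃-syntax; _×_; _,_)
open import Data.Rational as ℚ using (ℚ; 0ℚ; 1ℚ)
open import Function using (Injection; _∘_)
open import Function.Properties.Inverse using (↔⇒↣)
open import Relation.Binary using (Setoid)
open import Relation.Binary.PropositionalEquality
  using (_≡_; refl; sym; trans; cong; setoid; module ≡-Reasoning)
open import Relation.Nullary using (Dec)
open import Relation.Nullary.Decidable using (map′; _→-dec_)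

------------------------------------------------------------------------
-- Polynomials in one variable x over ℚ

-- a₀ ∷ a₁ ∷ … ∷ [] stands for a₀ + a₁ x + …; trailing zeros are allowed,
-- so equality of polynomials is _≈ₚ_ and not _≡_.
Poly : Set
Poly = List ℚ

coeff : Poly → ℕ → ℚ
coeff []       _       = 0ℚ
coeff (a ∷ _)  zero    = a
coeff (_ ∷ as) (suc i) = coeff as i

infix  4 _≈ₚ_
infixl 6 _+ₚ_
infixl 7 _*ₚ_
infixr 8 _•_

_≈ₚ_ : Poly → Poly → Set
p ≈ₚ q = ∀ i → coeff p i ≡ coeff q i

_+ₚ_ : Poly → Poly → Poly
[]       +ₚ q        = q
(a ∷ as) +ₚ []       = a ∷ as
(a ∷ as) +ₚ (b ∷ bs) = (a ℚ.+ b) ∷ (as +ₚ bs)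

_•_ : ℚ → Poly → Poly
c • p = map (c ℚ.*_) p

_*ₚ_ : Poly → Poly → Poly
[]       *ₚ q = []
(a ∷ as) *ₚ q = a • q +ₚ (0ℚ ∷ (as *ₚ q))

0ₚ 1ₚ : Poly
0ₚ = []
1ₚ = 1ℚ ∷ []

x^_ : ℕ → Poly
x^ k = replicate k 0ℚ ++ 1ₚ

productₚ : List Poly → Poly
productₚ = foldr _*ₚ_ 1ₚ

infix 5 ∑
∑ : {A : Set} → List A → (A → Poly) → Poly
∑ xs f = foldr (λ a p → f a +ₚ p) 0ₚ xs
syntax ∑ xs (λ a → p) = ∑[ a ∈ xs ] p

fromℕ : ℕ → ℚ
fromℕ m = ℤ.+ m ℚ./ 1

------------------------------------------------------------------------
-- Enumeration of the symmetric group on Fin n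

-- insert zero j π has one-line notation j followed by that of π, with the
-- values ≥ j shifted up by one.
permutations : (n : ℕ) → List (Permutation′ n)
permutations zero    = idₚ ∷ []
permutations (suc n) = cartesianProductWith (insert zero) (allFin (suc n)) (permutations n)

permutationSetoid : ℕ → Setoid _ _
permutationSetoid n = record
  { Carrier       = Permutation′ n
  ; _≈_           = _≗ₚ_
  ; isEquivalence = record
    { refl  = λ _ → refl
    ; sym   = λ p i → sym (p i)
    ; trans = λ p q i → trans (p i) (q i)
    }
  }

permutations-complete : ∀ n (w : Permutation′ n) → Any (w ≗ₚ_) (permutations n)
permutations-complete zero    w = here λ ()
permutations-complete (suc n) w =
  Any.cartesianProductWith⁺ (insert zero) hit
    (∈-allFin (w ⟨$⟩ʳ zero)) (permutations-complete n (remove zero w))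
  where
  hit : ∀ {j π} → w ⟨$⟩ʳ zero ≡ j → remove zero w ≗ₚ π → w ≗ₚ insert zero j π
  hit         refl _   zero    = refl
  hit {π = π} refl eq (suc i) = begin
    w ⟨$⟩ʳ suc i
      ≡⟨ insert-remove zero w (suc i) ⟨
    insert zero (w ⟨$⟩ʳ zero) (remove zero w) ⟨$⟩ʳ suc i
      ≡⟨ cong (Fin.punchIn (w ⟨$⟩ʳ zero)) (eq i) ⟩
    insert zero (w ⟨$⟩ʳ zero) π ⟨$⟩ʳ suc i ∎
    where open ≡-Reasoning

permutations-unique : ∀ n → Unique (permutationSetoid n) (permutations n)
permutations-unique zero    = [] ∷ []
permutations-unique (suc n) =
  Unique.cartesianProductWith⁺ (setoid _) (permutationSetoid n) (permutationSetoid (suc n))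
    (insert zero) (λ {j} {k} {π} {ρ} eq → eq zero , tail {π = π} {ρ} (eq zero) (eq ∘ suc))
    (allFin⁺ (suc n)) (permutations-unique n)
  where
  tail : ∀ {j k : Fin (suc n)} {π ρ : Permutation′ n} → j ≡ k →
         (∀ i → Fin.punchIn j (π ⟨$⟩ʳ i) ≡ Fin.punchIn k (ρ ⟨$⟩ʳ i)) → π ≗ₚ ρ
  tail {j} refl eq i = Fin.punchIn-injective j _ _ (eq i)

------------------------------------------------------------------------
-- Descents and Eulerian polynomials

des : ∀ {n} → Permutation′ n → ℕ
des {zero}  w = 0
des {suc n} w = length (filter (λ i → w ⟨$⟩ʳ suc i Fin.<? w ⟨$⟩ʳ inject₁ i) (allFin n))

E : ℕ → Poly
E n = ∑[ w ∈ permutations n ] x^ (des w)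

------------------------------------------------------------------------
-- Type B Narayana polynomials

-- Only used for n ≥ 1; the sum over 0 ≤ k ≤ n - 1 is empty for n = 0.
B : ℕ → Poly
B n = ∑[ k ∈ upTo n ] fromℕ (((n ∸ 1) C k) ^ 2) • x^ k

------------------------------------------------------------------------
-- Cycles

infix 8 _⟨$⟩^_
_⟨$⟩^_ : ∀ {n} → Permutation′ n → ℕ → Fin n → Fin n
(w ⟨$⟩^ m) i = fold i (w ⟨$⟩ʳ_) m

SameCycle : ∀ {n} → Permutation′ n → Fin n → Fin n → Set
SameCycle w i j = ∃[ m ] (w ⟨$⟩^ m) i ≡ j

-- Deciding SameCycle: some p with 1 ≤ p ≤ n has wᵖ(i) = i, so the powers
-- wᵐ with m < n already sweep the cycle of i.
module _ {n} (w : Permutation′ n) (i : Fin n) where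

  private
    cancel : ∀ a {x y} → (w ⟨$⟩^ a) x ≡ (w ⟨$⟩^ a) y → x ≡ y
    cancel zero    eq = eq
    cancel (suc a) eq = cancel a (Injection.injective (↔⇒↣ w) eq)

  period : ∃[ p ] 0 < p × p ≤ n × (w ⟨$⟩^ p) i ≡ i
  period with Fin.pigeonhole (ℕ.n<1+n n) (λ a → (w ⟨$⟩^ toℕ a) i)
  ... | a , b , a<b , eq =
    toℕ b ∸ toℕ a , ℕ.m<n⇒0<n∸m a<b
    , ℕ.≤-trans (ℕ.m∸n≤m (toℕ b) (toℕ a)) (ℕ.≤-pred (Fin.toℕ<n b))
    , sym (cancel (toℕ a) (begin
        (w ⟨$⟩^ toℕ a) i                               ≡⟨ eq ⟩
        (w ⟨$⟩^ toℕ b) i                               ≡⟨ cong (λ m → (w ⟨$⟩^ m) i) (ℕ.m+[n∸m]≡n (ℕ.<⇒≤ a<b)) ⟨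
        (w ⟨$⟩^ (toℕ a + (toℕ b ∸ toℕ a))) i           ≡⟨ fold-+ i (w ⟨$⟩ʳ_) (toℕ a) ⟩
        (w ⟨$⟩^ toℕ a) ((w ⟨$⟩^ (toℕ b ∸ toℕ a)) i)    ∎))
    where open ≡-Reasoning

  private
    periodic : ∀ {p} → (w ⟨$⟩^ p) i ≡ i → ∀ q → (w ⟨$⟩^ (q * p)) i ≡ i
    periodic     eq zero    = refl
    periodic {p} eq (suc q) =
      trans (fold-+ i (w ⟨$⟩ʳ_) p)
            (trans (cong (w ⟨$⟩^ p) (periodic eq q)) eq)

  sameCycle-bounded : ∀ {j} → SameCycle w i j → ∃[ a ] (w ⟨$⟩^ toℕ {n} a) i ≡ j
  sameCycle-bounded {j} (m , eq) with period
  ... | p , 0<p , p≤n , wᵖi≡i = Fin.fromℕ< r<n , (begin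
    (w ⟨$⟩^ toℕ (Fin.fromℕ< r<n)) i               ≡⟨ cong (λ s → (w ⟨$⟩^ s) i) (Fin.toℕ-fromℕ< r<n) ⟩
    (w ⟨$⟩^ (m % p)) i                            ≡⟨ cong (w ⟨$⟩^ (m % p)) (periodic wᵖi≡i (m / p)) ⟨
    (w ⟨$⟩^ (m % p)) ((w ⟨$⟩^ (m / p * p)) i)     ≡⟨ fold-+ i (w ⟨$⟩ʳ_) (m % p) ⟨
    (w ⟨$⟩^ (m % p + m / p * p)) i                ≡⟨ cong (λ s → (w ⟨$⟩^ s) i) (m≡m%n+[m/n]*n m p) ⟨
    (w ⟨$⟩^ m) i                                  ≡⟨ eq ⟩
    j                                             ∎)
    where
    open ≡-Reasoning
    instance
      p≢0 : NonZero p
      p≢0 = >-nonZero 0<p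
    r<n : m % p < n
    r<n = ℕ.<-≤-trans (m%n<n m p) p≤n

  sameCycle? : ∀ j → Dec (SameCycle w i j)
  sameCycle? j = map′ (λ (a , eq) → toℕ a , eq) sameCycle-bounded
                      (Fin.any? (λ a → (w ⟨$⟩^ toℕ a) i Fin.≟ j))

  cycle : List (Fin n)
  cycle = filter sameCycle? (allFin n)

-- Each cycle is represented by its smallest element.
IsCycleMin : ∀ {n} → Permutation′ n → Fin n → Set
IsCycleMin w i = ∀ j → SameCycle w i j → i Fin.≤ j

isCycleMin? : ∀ {n} (w : Permutation′ n) i → Dec (IsCycleMin w i)
isCycleMin? w i = Fin.all? (λ j → sameCycle? w i j →-dec i Fin.≤? j)

-- The parts are listed in the order of the cycle minima rather than in
-- decreasing order; B[_] and ℓ do not depend on the order.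
cycleType : ∀ {n} → Permutation′ n → List ℕ
cycleType {n} w = map (λ i → length (cycle w i)) (filter (isCycleMin? w) (allFin n))

ℓ : ∀ {n} → Permutation′ n → ℕ
ℓ w = length (cycleType w)

B[_] : ∀ {n} → Permutation′ n → Poly
B[ w ] = productₚ (map B (cycleType w))

{-# OPTIONS --safe #-}

-- Put c = 1 - x and let Pₙ(t) = (1/n!) Σ_{w ∈ 𝔖ₙ} t^{ℓ_w} B_w.  The Eulerian polynomials are
-- Eₘ = c Σ_{j ≥ 0} xʲ tⱼ₊₁ᵐ at the nodes tⱼ = c j, so the claim is that the averages
-- J(n, k) = Σ_{j ≥ 0} xʲ Pₙ(tⱼ₊₁) Pₖ(tⱼ₊₁) depend on n + k only.  By the exponential formula
-- Σ Pₙ(t) zⁿ = exp (t ∫ γ/z) with γ = Σ Bₙ zⁿ, and γ² (1 - 2(1 + x)z + c²z²) = z² by the three-term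
-- recurrence of the Bₙ.  For G = Σ Pₙ(c) zⁿ this gives c²z = (1 + x) - xG - 1/G, i.e. the difference equation
--   c² Pₙ(t) = (1 + x) Pₙ₊₁(t) - x Pₙ₊₁(t + c) - Pₙ₊₁(t - c).
-- It turns c² (J(n, k + 1) - J(n + 1, k)) into a telescoping sum whose boundary term vanishes.

module Submission where

open import Defs
open import Algebra.Bundles using (CommutativeRing; CommutativeMonoid)
import Algebra.Properties.Ring
import Algebra.Properties.Semiring.Exp
import Algebra.Properties.Semiring.Mult
import Algebra.Solver.Ring
import Algebra.Solver.Ring.AlmostCommutativeRing as ACR
open import Data.Bool using (true; false; if_then_else_)
open import Data.Empty using (⊥-elim)
open import Data.Fin as Fin using (Fin; zero; suc; toℕ; inject₁; punchIn)
import Data.Fin.Induction as Fin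
open import Data.Fin.Permutation as Perm
  using (Permutation′; _⟨$⟩ʳ_; _⟨$⟩ˡ_; insert; remove; lift₀; _∘ₚ_; transpose; flip)
  renaming (_≈_ to _≗ₚ_)
import Data.Fin.Properties as Fin
import Data.Integer as ℤ
import Data.Integer.Properties as ℤ
open import Data.List as List
  using (List; []; _∷_; _++_; map; foldr; filter; length; allFin; upTo; cartesianProductWith)
open import Data.List.Membership.Propositional using (_∈_)
open import Data.List.Membership.Propositional.Properties using (∈-allFin; ∈-filter⁺; ∈-filter⁻)
import Data.List.Properties as List
open import Data.List.Relation.Unary.All as All using (All; []; _∷_)
import Data.List.Relation.Unary.All.Properties as All
open import Data.List.Relation.Unary.AllPairs using ([]; _∷_)
open import Data.List.Relation.Unary.Any as Any using (Any; here; there)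
import Data.List.Relation.Unary.Any.Properties as Any
open import Data.List.Relation.Unary.Unique.Propositional.Properties using (allFin⁺)
import Data.List.Relation.Unary.Unique.Propositional.Properties as UniqueP
open import Data.List.Relation.Unary.Unique.Setoid using (Unique)
import Data.List.Relation.Unary.Unique.Setoid.Properties as Unique
open import Data.Maybe using (Maybe; just; nothing)
open import Data.Nat as ℕ using (ℕ; zero; suc; _≤_; _!; _∸_; z≤n; s≤s; NonZero)
open import Data.Nat.Combinatorics
  using (_C_; nCk+nC[k+1]≡[n+1]C[k+1]; nCk≡n!/k![n-k]!; k![n∸k]!∣n!; k>n⇒nCk≡0)
open import Data.Nat.DivMod using (m/n*n≡m)
open import Data.Nat.GeneralisedArithmetic using (fold-+)
import Data.Nat.Properties as ℕ
open import Data.Nat.Properties using (_!≢0; _!*_!≢0)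
open import Data.Product using (_×_; _,_; proj₁; proj₂; ∃-syntax)
open import Data.Rational as ℚ using (ℚ; 0ℚ; 1ℚ; _/_)
import Data.Rational.Properties as ℚ
import Data.Rational.Unnormalised as ℚᵘ
import Data.Rational.Unnormalised.Properties as ℚᵘ
import Data.Sign as Sign
open import Function using (_∘_; Injection)
open import Function.Properties.Inverse using (↔⇒↣)
open import Induction.WellFounded using (Acc; acc)
open import Level using (0ℓ)
open import Relation.Binary using (Setoid)
open import Relation.Binary.PropositionalEquality as ≡ using (_≡_)
import Relation.Binary.Reasoning.Setoid
open import Relation.Nullary using (Dec; yes; no; does; ¬_)
open import Relation.Nullary.Decidable using (_×-dec_; _→-dec_; ¬?; decidable-stable)
open import Relation.Nullary.Negation using (contradiction)
open import Relation.Unary using (Pred; Decidable)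

-- The sums over j are formal: they live in ℚ[[x]], where the factor xʲ leaves finitely many terms
-- in each coefficient. Generating functions in z have coefficients in that ring, so `PowerSeries`
-- is applied twice. In ℚ[[x]] the element c is no zero divisor, hence c² can be cancelled at the
-- end.
--
-- Square roots, exponentials and reciprocals are never formed. The series γ, `F t` and the relation
-- between G, 1/G and z are handled through linear equations in z d/dz, whose solutions are
-- determined coefficient by coefficient in a torsion-free ring; 1/G is `F (- c)`. As that relation
-- is linear in G and 1/G, multiplying it by `F t` yields the difference equation at every t.
--
-- The coefficients of the difference equation do not involve n. So Pₙ₊₁ and Pₖ₊₁ obey it side by
-- side, and the telescoping quantity is their Casoratian, from which the middle term (1 + x) drops
-- out.
--
-- The formula for Eₘ is Worpitzky's identity with the powers of 1 - x absorbed into the nodes. It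
-- is proved by induction in a form refined by the first letter.

module IntegerCoefficients (R : CommutativeRing 0ℓ 0ℓ) where
  open CommutativeRing R hiding (zero)
  open Algebra.Properties.Ring ring
  open Algebra.Properties.Semiring.Mult semiring
    using (×1-homo-*; ×-homo-+) renaming (_×_ to _⋆_)
  open Relation.Binary.Reasoning.Setoid setoid

  ι : ℕ → Carrier
  ι n = n ⋆ 1#

  ι-+ : ∀ m n → ι (m ℕ.+ n) ≈ ι m + ι n
  ι-+ = ×-homo-+ 1#

  ι-* : ∀ m n → ι (m ℕ.* n) ≈ ι m * ι n
  ι-* = ×1-homo-*

  private
    fromℤ : ℤ.ℤ → Carrier
    fromℤ (ℤ.+ n)    = ι n
    fromℤ ℤ.-[1+ n ] = - ι (suc n)

    cancel-1 : ∀ a b → (1# + a) - (1# + b) ≈ a - b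
    cancel-1 a b = begin
      (1# + a) - (1# + b)       ≈⟨ +-cong (+-comm a 1#) (-‿+-comm 1# b) ⟨
      (a + 1#) + (- 1# + - b)   ≈⟨ +-assoc a 1# _ ⟩
      a + (1# + (- 1# + - b))   ≈⟨ +-congˡ (+-assoc 1# (- 1#) (- b)) ⟨
      a + ((1# - 1#) + - b)     ≈⟨ +-congˡ (trans (+-congʳ (-‿inverseʳ 1#)) (+-identityˡ _)) ⟩
      a - b                     ∎

    from-⊖ : ∀ m n → fromℤ (m ℤ.⊖ n) ≈ ι m - ι n
    from-⊖ m       zero    = sym (trans (+-congˡ -0#≈0#) (+-identityʳ _))
    from-⊖ zero    (suc n) = sym (+-identityˡ _)
    from-⊖ (suc m) (suc n) = begin
      fromℤ (suc m ℤ.⊖ suc n) ≡⟨ ≡.cong fromℤ (ℤ.[1+m]⊖[1+n]≡m⊖n m n) ⟩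
      fromℤ (m ℤ.⊖ n)         ≈⟨ from-⊖ m n ⟩
      ι m - ι n               ≈⟨ cancel-1 (ι m) (ι n) ⟨
      ι (suc m) - ι (suc n)   ∎

    from-+ : ∀ i j → fromℤ (i ℤ.+ j) ≈ fromℤ i + fromℤ j
    from-+ (ℤ.+ m)    (ℤ.+ n)    = ι-+ m n
    from-+ (ℤ.+ m)    ℤ.-[1+ n ] = from-⊖ m (suc n)
    from-+ ℤ.-[1+ m ] (ℤ.+ n)    = trans (from-⊖ n (suc m)) (+-comm _ _)
    from-+ ℤ.-[1+ m ] ℤ.-[1+ n ] = begin
      - ι (suc (suc (m ℕ.+ n)))   ≡⟨ ≡.cong (λ k → - ι (suc k)) (ℕ.+-suc m n) ⟨
      - ι (suc m ℕ.+ suc n)       ≈⟨ -‿cong (ι-+ (suc m) (suc n)) ⟩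
      - (ι (suc m) + ι (suc n))   ≈⟨ -‿+-comm _ _ ⟨
      - ι (suc m) - ι (suc n)     ∎

    from-neg : ∀ i → fromℤ (ℤ.- i) ≈ - fromℤ i
    from-neg (ℤ.+ zero)  = sym -0#≈0#
    from-neg ℤ.+[1+ n ]  = refl
    from-neg ℤ.-[1+ n ]  = sym (-‿involutive _)

    from-◃ : ∀ n → fromℤ (Sign.- ℤ.◃ n) ≈ - ι n
    from-◃ zero    = sym -0#≈0#
    from-◃ (suc n) = refl

    from-* : ∀ i j → fromℤ (i ℤ.* j) ≈ fromℤ i * fromℤ j
    from-* (ℤ.+ m)    (ℤ.+ n)    = trans (reflexive (≡.cong fromℤ (ℤ.+◃n≡+n (m ℕ.* n)))) (ι-* m n)
    from-* (ℤ.+ m)    ℤ.-[1+ n ] = begin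
      fromℤ (Sign.- ℤ.◃ m ℕ.* suc n)  ≈⟨ from-◃ (m ℕ.* suc n) ⟩
      - ι (m ℕ.* suc n)               ≈⟨ -‿cong (ι-* m (suc n)) ⟩
      - (ι m * ι (suc n))             ≈⟨ -‿distribʳ-* _ _ ⟩
      ι m * - ι (suc n)               ∎
    from-* ℤ.-[1+ m ] (ℤ.+ n)    = begin
      fromℤ (Sign.- ℤ.◃ suc m ℕ.* n)  ≈⟨ from-◃ (suc m ℕ.* n) ⟩
      - ι (suc m ℕ.* n)               ≈⟨ -‿cong (ι-* (suc m) n) ⟩
      - (ι (suc m) * ι n)             ≈⟨ -‿distribˡ-* _ _ ⟩
      - ι (suc m) * ι n               ∎
    from-* ℤ.-[1+ m ] ℤ.-[1+ n ] = begin
      ι (suc m ℕ.* suc n)         ≈⟨ ι-* (suc m) (suc n) ⟩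
      ι (suc m) * ι (suc n)       ≈⟨ -‿involutive _ ⟨
      - (- (ι (suc m) * ι (suc n))) ≈⟨ -‿cong (-‿distribˡ-* _ _) ⟩
      - (- ι (suc m) * ι (suc n)) ≈⟨ -‿distribʳ-* _ _ ⟩
      - ι (suc m) * - ι (suc n)   ∎

    almost : ACR.AlmostCommutativeRing 0ℓ 0ℓ
    almost = ACR.fromCommutativeRing R

    -- Unlike fromℤ, this sends 1 to 1# judgementally, so that solver constants match 0#, 1# and 1# + 1#.
    litℕ : ℕ → Carrier
    litℕ zero          = 0#
    litℕ (suc zero)    = 1#
    litℕ (suc (suc n)) = 1# + litℕ (suc n)

    lit : ℤ.ℤ → Carrier
    lit (ℤ.+ n)    = litℕ n
    lit ℤ.-[1+ n ] = - litℕ (suc n)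

    litℕ≈ι : ∀ n → litℕ n ≈ ι n
    litℕ≈ι zero          = refl
    litℕ≈ι (suc zero)    = sym (+-identityʳ 1#)
    litℕ≈ι (suc (suc n)) = +-congˡ (litℕ≈ι (suc n))

    lit≈from : ∀ i → lit i ≈ fromℤ i
    lit≈from (ℤ.+ n)    = litℕ≈ι n
    lit≈from ℤ.-[1+ n ] = -‿cong (litℕ≈ι (suc n))

    -- Equality of series is not decidable, so the solver normalises with integer coefficients,
    -- whose equality is, and interprets them in the ring through this map.
    morphism : ℤ.+-*-rawRing ACR.-Raw-AlmostCommutative⟶ almost
    morphism = record
      { ⟦_⟧    = lit
      ; +-homo = λ i j → trans (lit≈from (i ℤ.+ j))
          (trans (from-+ i j) (sym (+-cong (lit≈from i) (lit≈from j))))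
      ; *-homo = λ i j → trans (lit≈from (i ℤ.* j))
          (trans (from-* i j) (sym (*-cong (lit≈from i) (lit≈from j))))
      ; -‿homo = λ i → trans (lit≈from (ℤ.- i))
          (trans (from-neg i) (sym (-‿cong (lit≈from i))))
      ; 0-homo = refl
      ; 1-homo = refl
      }

    _≟_ : ∀ i j → Maybe (lit i ≈ lit j)
    i ≟ j with i ℤ.≟ j
    ... | yes eq = just (reflexive (≡.cong lit eq))
    ... | no  _  = nothing

  open Algebra.Solver.Ring ℤ.+-*-rawRing almost morphism _≟_ public
    using (solve; con; _:+_; _:*_; _:-_; :-_; _:=_; Polynomial)

  𝟘 𝟙 : ∀ {n} → Polynomial n
  𝟘 = con (ℤ.+ 0)
  𝟙 = con (ℤ.+ 1)

-- Formal power series, the Euler operator and the sums Σ xᵐ fₘ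

module PowerSeries (R : CommutativeRing 0ℓ 0ℓ) where
  open CommutativeRing R hiding (zero)
  open Algebra.Properties.Ring ring using (-0#≈0#)
  open IntegerCoefficients R
  open Relation.Binary.Reasoning.Setoid setoid

  Series : Set
  Series = ℕ → Carrier

  infix 4 _≋_
  -- A record instead of a bare function type, so that unification recovers both series from the
  -- type of a proof.
  record _≋_ (f g : Series) : Set where
    constructor mk
    field at : ∀ n → f n ≈ g n
  open _≋_ public

  infixl 6 _⊕_
  infixl 7 _⊛_
  infix  8 ⊖_

  _⊕_ : Series → Series → Series
  (f ⊕ g) n = f n + g n

  ⊖_ : Series → Series
  (⊖ f) n = - f n

  tail : Series → Series
  tail f n = f (suc n)

  infixr 5 _◂_
  _◂_ : Carrier → Series → Series
  (a ◂ f) zero    = a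
  (a ◂ f) (suc n) = f n

  𝟎 : Series
  𝟎 n = 0#

  const : Carrier → Series
  const a = a ◂ 𝟎

  _⊛_ : Series → Series → Series
  (f ⊛ g) zero    = f 0 * g 0
  (f ⊛ g) (suc n) = f 0 * g (suc n) + (tail f ⊛ g) n

  private
    variable
      f f′ g g′ h : Series

    ⊛-cong′ : (∀ n → f n ≈ f′ n) → (∀ n → g n ≈ g′ n) → ∀ n → (f ⊛ g) n ≈ (f′ ⊛ g′) n
    ⊛-cong′ p q zero    = *-cong (p 0) (q 0)
    ⊛-cong′ p q (suc n) = +-cong (*-cong (p 0) (q (suc n))) (⊛-cong′ (λ m → p (suc m)) q n)

    ⊛-distribʳ′ : ∀ f g h n → ((g ⊕ h) ⊛ f) n ≈ (g ⊛ f) n + (h ⊛ f) n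
    ⊛-distribʳ′ f g h zero    = distribʳ (f 0) (g 0) (h 0)
    ⊛-distribʳ′ f g h (suc n) = trans (+-congˡ (⊛-distribʳ′ f (tail g) (tail h) n))
      (solve 5 (λ a b c d e → (a :+ b) :* c :+ (d :+ e) := (a :* c :+ d) :+ (b :* c :+ e)) refl
        (g 0) (h 0) (f (suc n)) _ _)

    -- The recursion of `_⊛_` consumes the left factor from the front. Commutativity also needs the
    -- mirror image, which consumes the right one.
    ⊛-last : ∀ f g n → (f ⊛ g) (suc n) ≈ f (suc n) * g 0 + (f ⊛ tail g) n
    ⊛-last f g zero    = +-comm _ _
    ⊛-last f g (suc n) = trans (+-congˡ (⊛-last (tail f) g n))
      (solve 3 (λ a b c → a :+ (b :+ c) := b :+ (a :+ c)) refl _ _ _)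

    ⊛-comm′ : ∀ f g n → (f ⊛ g) n ≈ (g ⊛ f) n
    ⊛-comm′ f g zero    = *-comm _ _
    ⊛-comm′ f g (suc n) = sym (trans (⊛-last g f n) (+-cong (*-comm _ _) (⊛-comm′ g (tail f) n)))

    ⊛-scale : ∀ a f g n → ((λ m → a * f m) ⊛ g) n ≈ a * (f ⊛ g) n
    ⊛-scale a f g zero    = *-assoc _ _ _
    ⊛-scale a f g (suc n) = trans (+-cong (*-assoc _ _ _) (⊛-scale a (tail f) g n)) (sym (distribˡ _ _ _))

    ⊛-assoc′ : ∀ f g h n → ((f ⊛ g) ⊛ h) n ≈ (f ⊛ (g ⊛ h)) n
    ⊛-assoc′ f g h zero    = *-assoc _ _ _
    ⊛-assoc′ f g h (suc n) = begin
      f 0 * g 0 * h (suc n) + (tail (f ⊛ g) ⊛ h) n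
        ≈⟨ +-congˡ (⊛-distribʳ′ h (λ m → f 0 * g (suc m)) (tail f ⊛ g) n) ⟩
      f 0 * g 0 * h (suc n) + (((λ m → f 0 * g (suc m)) ⊛ h) n + ((tail f ⊛ g) ⊛ h) n)
        ≈⟨ +-congˡ (+-cong (⊛-scale (f 0) (tail g) h n) (⊛-assoc′ (tail f) g h n)) ⟩
      f 0 * g 0 * h (suc n) + (f 0 * (tail g ⊛ h) n + (tail f ⊛ (g ⊛ h)) n)
        ≈⟨ solve 5 (λ a b c d e → a :* b :* c :+ (a :* d :+ e) := a :* (b :* c :+ d) :+ e) refl
             (f 0) (g 0) (h (suc n)) _ _ ⟩
      f 0 * (g 0 * h (suc n) + (tail g ⊛ h) n) + (tail f ⊛ (g ⊛ h)) n ∎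

    𝟎-zeroˡ : ∀ f n → (𝟎 ⊛ f) n ≈ 0#
    𝟎-zeroˡ f zero    = zeroˡ _
    𝟎-zeroˡ f (suc n) = trans (+-cong (zeroˡ _) (𝟎-zeroˡ f n)) (+-identityˡ 0#)

  const-⊛ : ∀ a f n → (const a ⊛ f) n ≈ a * f n
  const-⊛ a f zero    = refl
  const-⊛ a f (suc n) = trans (+-congˡ (𝟎-zeroˡ f n)) (+-identityʳ _)

  commutativeRing : CommutativeRing 0ℓ 0ℓ
  commutativeRing = record
    { Carrier = Series ; _≈_ = _≋_ ; _+_ = _⊕_ ; _*_ = _⊛_ ; -_ = ⊖_ ; 0# = 𝟎 ; 1# = const 1#
    ; isCommutativeRing = record
      { isRing = record
        { +-isAbelianGroup = record
          { isGroup = record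
            { isMonoid = record
              { isSemigroup = record
                { isMagma = record
                  { isEquivalence = record
                    { refl  = mk λ _ → refl
                    ; sym   = λ p → mk λ n → sym (at p n)
                    ; trans = λ p q → mk λ n → trans (at p n) (at q n)
                    }
                  ; ∙-cong = λ p q → mk λ n → +-cong (at p n) (at q n)
                  }
                ; assoc = λ f g h → mk λ n → +-assoc _ _ _
                }
              ; identity = (λ f → mk λ n → +-identityˡ _) , (λ f → mk λ n → +-identityʳ _)
              }
            ; inverse = (λ f → mk λ n → -‿inverseˡ _) , (λ f → mk λ n → -‿inverseʳ _)
            ; ⁻¹-cong = λ p → mk λ n → -‿cong (at p n)
            }
          ; comm = λ f g → mk λ n → +-comm _ _
          }
        ; *-cong = λ p q → mk (⊛-cong′ (at p) (at q))
        ; *-assoc = λ f g h → mk (⊛-assoc′ f g h)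
        ; *-identity = (λ f → mk λ n → trans (const-⊛ 1# f n) (*-identityˡ _))
                     , (λ f → mk λ n → trans (⊛-comm′ f _ n) (trans (const-⊛ 1# f n) (*-identityˡ _)))
        ; distrib = (λ f g h → mk λ n → trans (⊛-comm′ f (g ⊕ h) n)
                       (trans (⊛-distribʳ′ f g h n) (+-cong (⊛-comm′ g f n) (⊛-comm′ h f n))))
                  , (λ f g h → mk (⊛-distribʳ′ f g h))
        }
      ; *-comm = λ f g → mk (⊛-comm′ f g)
      }
    }

  private module S = CommutativeRing commutativeRing

  X : Series
  X = 0# ◂ 1# ◂ 𝟎

  X-⊛ : ∀ f → X ⊛ f ≋ (0# ◂ f)
  X-⊛ f = mk λ
    { zero    → zeroˡ _
    ; (suc n) → trans (+-cong (zeroˡ _) (trans (const-⊛ 1# f n) (*-identityˡ _))) (+-identityˡ _)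
    }

  const-+ : ∀ a b → const (a + b) ≋ const a ⊕ const b
  const-+ a b = mk λ { zero → refl ; (suc n) → sym (+-identityˡ 0#) }

  const-* : ∀ a b → const (a * b) ≋ const a ⊛ const b
  const-* a b = mk λ { zero → refl ; (suc n) → sym (trans (const-⊛ a (const b) (suc n)) (zeroʳ a)) }

  const-neg : ∀ a → const (- a) ≋ ⊖ const a
  const-neg a = mk λ { zero → refl ; (suc n) → sym -0#≈0# }

  const-cong : ∀ {a b} → a ≈ b → const a ≋ const b
  const-cong p = mk λ { zero → p ; (suc n) → refl }

  -- The Euler operator z d/dz. Unlike d/dz it preserves degrees, so differential equations become
  -- coefficient identities without index shifts.
  ϑ : Series → Series
  ϑ f n = ι n * f n

  ϑ-cong : f ≋ g → ϑ f ≋ ϑ g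
  ϑ-cong p = mk λ n → *-congˡ (at p n)

  ϑ-+ : ∀ f g → ϑ (f ⊕ g) ≋ ϑ f ⊕ ϑ g
  ϑ-+ f g = mk λ n → distribˡ _ _ _

  private
    ϑ-⊛′ : ∀ f g n → ι n * (f ⊛ g) n ≈ (ϑ f ⊛ g) n + (f ⊛ ϑ g) n
    ϑ-⊛′ f g zero    = solve 2 (λ a b → 𝟘 :* (a :* b) := 𝟘 :* a :* b :+ a :* (𝟘 :* b)) refl _ _
    ϑ-⊛′ f g (suc n) = begin
      (1# + ι n) * (f 0 * g (suc n) + (tail f ⊛ g) n)
        ≈⟨ solve 4 (λ k a b t → (𝟙 :+ k) :* (a :* b :+ t) := a :* ((𝟙 :+ k) :* b) :+ t :+ k :* t) refl (ι n) (f 0) (g (suc n)) _ ⟩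
      f 0 * ((1# + ι n) * g (suc n)) + (tail f ⊛ g) n + ι n * (tail f ⊛ g) n
        ≈⟨ +-congˡ (ϑ-⊛′ (tail f) g n) ⟩
      f 0 * ((1# + ι n) * g (suc n)) + (tail f ⊛ g) n + ((ϑ (tail f) ⊛ g) n + (tail f ⊛ ϑ g) n)
        ≈⟨ solve 6 (λ a b t u v w → b :+ t :+ (u :+ v) := 𝟘 :* a :* w :+ (t :+ u) :+ (b :+ v)) refl (f 0) _ _ _ _ (g (suc n)) ⟩
      0# * f 0 * g (suc n) + ((tail f ⊛ g) n + (ϑ (tail f) ⊛ g) n) + (f 0 * ((1# + ι n) * g (suc n)) + (tail f ⊛ ϑ g) n)
        -- `tail (ϑ f)` is `tail f ⊕ ϑ (tail f)`; the extra summand accounts for the copy of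
        -- `tail f ⊛ g` set aside when 1 + n was split.
        ≈⟨ +-congʳ (+-congˡ (sym (trans (⊛-cong′ (λ m → trans (distribʳ _ _ _) (+-congʳ (*-identityˡ _))) (λ _ → refl) n)
                                (⊛-distribʳ′ g (tail f) (ϑ (tail f)) n)))) ⟩
      0# * f 0 * g (suc n) + (tail (ϑ f) ⊛ g) n + (f 0 * ((1# + ι n) * g (suc n)) + (tail f ⊛ ϑ g) n) ∎

  ϑ-⊛ : ∀ f g → ϑ (f ⊛ g) ≋ ϑ f ⊛ g ⊕ f ⊛ ϑ g
  ϑ-⊛ f g = mk (ϑ-⊛′ f g)

  ϑ-const : ∀ a → ϑ (const a) ≋ 𝟎
  ϑ-const a = mk λ { zero → zeroˡ _ ; (suc n) → zeroʳ _ }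

  ϑ-X : ϑ X ≋ X
  ϑ-X = mk λ { zero → zeroˡ _ ; (suc zero) → trans (*-identityʳ _) (+-identityʳ 1#) ; (suc (suc n)) → zeroʳ _ }

  -- Σ_m x^m f_m, where x is the variable.
  Σ∞ : (ℕ → Series) → Series
  Σ∞ f zero    = f 0 0
  Σ∞ f (suc n) = f 0 (suc n) + Σ∞ (λ m → f (suc m)) n

  Σ∞-unfold : ∀ f → Σ∞ f ≋ f 0 ⊕ X ⊛ Σ∞ (λ m → f (suc m))
  Σ∞-unfold f = mk λ
    { zero    → sym (trans (+-congˡ (at (X-⊛ (Σ∞ (λ m → f (suc m)))) 0)) (+-identityʳ _))
    ; (suc n) → sym (+-congˡ (at (X-⊛ (Σ∞ (λ m → f (suc m)))) (suc n)))
    }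

  Σ∞-cong : ∀ {f g} → (∀ m → f m ≋ g m) → Σ∞ f ≋ Σ∞ g
  Σ∞-cong p = mk (go p)
    where
    go : ∀ {f g} → (∀ m → f m ≋ g m) → ∀ n → Σ∞ f n ≈ Σ∞ g n
    go p zero    = at (p 0) 0
    go p (suc n) = +-cong (at (p 0) (suc n)) (go (λ m → p (suc m)) n)

  Σ∞-+ : ∀ f g → Σ∞ (λ m → f m ⊕ g m) ≋ Σ∞ f ⊕ Σ∞ g
  Σ∞-+ f g = mk (go f g)
    where
    go : ∀ f g n → Σ∞ (λ m → f m ⊕ g m) n ≈ Σ∞ f n + Σ∞ g n
    go f g zero    = refl
    go f g (suc n) = trans (+-congˡ (go _ _ n))
      (solve 4 (λ a b c d → (a :+ b) :+ (c :+ d) := (a :+ c) :+ (b :+ d)) refl _ _ _ _)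

  Σ∞-𝟎 : Σ∞ (λ _ → 𝟎) ≋ 𝟎
  Σ∞-𝟎 = mk go
    where
    go : ∀ n → Σ∞ (λ _ → 𝟎) n ≈ 0#
    go zero    = refl
    go (suc n) = trans (+-identityˡ _) (go n)

  Σ∞-* : ∀ a f → Σ∞ (λ m → a ⊛ f m) ≋ a ⊛ Σ∞ f
  Σ∞-* a f = mk (go f)
    where
    unfold : ∀ f → a ⊛ Σ∞ f ≋ a ⊛ f 0 ⊕ (0# ◂ a ⊛ Σ∞ (λ m → f (suc m)))
    unfold f = S.trans (S.*-congˡ (Σ∞-unfold f)) (S.trans (S.distribˡ a (f 0) _)
      (S.+-congˡ (S.trans (S.sym (S.*-assoc a X _)) (S.trans (S.*-congʳ (S.*-comm a X))
        (S.trans (S.*-assoc X a _) (X-⊛ _))))))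
    go : ∀ f n → Σ∞ (λ m → a ⊛ f m) n ≈ (a ⊛ Σ∞ f) n
    go f zero    = refl
    go f (suc n) = trans (+-congˡ (go (λ m → f (suc m)) n)) (sym (at (unfold f) (suc n)))

-- From the three-term recurrence to the difference equation

module Narayana (R : CommutativeRing 0ℓ 0ℓ) where
  open CommutativeRing R hiding (zero)
  open IntegerCoefficients R
  open PowerSeries R hiding (commutativeRing)

  module Recurrence
    (ι-cancel : ∀ n {a} → ι (suc n) * a ≈ 0# → a ≈ 0#)
    (x : Carrier) (γ : Series) (γ₀ : γ 0 ≈ 0#) (γ₁ : γ 1 ≈ 1#)
    (γ-rec : ∀ k → ι (suc k) * γ (suc (suc k)) + (1# - x) * (1# - x) * (ι k * γ k)
                 ≈ (1# + x) * ((1# + ι k + ι k) * γ (suc k)))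
    where

    private
      module S = CommutativeRing (PowerSeries.commutativeRing R)
      module SI = IntegerCoefficients (PowerSeries.commutativeRing R)
      module ≈R = Relation.Binary.Reasoning.Setoid setoid
      module SR = Relation.Binary.Reasoning.Setoid S.setoid

    c : Carrier
    c = 1# - x

    private
      x̂ ĉ 1̂ : Series
      x̂ = const x
      ĉ = const c
      1̂ = S.1#

      ρ κ D : Series
      ρ = const (1# + x)
      κ = const (c * c)
      D = 1̂ ⊕ ⊖ ((ρ ⊕ ρ) ⊛ X) ⊕ κ ⊛ (X ⊛ X)

      κ≋ : κ ≋ ĉ ⊛ ĉ
      κ≋ = const-* c c

      D-⊛ : ∀ f → D ⊛ f ≋ f ⊕ ⊖ (ρ ⊛ (X ⊛ f) ⊕ ρ ⊛ (X ⊛ f)) ⊕ κ ⊛ (X ⊛ (X ⊛ f))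
      D-⊛ f = SI.solve 4 (λ r k z f → (SI.𝟙 SI.:+ SI.:- ((r SI.:+ r) SI.:* z) SI.:+ k SI.:* (z SI.:* z)) SI.:* f
                  SI.:= f SI.:+ SI.:- (r SI.:* (z SI.:* f) SI.:+ r SI.:* (z SI.:* f)) SI.:+ k SI.:* (z SI.:* (z SI.:* f)))
                S.refl ρ κ X f

      X-⊛-suc : ∀ f n → (X ⊛ f) (suc n) ≈ f n
      X-⊛-suc f n = at (X-⊛ f) (suc n)

      const-X₀ : ∀ a f → (const a ⊛ (X ⊛ f)) 0 ≈ 0#
      const-X₀ a f = trans (const-⊛ a (X ⊛ f) 0) (trans (*-congˡ (at (X-⊛ f) 0)) (zeroʳ a))

      const-X : ∀ a f n → (const a ⊛ (X ⊛ f)) (suc n) ≈ a * f n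
      const-X a f n = trans (const-⊛ a (X ⊛ f) (suc n)) (*-congˡ (X-⊛-suc f n))

      D₀ : ∀ f → (D ⊛ f) 0 ≈ f 0
      D₀ f = trans (at (D-⊛ f) 0)
        (trans (+-cong (+-congˡ (-‿cong (+-cong (const-X₀ _ f) (const-X₀ _ f)))) (const-X₀ _ (X ⊛ f)))
          (solve 1 (λ a → a :- (𝟘 :+ 𝟘) :+ 𝟘 := a) refl (f 0)))

      D₁ : ∀ f → (D ⊛ f) 1 ≈ f 1 - ((1# + x) * f 0 + (1# + x) * f 0)
      D₁ f = trans (at (D-⊛ f) 1)
        (trans (+-cong (+-congˡ (-‿cong (+-cong (const-X _ f 0) (const-X _ f 0))))
                       (trans (const-X _ (X ⊛ f) 0) (trans (*-congˡ (at (X-⊛ f) 0)) (zeroʳ _))))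
          (+-identityʳ _))

      D₂ : ∀ f n → (D ⊛ f) (suc (suc n)) ≈
             f (suc (suc n)) - ((1# + x) * f (suc n) + (1# + x) * f (suc n)) + c * c * f n
      D₂ f n = trans (at (D-⊛ f) (suc (suc n)))
        (+-cong (+-congˡ (-‿cong (+-cong (const-X _ f (suc n)) (const-X _ f (suc n)))))
                (trans (const-X _ (X ⊛ f) (suc n)) (*-congˡ (X-⊛-suc f n))))

      linear-⊛ : ∀ f → (1̂ ⊕ ⊖ (ρ ⊛ X)) ⊛ f ≋ f ⊕ ⊖ (ρ ⊛ (X ⊛ f))
      linear-⊛ f = SI.solve 3 (λ r z f → (SI.𝟙 SI.:+ SI.:- (r SI.:* z)) SI.:* f
                    SI.:= f SI.:+ SI.:- (r SI.:* (z SI.:* f))) S.refl ρ X f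

      L₀ : ∀ f → ((1̂ ⊕ ⊖ (ρ ⊛ X)) ⊛ f) 0 ≈ f 0
      L₀ f = trans (at (linear-⊛ f) 0) (trans (+-congˡ (-‿cong (const-X₀ _ f)))
        (solve 1 (λ a → a :- 𝟘 := a) refl (f 0)))

      L₁ : ∀ f n → ((1̂ ⊕ ⊖ (ρ ⊛ X)) ⊛ f) (suc n) ≈ f (suc n) - (1# + x) * f n
      L₁ f n = trans (at (linear-⊛ f) (suc n)) (+-congˡ (-‿cong (const-X _ f n)))

      -- The recurrence `γ-rec`, summed over k. It is the first-order equation satisfied by z
      -- divided by the square root of D, and stands in for that closed form.
      γ-ode : D ⊛ ϑ γ ≋ (1̂ ⊕ ⊖ (ρ ⊛ X)) ⊛ γ
      γ-ode = mk λ
        { zero → trans (D₀ (ϑ γ)) (trans (zeroˡ _) (sym (trans (L₀ γ) γ₀)))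
        ; (suc zero) → trans (D₁ (ϑ γ)) (trans
            (solve 3 (λ x a b → (𝟙 :+ 𝟘) :* b :- ((𝟙 :+ x) :* (𝟘 :* a) :+ (𝟙 :+ x) :* (𝟘 :* a))
                := b :- (𝟙 :+ x) :* 𝟘) refl x (γ 0) (γ 1))
            (sym (trans (L₁ γ 0) (+-congˡ (-‿cong (*-congˡ γ₀))))))
        ; (suc (suc k)) → trans (D₂ (ϑ γ) k) (trans
            (trans (solve 6 (λ c x k p q r →
                 (𝟙 :+ (𝟙 :+ k)) :* p :- ((𝟙 :+ x) :* ((𝟙 :+ k) :* q) :+ (𝟙 :+ x) :* ((𝟙 :+ k) :* q)) :+ c :* c :* (k :* r)
                 := ((𝟙 :+ k) :* p :+ c :* c :* (k :* r)) :+ (p :- (𝟙 :+ x) :* q :- (𝟙 :+ x) :* ((𝟙 :+ k :+ k) :* q))) refl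
                 c x (ι k) (γ (suc (suc k))) (γ (suc k)) (γ k))
            (trans (+-congʳ (γ-rec k))
              (solve 2 (λ a b → a :+ (b :- a) := b) refl _ _)))
            (sym (L₁ γ (suc k))))
        }

      ϑ-scale : ∀ a f → ϑ (const a ⊛ f) ≋ const a ⊛ ϑ f
      ϑ-scale a f = S.trans (ϑ-⊛ (const a) f) (S.trans (S.+-congʳ (S.trans (S.*-congʳ (ϑ-const a)) (S.zeroˡ f))) (S.+-identityˡ _))

      ϑ-neg : ∀ f → ϑ (⊖ f) ≋ ⊖ ϑ f
      ϑ-neg f = mk λ n → solve 2 (λ a b → a :* (:- b) := :- (a :* b)) refl _ _

      ϑD : ϑ D ≋ ⊖ ((ρ ⊕ ρ) ⊛ X) ⊕ (κ ⊛ (X ⊛ X) ⊕ κ ⊛ (X ⊛ X))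
      ϑD = S.trans (ϑ-+ _ _) (S.+-cong
        (S.trans (ϑ-+ _ _) (S.trans (S.+-cong (ϑ-const 1#)
          (S.trans (ϑ-neg _) (S.-‿cong (S.trans (ϑ-cong (S.distribʳ X ρ ρ)) (S.trans (ϑ-+ _ _)
             (S.trans (S.+-cong ρX ρX) (S.sym (S.distribʳ X ρ ρ))))))))
          (S.+-identityˡ _)))
        (S.trans (ϑ-scale _ _) (S.trans (S.*-congˡ (S.trans (ϑ-⊛ X X) (S.+-cong (S.*-congʳ ϑ-X) (S.*-congˡ ϑ-X))))
          (S.distribˡ _ _ _))))
        where
        ρX : ϑ (ρ ⊛ X) ≋ ρ ⊛ X
        ρX = S.trans (ϑ-scale _ X) (S.*-congˡ ϑ-X)

      γ² : Series
      γ² = γ ⊛ γ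

      γ²₀ : γ² 0 ≈ 0#
      γ²₀ = trans (*-congʳ γ₀) (zeroˡ _)

      γ²₁ : γ² 1 ≈ 0#
      γ²₁ = trans (+-cong (*-congʳ γ₀) (*-congˡ γ₀)) (solve 1 (λ a → 𝟘 :* a :+ a :* 𝟘 := 𝟘) refl _)

      γ²₂ : γ² 2 ≈ 1#
      γ²₂ = trans (+-cong (*-congʳ γ₀) (+-cong (*-cong γ₁ γ₁) (*-congˡ γ₀)))
        (solve 1 (λ a → 𝟘 :* a :+ (𝟙 :* 𝟙 :+ a :* 𝟘) := 𝟙) refl _)

      -- Says that `D ⊛ γ²` is homogeneous of degree 2, since ϑ multiplies it by 2. It is therefore
      -- a multiple of z², and only one coefficient remains to be computed.
      ϑ[Dγ²] : ϑ (D ⊛ γ²) ≋ D ⊛ γ² ⊕ D ⊛ γ²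
      ϑ[Dγ²] = begin
        ϑ (D ⊛ γ²)
          ≈⟨ ϑ-⊛ D γ² ⟩
        ϑ D ⊛ γ² ⊕ D ⊛ ϑ γ²
          ≈⟨ S.+-cong (S.*-congʳ ϑD) (S.*-congˡ (ϑ-⊛ γ γ)) ⟩
        (⊖ ((ρ ⊕ ρ) ⊛ X) ⊕ (κ ⊛ (X ⊛ X) ⊕ κ ⊛ (X ⊛ X))) ⊛ γ² ⊕ D ⊛ (ϑ γ ⊛ γ ⊕ γ ⊛ ϑ γ)
          ≈⟨ S.+-congˡ (SI.solve 3 (λ d t g → d SI.:* (t SI.:* g SI.:+ g SI.:* t) SI.:= (d SI.:* t) SI.:* (g SI.:+ g)) S.refl D (ϑ γ) γ) ⟩
        (⊖ ((ρ ⊕ ρ) ⊛ X) ⊕ (κ ⊛ (X ⊛ X) ⊕ κ ⊛ (X ⊛ X))) ⊛ γ² ⊕ (D ⊛ ϑ γ) ⊛ (γ ⊕ γ)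
          ≈⟨ S.+-congˡ (S.*-congʳ γ-ode) ⟩
        (⊖ ((ρ ⊕ ρ) ⊛ X) ⊕ (κ ⊛ (X ⊛ X) ⊕ κ ⊛ (X ⊛ X))) ⊛ γ² ⊕ ((1̂ ⊕ ⊖ (ρ ⊛ X)) ⊛ γ) ⊛ (γ ⊕ γ)
          ≈⟨ SI.solve 4 (λ r k z g →
               (SI.:- ((r SI.:+ r) SI.:* z) SI.:+ (k SI.:* (z SI.:* z) SI.:+ k SI.:* (z SI.:* z))) SI.:* (g SI.:* g)
                 SI.:+ ((SI.𝟙 SI.:+ SI.:- (r SI.:* z)) SI.:* g) SI.:* (g SI.:+ g)
               SI.:= (SI.𝟙 SI.:+ SI.:- ((r SI.:+ r) SI.:* z) SI.:+ k SI.:* (z SI.:* z)) SI.:* (g SI.:* g)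
                 SI.:+ (SI.𝟙 SI.:+ SI.:- ((r SI.:+ r) SI.:* z) SI.:+ k SI.:* (z SI.:* z)) SI.:* (g SI.:* g))
               S.refl ρ κ X γ ⟩
        D ⊛ γ² ⊕ D ⊛ γ² ∎
        where open SR

      Dγ²≋X² : D ⊛ γ² ≋ X ⊛ X
      Dγ²≋X² = S.trans (mk coefficient) (S.sym (X-⊛ X))
        where
        coefficient : ∀ n → (D ⊛ γ²) n ≈ (0# ◂ X) n
        coefficient zero             = trans (D₀ γ²) γ²₀
        coefficient (suc zero)       = trans (D₁ γ²) (trans (+-cong γ²₁ (-‿cong (+-cong (*-congˡ γ²₀) (*-congˡ γ²₀))))
          (solve 1 (λ x → 𝟘 :- ((𝟙 :+ x) :* 𝟘 :+ (𝟙 :+ x) :* 𝟘) := 𝟘) refl x))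
        coefficient (suc (suc zero)) = trans (D₂ γ² 0) (trans
          (+-cong (+-cong γ²₂ (-‿cong (+-cong (*-congˡ γ²₁) (*-congˡ γ²₁)))) (*-congˡ γ²₀))
          (solve 2 (λ x d → 𝟙 :- ((𝟙 :+ x) :* 𝟘 :+ (𝟙 :+ x) :* 𝟘) :+ d :* 𝟘 := 𝟙) refl x _))
        -- Homogeneity gives (n + 3) y = 2y, that is (n + 1) y = 0.
        coefficient (suc (suc (suc n))) = ι-cancel n (trans
          (solve 2 (λ k y → (𝟙 :+ k) :* y := (𝟙 :+ (𝟙 :+ (𝟙 :+ k))) :* y :- (y :+ y)) refl (ι n) y)
          (trans (+-congʳ (at ϑ[Dγ²] (suc (suc (suc n))))) (-‿inverseʳ _)))
          where y = (D ⊛ γ²) (suc (suc (suc n)))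

    ⊛-vanish : ∀ f g n → (∀ m → m ℕ.≤ n → g m ≈ 0#) → (f ⊛ g) n ≈ 0#
    ⊛-vanish f g zero    p = trans (*-congˡ (p 0 z≤n)) (zeroʳ _)
    ⊛-vanish f g (suc n) p = trans (+-cong (trans (*-congˡ (p (suc n) ℕ.≤-refl)) (zeroʳ _))
        (⊛-vanish (tail f) g n (λ m m≤n → p m (ℕ.m≤n⇒m≤1+n m≤n)))) (+-identityˡ 0#)

    -- ϑ f = t γ f is solved by f₀ exp (t ∫ γ/z), hence determined by f₀.
    Exponential : Carrier → Series → Set
    Exponential t f = ϑ f ≋ const t ⊛ (γ ⊛ f)

    private
      -- Because γ₀ = 0, coefficient m + 1 of `γ ⊛ f` involves only f₀, ..., fₘ. The equation thus
      -- expresses (m + 1) fₘ₊₁ through earlier coefficients. The bound `n` in `below` serves strong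
      -- induction.
      exponential-zero : ∀ {t f} → Exponential t f → f 0 ≈ 0# → f ≋ 𝟎
      exponential-zero {t} {f} ode f₀ = mk λ n → below n n ℕ.≤-refl
        where
        below : ∀ n m → m ℕ.≤ n → f m ≈ 0#
        below n       zero    _         = f₀
        below (suc n) (suc m) (s≤s m≤n) = ι-cancel m (trans (at ode (suc m)) (trans (const-⊛ t (γ ⊛ f) (suc m))
          (trans (*-congˡ (trans (+-cong (trans (*-congʳ γ₀) (zeroˡ _))
              (⊛-vanish (tail γ) f m (λ k k≤m → below n k (ℕ.≤-trans k≤m m≤n)))) (+-identityˡ 0#)))
            (zeroʳ t))))

    exponential-unique : ∀ {s t f g} → s ≈ t → Exponential s f → Exponential t g → f 0 ≈ g 0 → f ≋ g
    exponential-unique {s} {t} {f} {g} s≈t odef odeg f₀≈g₀ = mk λ n → trans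
        (solve 2 (λ a b → a := (a :- b) :+ b) refl (f n) (g n))
        (trans (+-congʳ (at difference n)) (+-identityˡ _))
      where
      difference : f ⊕ ⊖ g ≋ 𝟎
      difference = exponential-zero {t}
        (S.trans (ϑ-+ f (⊖ g)) (S.trans (S.+-cong (S.trans odef (S.*-congʳ (const-cong s≈t))) (S.trans (ϑ-neg g) (S.-‿cong odeg)))
          (SI.solve 4 (λ t γ f g → t SI.:* (γ SI.:* f) SI.:+ SI.:- (t SI.:* (γ SI.:* g)) SI.:= t SI.:* (γ SI.:* (f SI.:+ SI.:- g)))
            S.refl (const t) γ f g)))
        (trans (+-congʳ f₀≈g₀) (-‿inverseʳ _))

    exponential-* : ∀ {s t f g} → Exponential s f → Exponential t g → Exponential (s + t) (f ⊛ g)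
    exponential-* {s} {t} {f} {g} odef odeg = S.trans (ϑ-⊛ f g) (S.trans
      (S.+-cong (S.*-congʳ odef) (S.*-congˡ odeg))
      (S.trans (SI.solve 5 (λ s t γ f g → (s SI.:* (γ SI.:* f)) SI.:* g SI.:+ f SI.:* (t SI.:* (γ SI.:* g))
            SI.:= (s SI.:+ t) SI.:* (γ SI.:* (f SI.:* g))) S.refl (const s) (const t) γ f g)
        (S.*-congʳ (S.sym (const-+ s t)))))

    exponential-1 : Exponential 0# S.1#
    exponential-1 = S.trans (ϑ-const 1#) (S.sym (S.trans (S.*-congʳ (mk λ { zero → refl ; (suc n) → refl })) (S.zeroˡ _)))

    module Family
      (F : Carrier → Series) (F₀ : ∀ t → F t 0 ≈ 1#) (F-exp : ∀ t → Exponential t (F t)) where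

      F-+ : ∀ s t → F s ⊛ F t ≋ F (s + t)
      F-+ s t = exponential-unique refl (exponential-* (F-exp s) (F-exp t)) (F-exp (s + t))
        (trans (*-cong (F₀ s) (F₀ t)) (trans (*-identityˡ 1#) (sym (F₀ _))))

      -- `F` is an arbitrary function on `Carrier`, so its compatibility with `_≈_` has to come from
      -- uniqueness of solutions.
      F-cong : ∀ {s t} → s ≈ t → F s ≋ F t
      F-cong {s} {t} s≈t = exponential-unique s≈t (F-exp s) (F-exp t) (trans (F₀ s) (sym (F₀ t)))

      private
        G G⁻ : Series
        G  = F c
        G⁻ = F (- c)

        -- K vanishes since (K , K′) solves the system ϑK = c K′, D ϑK′ = (1 - (1 + x)z) K′ + c z² K,
        -- which determines both series from K₀, K′₀ and K′₁.
        K K′ : Series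
        K  = ρ ⊕ ⊖ (x̂ ⊛ G) ⊕ ⊖ G⁻ ⊕ ⊖ (κ ⊛ X)
        K′ = γ ⊛ (G⁻ ⊕ ⊖ (x̂ ⊛ G)) ⊕ ⊖ (ĉ ⊛ X)

        ϑG⁻ : ϑ G⁻ ≋ ⊖ ĉ ⊛ (γ ⊛ G⁻)
        ϑG⁻ = S.trans (F-exp (- c)) (S.*-congʳ (const-neg c))

        ϑG : ϑ G ≋ ĉ ⊛ (γ ⊛ G)
        ϑG = F-exp c

        ϑK : ϑ K ≋ ĉ ⊛ K′
        ϑK = begin
          ϑ K
            ≈⟨ S.trans (ϑ-+ _ _) (S.+-cong (S.trans (ϑ-+ _ _) (S.+-cong (S.trans (ϑ-+ _ _) (S.+-cong
                (ϑ-const _) (S.trans (ϑ-neg _) (S.-‿cong (S.trans (ϑ-scale _ _) (S.*-congˡ ϑG))))))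
                (S.trans (ϑ-neg _) (S.-‿cong ϑG⁻))))
                (S.trans (ϑ-neg _) (S.-‿cong (S.trans (ϑ-scale _ _) (S.*-cong κ≋ ϑ-X))))) ⟩
          𝟎 ⊕ ⊖ (x̂ ⊛ (ĉ ⊛ (γ ⊛ G))) ⊕ ⊖ (⊖ ĉ ⊛ (γ ⊛ G⁻)) ⊕ ⊖ (ĉ ⊛ ĉ ⊛ X)
            ≈⟨ SI.solve 6 (λ x c γ g h z →
                 SI.𝟘 SI.:+ SI.:- (x SI.:* (c SI.:* (γ SI.:* g))) SI.:+ SI.:- (SI.:- c SI.:* (γ SI.:* h)) SI.:+ SI.:- (c SI.:* c SI.:* z)
                 SI.:= c SI.:* (γ SI.:* (h SI.:+ SI.:- (x SI.:* g)) SI.:+ SI.:- (c SI.:* z))) S.refl x̂ ĉ γ G G⁻ X ⟩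
          ĉ ⊛ K′ ∎
          where open SR

        DϑK′ : D ⊛ ϑ K′ ≋ (1̂ ⊕ ⊖ (ρ ⊛ X)) ⊛ K′ ⊕ ĉ ⊛ (X ⊛ (X ⊛ K))
        DϑK′ = begin
          D ⊛ ϑ K′
            ≈⟨ S.*-congˡ (S.trans (ϑ-+ _ _) (S.+-cong (S.trans (ϑ-⊛ _ _) (S.+-congˡ (S.*-congˡ
                 (S.trans (ϑ-+ _ _) (S.+-cong ϑG⁻ (S.trans (ϑ-neg _) (S.-‿cong (S.trans (ϑ-scale _ _) (S.*-congˡ ϑG)))))))))
                 (S.trans (ϑ-neg _) (S.-‿cong (S.trans (ϑ-scale _ _) (S.*-congˡ ϑ-X)))))) ⟩
          D ⊛ (ϑ γ ⊛ U ⊕ γ ⊛ (⊖ ĉ ⊛ (γ ⊛ G⁻) ⊕ ⊖ (x̂ ⊛ (ĉ ⊛ (γ ⊛ G)))) ⊕ ⊖ (ĉ ⊛ X))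
            ≈⟨ SI.solve 9 (λ d t u γ c g h x z →
                 d SI.:* (t SI.:* u SI.:+ γ SI.:* (SI.:- c SI.:* (γ SI.:* h) SI.:+ SI.:- (x SI.:* (c SI.:* (γ SI.:* g)))) SI.:+ SI.:- (c SI.:* z))
                 SI.:= (d SI.:* t) SI.:* u SI.:+ SI.:- (c SI.:* (d SI.:* (γ SI.:* γ)) SI.:* (h SI.:+ x SI.:* g)) SI.:+ SI.:- (d SI.:* (c SI.:* z)))
                 S.refl D (ϑ γ) U γ ĉ G G⁻ x̂ X ⟩
          (D ⊛ ϑ γ) ⊛ U ⊕ ⊖ (ĉ ⊛ (D ⊛ γ²) ⊛ (G⁻ ⊕ x̂ ⊛ G)) ⊕ ⊖ (D ⊛ (ĉ ⊛ X))
            -- The step that closes the system: γ² occurs only multiplied by D, so it becomes the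
            -- monomial z², and what is left is linear in K and K′.
            ≈⟨ S.+-congʳ (S.+-cong (S.*-congʳ γ-ode) (S.-‿cong (S.*-congʳ (S.*-congˡ Dγ²≋X²)))) ⟩
          ((1̂ ⊕ ⊖ (ρ ⊛ X)) ⊛ γ) ⊛ U ⊕ ⊖ (ĉ ⊛ (X ⊛ X) ⊛ (G⁻ ⊕ x̂ ⊛ G)) ⊕ ⊖ (D ⊛ (ĉ ⊛ X))
            ≈⟨ SI.solve 8 (λ r k γ c g h x z →
                 ((SI.𝟙 SI.:+ SI.:- (r SI.:* z)) SI.:* γ) SI.:* (h SI.:+ SI.:- (x SI.:* g))
                   SI.:+ SI.:- (c SI.:* (z SI.:* z) SI.:* (h SI.:+ x SI.:* g))
                   SI.:+ SI.:- ((SI.𝟙 SI.:+ SI.:- ((r SI.:+ r) SI.:* z) SI.:+ k SI.:* (z SI.:* z)) SI.:* (c SI.:* z))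
                 SI.:= (SI.𝟙 SI.:+ SI.:- (r SI.:* z)) SI.:* (γ SI.:* (h SI.:+ SI.:- (x SI.:* g)) SI.:+ SI.:- (c SI.:* z))
                   SI.:+ c SI.:* (z SI.:* (z SI.:* (r SI.:+ SI.:- (x SI.:* g) SI.:+ SI.:- h SI.:+ SI.:- (k SI.:* z)))))
                 S.refl ρ κ γ ĉ G G⁻ x̂ X ⟩
          (1̂ ⊕ ⊖ (ρ ⊛ X)) ⊛ K′ ⊕ ĉ ⊛ (X ⊛ (X ⊛ K)) ∎
          where
          open SR
          U : Series
          U = G⁻ ⊕ ⊖ (x̂ ⊛ G)

        Kₙ : ∀ n → K′ (suc n) ≈ 0# → K (suc n) ≈ 0#
        Kₙ n p = ι-cancel n (trans (at ϑK (suc n)) (trans (const-⊛ c K′ (suc n)) (trans (*-congˡ p) (zeroʳ c))))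

        -- The factor D reaches back two indices, so two consecutive ones are carried along. Once
        -- these vanish, degree n + 2 of `DϑK′` reads (n + 2) K′ₙ₊₂ = K′ₙ₊₂, which kills K′ₙ₊₂ in a
        -- torsion-free ring, and `ϑK` then kills Kₙ₊₂.
        K≈0 : ∀ n → (K n ≈ 0# × K′ n ≈ 0#) × (K (suc n) ≈ 0# × K′ (suc n) ≈ 0#)
        K≈0 zero = (K₀ , K′₀) , (Kₙ 0 K′₁ , K′₁)
          where
          K₀ : K 0 ≈ 0#
          K₀ = trans (+-cong (+-cong (+-congˡ (-‿cong (*-congˡ (F₀ c)))) (-‿cong (F₀ (- c)))) (-‿cong (zeroʳ _)))
            (solve 1 (λ x → 𝟙 :+ x :+ :- (x :* 𝟙) :+ :- 𝟙 :+ :- 𝟘 := 𝟘) refl x)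
          K′₀ : K′ 0 ≈ 0#
          K′₀ = trans (+-cong (trans (*-congʳ γ₀) (zeroˡ _)) (-‿cong (zeroʳ c)))
            (solve 0 (𝟘 :+ :- 𝟘 := 𝟘) refl)
          -- In degree 1 the system only says K′₁ = K′₁, so this value is computed directly. It
          -- vanishes because γ₁ (1 - x) = c.
          K′₁ : K′ 1 ≈ 0#
          K′₁ = trans (+-cong (+-cong (trans (*-congʳ γ₀) (zeroˡ _)) (*-cong γ₁ (+-cong (F₀ (- c)) (-‿cong (*-congˡ (F₀ c))))))
                              (-‿cong (+-cong refl (zeroˡ _))))
            (solve 1 (λ x → 𝟘 :+ 𝟙 :* (𝟙 :+ :- (x :* 𝟙)) :+ :- ((𝟙 :- x) :* 𝟙 :+ 𝟘) := 𝟘) refl x)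
        K≈0 (suc n) with K≈0 n
        ... | (Kn , K′n) , (Kn₁ , K′n₁) = (Kn₁ , K′n₁) , (Kₙ (suc n) K′₂ , K′₂)
          where
          equation : (1# + (1# + ι n)) * K′ (suc (suc n)) ≈ K′ (suc (suc n))
          equation = begin
            ϑ K′ (suc (suc n))
              ≈⟨ solve 3 (λ p q r → p := (p :- (q :+ q) :+ r) :+ (q :+ q :- r)) refl _ ((1# + x) * ϑ K′ (suc n)) (c * c * ϑ K′ n) ⟩
            (ϑ K′ (suc (suc n)) - ((1# + x) * ϑ K′ (suc n) + (1# + x) * ϑ K′ (suc n)) + c * c * ϑ K′ n)
              + ((1# + x) * ϑ K′ (suc n) + (1# + x) * ϑ K′ (suc n) - c * c * ϑ K′ n)
              ≈⟨ +-congʳ (trans (sym (D₂ (ϑ K′) n)) (at DϑK′ (suc (suc n)))) ⟩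
            ((1̂ ⊕ ⊖ (ρ ⊛ X)) ⊛ K′) (suc (suc n)) + (ĉ ⊛ (X ⊛ (X ⊛ K))) (suc (suc n))
              + ((1# + x) * ϑ K′ (suc n) + (1# + x) * ϑ K′ (suc n) - c * c * ϑ K′ n)
              ≈⟨ +-cong (+-cong (trans (L₁ K′ (suc n)) (+-congˡ (-‿cong (*-congˡ K′n₁))))
                     (trans (const-X c (X ⊛ K) (suc n)) (*-congˡ (trans (X-⊛-suc K n) Kn))))
                   (+-cong (+-cong (*-congˡ (*-congˡ K′n₁)) (*-congˡ (*-congˡ K′n₁))) (-‿cong (*-congˡ (*-congˡ K′n)))) ⟩
            K′ (suc (suc n)) - (1# + x) * 0# + c * 0#
              + ((1# + x) * (ι (suc n) * 0#) + (1# + x) * (ι (suc n) * 0#) - c * c * (ι n * 0#))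
              ≈⟨ solve 5 (λ k x c m n → k :- (𝟙 :+ x) :* 𝟘 :+ c :* 𝟘
                   :+ ((𝟙 :+ x) :* (m :* 𝟘) :+ (𝟙 :+ x) :* (m :* 𝟘) :- c :* c :* (n :* 𝟘)) := k)
                   refl (K′ (suc (suc n))) x c (ι (suc n)) (ι n) ⟩
            K′ (suc (suc n)) ∎
            where open ≈R
          K′₂ : K′ (suc (suc n)) ≈ 0#
          K′₂ = ι-cancel n (trans
            (solve 2 (λ k y → (𝟙 :+ k) :* y := (𝟙 :+ (𝟙 :+ k)) :* y :- y) refl (ι n) _)
            (trans (+-congʳ equation) (-‿inverseʳ _)))

      -- The coefficient of zⁿ⁺¹ in `K ⊛ F t ≋ 𝟎`. By the exponential law `F-+`, multiplication by
      -- `G` and `G⁻` shifts the argument t by c and - c.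
      difference-equation : ∀ t n →
        c * c * F t n ≈ (1# + x) * F t (suc n) - x * F (t + c) (suc n) - F (t - c) (suc n)
      difference-equation t n = begin
        c * c * F t n
          ≈⟨ solve 4 (λ p q r s → s := p :- q :- r :- (p :+ :- q :+ :- r :+ :- s)) refl
               ((1# + x) * F t (suc n)) (x * F (t + c) (suc n)) (F (t - c) (suc n)) _ ⟩
        rhs - ((1# + x) * F t (suc n) + - (x * F (t + c) (suc n)) + - F (t - c) (suc n) + - (c * c * F t n))
          ≈⟨ +-congˡ (-‿cong (trans (sym expanded) (at vanishing (suc n)))) ⟩
        rhs - 0#
          ≈⟨ solve 1 (λ a → a :- 𝟘 := a) refl _ ⟩
        rhs ∎
        where
        open ≈R
        rhs = (1# + x) * F t (suc n) - x * F (t + c) (suc n) - F (t - c) (suc n)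
        vanishing : K ⊛ F t ≋ 𝟎
        vanishing = S.trans (S.*-congʳ (mk λ n → proj₁ (proj₁ (K≈0 n)))) (S.zeroˡ _)
        expand : K ⊛ F t ≋ ρ ⊛ F t ⊕ ⊖ (x̂ ⊛ F (t + c)) ⊕ ⊖ F (t - c) ⊕ ⊖ (κ ⊛ (X ⊛ F t))
        expand = S.trans
          (SI.solve 7 (λ r k g h x z f → (r SI.:+ SI.:- (x SI.:* g) SI.:+ SI.:- h SI.:+ SI.:- (k SI.:* z)) SI.:* f
             SI.:= r SI.:* f SI.:+ SI.:- (x SI.:* (f SI.:* g)) SI.:+ SI.:- (f SI.:* h) SI.:+ SI.:- (k SI.:* (z SI.:* f)))
             S.refl ρ κ G G⁻ x̂ X (F t))
          (S.+-congʳ (S.+-cong (S.+-congˡ (S.-‿cong (S.*-congˡ (F-+ t c)))) (S.-‿cong (F-+ t (- c)))))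
        expanded : (K ⊛ F t) (suc n) ≈ (1# + x) * F t (suc n) + - (x * F (t + c) (suc n)) + - F (t - c) (suc n) + - (c * c * F t n)
        expanded = trans (at expand (suc n)) (+-cong (+-cong (+-cong (const-⊛ _ (F t) (suc n)) (-‿cong (const-⊛ x (F (t + c)) (suc n)))) refl)
          (-‿cong (const-X (c * c) (F t) n)))

-- Finite sums and products over lists

allFin-suc : ∀ n → allFin (suc n) ≡ zero ∷ map suc (allFin n)
allFin-suc n = ≡.cong (zero ∷_) (≡.sym (List.map-tabulate (λ i → i) suc))

module _ {a b p} {A : Set a} {B : Set b} {P : Pred B p} (P? : Decidable P) (f : A → B) where
  filter-map : ∀ xs → filter P? (map f xs) ≡ map f (filter (P? ∘ f) xs)
  filter-map []       = ≡.refl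
  filter-map (x ∷ xs) with does (P? (f x))
  ... | true  = ≡.cong (f x ∷_) (filter-map xs)
  ... | false = filter-map xs

module BigOp {c ℓ} (M : CommutativeMonoid c ℓ) where
  open CommutativeMonoid M
  open Relation.Binary.Reasoning.Setoid setoid

  ⨁ : ∀ {a} {I : Set a} → List I → (I → Carrier) → Carrier
  ⨁ xs f = foldr (λ i s → f i ∙ s) ε xs

  module _ {a} {I : Set a} where
    ⨁-cong : ∀ (xs : List I) {f g} → (∀ i → f i ≈ g i) → ⨁ xs f ≈ ⨁ xs g
    ⨁-cong []       p = refl
    ⨁-cong (x ∷ xs) p = ∙-cong (p x) (⨁-cong xs p)

    ⨁-++ : ∀ (xs ys : List I) f → ⨁ (xs ++ ys) f ≈ ⨁ xs f ∙ ⨁ ys f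
    ⨁-++ []       ys f = sym (identityˡ _)
    ⨁-++ (x ∷ xs) ys f = trans (∙-congˡ (⨁-++ xs ys f)) (sym (assoc _ _ _))

  ⨁-map : ∀ {a b} {I : Set a} {J : Set b} (g : I → J) xs f → ⨁ (map g xs) f ≡ ⨁ xs (f ∘ g)
  ⨁-map g xs f = List.foldr-map (λ i s → f i ∙ s) g ε xs

  ⨁-cartesianProductWith : ∀ {a b c} {I : Set a} {J : Set b} {K : Set c} (g : I → J → K) xs ys f →
    ⨁ (cartesianProductWith g xs ys) f ≈ ⨁ xs (λ i → ⨁ ys (λ j → f (g i j)))
  ⨁-cartesianProductWith g []       ys f = refl
  ⨁-cartesianProductWith g (x ∷ xs) ys f = trans (⨁-++ (map (g x) ys) _ f)
    (∙-cong (reflexive (⨁-map (g x) ys f)) (⨁-cartesianProductWith g xs ys f))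

  ⨁-allFin-suc : ∀ n (f : Fin (suc n) → Carrier) → ⨁ (allFin (suc n)) f ≡ f zero ∙ ⨁ (allFin n) (f ∘ suc)
  ⨁-allFin-suc n f = ≡.trans (≡.cong (λ xs → ⨁ xs f) (allFin-suc n)) (≡.cong (f zero ∙_) (⨁-map suc (allFin n) f))

module RingSums (R : CommutativeRing 0ℓ 0ℓ) where
  open CommutativeRing R
  open BigOp +-commutativeMonoid public
  open IntegerCoefficients R

  ⨁-*ˡ : ∀ {I : Set} (xs : List I) a f → ⨁ xs (λ i → a * f i) ≈ a * ⨁ xs f
  ⨁-*ˡ []       a f = sym (zeroʳ a)
  ⨁-*ˡ (x ∷ xs) a f = trans (+-congˡ (⨁-*ˡ xs a f)) (sym (distribˡ a _ _))

  ⨁-*ʳ : ∀ {I : Set} (xs : List I) a f → ⨁ xs (λ i → f i * a) ≈ ⨁ xs f * a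
  ⨁-*ʳ []       a f = sym (zeroˡ a)
  ⨁-*ʳ (x ∷ xs) a f = trans (+-congˡ (⨁-*ʳ xs a f)) (sym (distribʳ a _ _))

  ⨁-const : ∀ n a → ⨁ (allFin n) (λ _ → a) ≈ ι n * a
  ⨁-const zero    a = sym (zeroˡ a)
  ⨁-const (suc n) a = trans (reflexive (⨁-allFin-suc n (λ _ → a)))
    (trans (+-cong (sym (*-identityˡ a)) (⨁-const n a)) (sym (distribʳ a 1# (ι n))))

-- Descents when a first letter is prepended

insert-descent : ∀ {n} (j : Fin (suc (suc n))) (i : Fin (suc n)) → ℕ
insert-descent j i = if does (punchIn j i Fin.<? j) then 1 else 0

private
  punchIn-< : ∀ {n} (j : Fin (suc n)) {a b} → a Fin.< b → punchIn j a Fin.< punchIn j b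
  punchIn-< j {a} {b} a<b = ℕ.≰⇒> (λ q → ℕ.<⇒≱ a<b (Fin.punchIn-cancel-≤ j b a q))

  punchIn-<⁻ : ∀ {n} (j : Fin (suc n)) {a b} → punchIn j a Fin.< punchIn j b → a Fin.< b
  punchIn-<⁻ j {a} {b} q = ℕ.≰⇒> (λ b≤a → ℕ.<⇒≱ q (Fin.punchIn-mono-≤ j b a b≤a))

des-insert : ∀ {n} (j : Fin (suc (suc n))) (π : Permutation′ (suc n)) →
  des (insert zero j π) ≡ insert-descent j (π ⟨$⟩ʳ zero) ℕ.+ des π
des-insert {n} j π = begin
  length (filter Q? (allFin (suc n)))
    ≡⟨ ≡.cong (length ∘ filter Q?) (allFin-suc n) ⟩
  length (filter Q? (zero ∷ map suc (allFin n)))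
    ≡⟨ first ⟩
  insert-descent j (π ⟨$⟩ʳ zero) ℕ.+ length (filter Q? (map suc (allFin n)))
    ≡⟨ ≡.cong (insert-descent j (π ⟨$⟩ʳ zero) ℕ.+_) rest ⟩
  insert-descent j (π ⟨$⟩ʳ zero) ℕ.+ des π ∎
  where
  open ≡.≡-Reasoning
  w = insert zero j π
  Q? : Decidable (λ i → w ⟨$⟩ʳ suc i Fin.< w ⟨$⟩ʳ inject₁ i)
  Q? i = w ⟨$⟩ʳ suc i Fin.<? w ⟨$⟩ʳ inject₁ i
  first : length (filter Q? (zero ∷ map suc (allFin n))) ≡ insert-descent j (π ⟨$⟩ʳ zero) ℕ.+ length (filter Q? (map suc (allFin n)))
  first with does (punchIn j (π ⟨$⟩ʳ zero) Fin.<? j)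
  ... | true  = ≡.refl
  ... | false = ≡.refl
  rest : length (filter Q? (map suc (allFin n))) ≡ des π
  rest = ≡.trans (≡.cong length (filter-map Q? suc (allFin n)))
    (≡.trans (List.length-map suc (filter (Q? ∘ suc) (allFin n)))
      (≡.cong length (List.filter-≐ (Q? ∘ suc) (λ i → π ⟨$⟩ʳ suc i Fin.<? π ⟨$⟩ʳ inject₁ i)
        (punchIn-<⁻ j , punchIn-< j) (allFin n))))

-- Eulerian polynomials as series over the nodes, and the exchange of degrees

module Eulerian (Q : CommutativeRing 0ℓ 0ℓ) where
  open PowerSeries Q hiding (commutativeRing)
  private A = PowerSeries.commutativeRing Q
  open CommutativeRing A hiding (zero)
  open Algebra.Properties.Semiring.Exp semiring using (_^_; ^-homo-*)
  open IntegerCoefficients A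
  open RingSums A
  open Relation.Binary.Reasoning.Setoid setoid

  Σ∞-⨁ : ∀ {I : Set} (xs : List I) (f : I → ℕ → Carrier) →
    Σ∞ (λ m → ⨁ xs (λ i → f i m)) ≈ ⨁ xs (λ i → Σ∞ (f i))
  Σ∞-⨁ []       f = Σ∞-𝟎
  Σ∞-⨁ (x ∷ xs) f = trans (Σ∞-+ (f x) (λ m → ⨁ xs (λ i → f i m))) (+-congˡ (Σ∞-⨁ xs f))

  c : Carrier
  c = 1# - X

  -- The Eulerian polynomial of n + 1 letters restricted to first letter `j`. Whether a newly
  -- prepended letter creates a descent depends only on the old first letter, so this refinement
  -- satisfies a recursion. The unrefined polynomial for n letters is the case `j = zero`, as a
  -- leading minimum creates no descent.
  firstLetter : ∀ n → Fin (suc n) → Carrier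
  firstLetter n j = ⨁ (permutations n) (λ π → X ^ des (insert zero j π))

  private
    weight : ∀ {n} → Fin (suc (suc n)) → Fin (suc n) → Carrier
    weight j i = X ^ insert-descent j i

    firstLetter-suc : ∀ n (j : Fin (suc (suc n))) →
      firstLetter (suc n) j ≈ ⨁ (allFin (suc n)) (λ i → weight j i * firstLetter n i)
    firstLetter-suc n j = trans
      (⨁-cartesianProductWith (insert zero) (allFin (suc n)) (permutations n) _)
      (⨁-cong (allFin (suc n)) λ i → trans
        (⨁-cong (permutations n) λ ρ → trans
          (reflexive (≡.cong (X ^_) (des-insert j (insert zero i ρ))))
          (^-homo-* X (insert-descent j i) (des (insert zero i ρ))))
        (⨁-*ˡ (permutations n) (weight j i) _))

    power : ∀ n → Carrier → Carrier → Fin (suc n) → Carrier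
    power n u v i = u ^ toℕ i * v ^ (n ∸ toℕ i)

    -- v ^ suc n - u ^ suc n is v - u times the sum of all power n u v i; the weight X on the first
    -- j summands splits this telescoping sum at power (suc n) u v j.
    telescope : ∀ {u v} → c + u ≈ v → ∀ n (j : Fin (suc (suc n))) →
      c * ⨁ (allFin (suc n)) (λ i → weight j i * power n u v i)
        ≈ c * power (suc n) u v j + (X * v ^ suc n - u ^ suc n)
    telescope {u} {v} p zero zero = begin
      c * (1# * (1# * 1#) + 0#)
        ≈⟨ solve 2 (λ x u → (𝟙 :- x) :* (𝟙 :* (𝟙 :* 𝟙) :+ 𝟘) :=
             (𝟙 :- x) :* (𝟙 :* (((𝟙 :- x) :+ u) :* 𝟙)) :+ (x :* (((𝟙 :- x) :+ u) :* 𝟙) :- u :* 𝟙)) refl X u ⟩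
      c * (1# * ((c + u) * 1#)) + (X * ((c + u) * 1#) - u * 1#)
        ≈⟨ +-cong (*-congˡ (*-congˡ (*-congʳ p))) (+-congʳ (*-congˡ (*-congʳ p))) ⟩
      c * (1# * (v * 1#)) + (X * (v * 1#) - u * 1#) ∎
    telescope {u} {v} p zero (suc zero) = begin
      c * (X * 1# * (1# * 1#) + 0#)
        ≈⟨ solve 2 (λ x u → (𝟙 :- x) :* (x :* 𝟙 :* (𝟙 :* 𝟙) :+ 𝟘) :=
             (𝟙 :- x) :* (u :* 𝟙 :* 𝟙) :+ (x :* (((𝟙 :- x) :+ u) :* 𝟙) :- u :* 𝟙)) refl X u ⟩
      c * (u * 1# * 1#) + (X * ((c + u) * 1#) - u * 1#)
        ≈⟨ +-congˡ (+-congʳ (*-congˡ (*-congʳ p))) ⟩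
      c * (u * 1# * 1#) + (X * (v * 1#) - u * 1#) ∎
    telescope {u} {v} p (suc n) zero = begin
      c * ⨁ (allFin (suc (suc n))) (λ i → 1# * power (suc n) u v i)
        ≈⟨ *-congˡ (reflexive (⨁-allFin-suc (suc n) _)) ⟩
      c * (1# * (1# * v ^ suc n) + ⨁ (allFin (suc n)) (λ i → 1# * (u * u ^ toℕ i * v ^ (n ∸ toℕ i))))
        ≈⟨ *-congˡ (+-congˡ (trans (⨁-cong (allFin (suc n)) (λ i → solve 3 (λ u a b → 𝟙 :* (u :* a :* b) := u :* (𝟙 :* (a :* b))) refl _ _ _))
             (⨁-*ˡ (allFin (suc n)) u _))) ⟩
      c * (1# * (1# * v ^ suc n) + u * ⨁ (allFin (suc n)) (λ i → 1# * power n u v i))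
        ≈⟨ solve 4 (λ c v u s → c :* (𝟙 :* (𝟙 :* v) :+ u :* s) := c :* v :+ u :* (c :* s)) refl c (v ^ suc n) u _ ⟩
      c * v ^ suc n + u * (c * ⨁ (allFin (suc n)) (λ i → 1# * power n u v i))
        ≈⟨ +-congˡ (*-congˡ (telescope p n zero)) ⟩
      c * v ^ suc n + u * (c * (1# * v ^ suc n) + (X * v ^ suc n - u ^ suc n))
        ≈⟨ solve 4 (λ x v u w → (𝟙 :- x) :* v :+ u :* ((𝟙 :- x) :* (𝟙 :* v) :+ (x :* v :- w))
             := (𝟙 :- x) :* (𝟙 :* (((𝟙 :- x) :+ u) :* v)) :+ (x :* (((𝟙 :- x) :+ u) :* v) :- u :* w)) refl X (v ^ suc n) u (u ^ suc n) ⟩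
      c * (1# * ((c + u) * v ^ suc n)) + (X * ((c + u) * v ^ suc n) - u ^ suc (suc n))
        ≈⟨ +-cong (*-congˡ (*-congˡ (*-congʳ p))) (+-congʳ (*-congˡ (*-congʳ p))) ⟩
      c * (1# * v ^ suc (suc n)) + (X * v ^ suc (suc n) - u ^ suc (suc n)) ∎
    telescope {u} {v} p (suc n) (suc j) = begin
      c * ⨁ (allFin (suc (suc n))) (λ i → weight (suc j) i * power (suc n) u v i)
        ≈⟨ *-congˡ (reflexive (⨁-allFin-suc (suc n) _)) ⟩
      c * (X * 1# * (1# * v ^ suc n) + ⨁ (allFin (suc n)) (λ i → weight j i * (u * u ^ toℕ i * v ^ (n ∸ toℕ i))))
        ≈⟨ *-congˡ (+-congˡ (trans (⨁-cong (allFin (suc n)) (λ i → solve 4 (λ w u a b → w :* (u :* a :* b) := u :* (w :* (a :* b))) refl _ _ _ _))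
             (⨁-*ˡ (allFin (suc n)) u _))) ⟩
      c * (X * 1# * (1# * v ^ suc n) + u * ⨁ (allFin (suc n)) (λ i → weight j i * power n u v i))
        ≈⟨ solve 5 (λ c v u s x → c :* (x :* 𝟙 :* (𝟙 :* v) :+ u :* s) := c :* x :* v :+ u :* (c :* s)) refl c (v ^ suc n) u _ X ⟩
      c * X * v ^ suc n + u * (c * ⨁ (allFin (suc n)) (λ i → weight j i * power n u v i))
        ≈⟨ +-congˡ (*-congˡ (telescope p n j)) ⟩
      c * X * v ^ suc n + u * (c * (u ^ toℕ j * v ^ (suc n ∸ toℕ j)) + (X * v ^ suc n - u ^ suc n))
        ≈⟨ solve 6 (λ x v u w a b → (𝟙 :- x) :* x :* v :+ u :* ((𝟙 :- x) :* (a :* b) :+ (x :* v :- w))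
             := (𝟙 :- x) :* (u :* a :* b) :+ (x :* (((𝟙 :- x) :+ u) :* v) :- u :* w)) refl X (v ^ suc n) u (u ^ suc n) _ _ ⟩
      c * (u ^ suc (toℕ j) * v ^ (suc n ∸ toℕ j)) + (X * ((c + u) * v ^ suc n) - u ^ suc (suc n))
        ≈⟨ +-congˡ (+-congʳ (*-congˡ (*-congʳ p))) ⟩
      c * (u ^ suc (toℕ j) * v ^ (suc n ∸ toℕ j)) + (X * v ^ suc (suc n) - u ^ suc (suc n)) ∎

  node : ℕ → Carrier
  node m = c * ι m

  node-suc : ∀ m → c + node m ≈ node (suc m)
  node-suc m = solve 2 (λ c k → c :+ c :* k := c :* (𝟙 :+ k)) refl c (ι m)

  Σ∞-shift : ∀ f → Σ∞ f - X * Σ∞ (λ m → f (suc m)) ≈ f 0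
  Σ∞-shift f = trans (+-congʳ (Σ∞-unfold f)) (solve 2 (λ a b → a :+ b :- b := a) refl _ _)

  -- Worpitzky's identity Σ xᵐ (m + 1)ⁿ = Eₙ / (1 - x)ⁿ⁺¹, refined by the first letter. For fixed m
  -- the sum over the next letter is geometric in two adjacent nodes and telescopes, up to a
  -- boundary term that disappears only after summation over m.
  firstLetter-series : ∀ n j → firstLetter n j ≈ c * Σ∞ (λ m → power n (node m) (node (suc m)) j)
  firstLetter-series zero zero = begin
    1# + 0#
      ≈⟨ trans (+-identityʳ 1#) (sym (*-identityˡ 1#)) ⟩
    1# * 1#
      ≈⟨ Σ∞-shift (λ _ → 1# * 1#) ⟨
    Σ∞ (λ _ → 1# * 1#) - X * Σ∞ (λ _ → 1# * 1#)
      ≈⟨ solve 2 (λ s x → s :- x :* s := (𝟙 :- x) :* s) refl _ X ⟩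
    c * Σ∞ (λ _ → 1# * 1#) ∎
  firstLetter-series (suc n) j = begin
    firstLetter (suc n) j
      ≈⟨ firstLetter-suc n j ⟩
    ⨁ (allFin (suc n)) (λ i → weight j i * firstLetter n i)
      ≈⟨ ⨁-cong (allFin (suc n)) (λ i → trans (*-congˡ (firstLetter-series n i))
           (solve 3 (λ a b d → a :* (b :* d) := b :* (a :* d)) refl _ _ _)) ⟩
    ⨁ (allFin (suc n)) (λ i → c * (weight j i * Σ∞ (λ m → power n (node m) (node (suc m)) i)))
      ≈⟨ trans (⨁-*ˡ (allFin (suc n)) c _) (*-congˡ (⨁-cong (allFin (suc n)) (λ i → sym (Σ∞-* (weight j i) _)))) ⟩
    c * ⨁ (allFin (suc n)) (λ i → Σ∞ (λ m → weight j i * power n (node m) (node (suc m)) i))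
      ≈⟨ *-congˡ (Σ∞-⨁ (allFin (suc n)) _) ⟨
    c * Σ∞ (λ m → ⨁ (allFin (suc n)) (λ i → weight j i * power n (node m) (node (suc m)) i))
      ≈⟨ Σ∞-* c _ ⟨
    Σ∞ (λ m → c * ⨁ (allFin (suc n)) (λ i → weight j i * power n (node m) (node (suc m)) i))
      ≈⟨ Σ∞-cong (λ m → telescope (node-suc m) n j) ⟩
    Σ∞ (λ m → c * power (suc n) (node m) (node (suc m)) j + (X * node (suc m) ^ suc n - node m ^ suc n))
      ≈⟨ Σ∞-+ _ _ ⟩
    Σ∞ (λ m → c * power (suc n) (node m) (node (suc m)) j) + Σ∞ (λ m → X * node (suc m) ^ suc n - node m ^ suc n)
      ≈⟨ +-cong (Σ∞-* c _) boundary ⟩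
    c * Σ∞ (λ m → power (suc n) (node m) (node (suc m)) j) + 0#
      ≈⟨ +-identityʳ _ ⟩
    c * Σ∞ (λ m → power (suc n) (node m) (node (suc m)) j) ∎
    where
    -- The upper node of index m is the lower node of index m + 1. Weighted by xᵐ, everything
    -- cancels except the power of node 0, which is zero because the exponent is positive.
    boundary : Σ∞ (λ m → X * node (suc m) ^ suc n - node m ^ suc n) ≈ 0#
    boundary = begin
      Σ∞ (λ m → X * node (suc m) ^ suc n - node m ^ suc n)
        ≈⟨ Σ∞-cong (λ m → solve 2 (λ a b → a :- b := a :+ (:- 𝟙) :* b) refl _ _) ⟩
      Σ∞ (λ m → X * node (suc m) ^ suc n + - 1# * node m ^ suc n)
        ≈⟨ trans (Σ∞-+ _ _) (+-cong (Σ∞-* X _) (Σ∞-* (- 1#) _)) ⟩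
      X * Σ∞ (λ m → node (suc m) ^ suc n) + - 1# * Σ∞ (λ m → node m ^ suc n)
        ≈⟨ solve 2 (λ a b → a :+ (:- 𝟙) :* b := :- (b :- a)) refl _ _ ⟩
      - (Σ∞ (λ m → node m ^ suc n) - X * Σ∞ (λ m → node (suc m) ^ suc n))
        ≈⟨ -‿cong (Σ∞-shift (λ m → node m ^ suc n)) ⟩
      - (c * 0# * node 0 ^ n)
        ≈⟨ solve 2 (λ a b → :- (a :* 𝟘 :* b) := 𝟘) refl _ _ ⟩
      0# ∎

  des-insert-zero : ∀ {n} (π : Permutation′ n) → des (insert zero zero π) ≡ des π
  des-insert-zero {zero}  π = ≡.refl
  des-insert-zero {suc n} π = des-insert zero π

  eulerian-series : ∀ n → ⨁ (permutations n) (λ π → X ^ des π) ≈ c * Σ∞ (λ m → node (suc m) ^ n)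
  eulerian-series n = begin
    ⨁ (permutations n) (λ π → X ^ des π)
      ≈⟨ ⨁-cong (permutations n) (λ π → reflexive (≡.cong (X ^_) (des-insert-zero π))) ⟨
    firstLetter n zero
      ≈⟨ firstLetter-series n zero ⟩
    c * Σ∞ (λ m → 1# * node (suc m) ^ n)
      ≈⟨ *-congˡ (Σ∞-cong (λ m → *-identityˡ _)) ⟩
    c * Σ∞ (λ m → node (suc m) ^ n) ∎

  -- If (1 - x) a = 0 then a = x a, so each coefficient of `a` equals the preceding one and the
  -- first is zero.
  c-cancel : ∀ {a} → c * a ≈ 0# → a ≈ 0#
  c-cancel {a} p = mk go
    where
    module Q = CommutativeRing Q
    fixed : a ≈ X * a
    fixed = trans (solve 2 (λ a x → a := (𝟙 :- x) :* a :+ x :* a) refl a X) (trans (+-congʳ p) (+-identityˡ _))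
    go : ∀ n → a n Q.≈ Q.0#
    go zero    = Q.trans (at fixed 0) (at (X-⊛ a) 0)
    go (suc n) = Q.trans (at fixed (suc n)) (Q.trans (at (X-⊛ a) (suc n)) (go n))

  module Exchange
    (F : Carrier → ℕ → Carrier)
    (F-cong : ∀ {s t} → s ≈ t → ∀ n → F s n ≈ F t n)
    (F-zero : ∀ n → F 0# (suc n) ≈ 0#)
    (difference-equation : ∀ t n →
      c * c * F t n ≈ (1# + X) * F t (suc n) - X * F (t + c) (suc n) - F (t - c) (suc n))
    where

    J : ℕ → ℕ → Carrier
    J n k = Σ∞ (λ m → F (node (suc m)) n * F (node (suc m)) k)

    private
      at-node : ∀ m n → c * c * F (node (suc m)) n ≈
        (1# + X) * F (node (suc m)) (suc n) - X * F (node (suc (suc m))) (suc n) - F (node m) (suc n)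
      at-node m n = trans (difference-equation (node (suc m)) n) (+-cong (+-congˡ (-‿cong (*-congˡ
        (F-cong (trans (+-comm _ _) (node-suc (suc m))) (suc n))))) (-‿cong (F-cong
          (trans (+-congʳ (sym (node-suc m))) (solve 2 (λ c t → (c :+ t) :- c := t) refl c (node m))) (suc n))))

      module _ (n k : ℕ) where
        -- The Casoratian (discrete Wronskian) of Pₙ₊₁ and Pₖ₊₁ at two adjacent nodes.
        -- Cross-multiplying the two difference equations cancels the terms with 1 + x, as in
        -- Lagrange's identity for second-order equations.
        W : ℕ → Carrier
        W m = F (node (suc m)) (suc n) * F (node m) (suc k) - F (node m) (suc n) * F (node (suc m)) (suc k)

        W₀ : W 0 ≈ 0#
        W₀ = trans (+-cong (*-congˡ (zero-node k)) (-‿cong (*-congʳ (zero-node n))))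
          (solve 2 (λ a b → a :* 𝟘 :- 𝟘 :* b := 𝟘) refl _ _)
          where
          zero-node : ∀ n → F (node 0) (suc n) ≈ 0#
          zero-node n = trans (F-cong (zeroʳ c) (suc n)) (F-zero n)

        pointwise : ∀ m → c * c * (F (node (suc m)) n * F (node (suc m)) (suc k) - F (node (suc m)) (suc n) * F (node (suc m)) k)
                      ≈ W m - X * W (suc m)
        pointwise m = begin
          c * c * (f * g′ - f′ * g)
            ≈⟨ solve 5 (λ c f g f′ g′ → c :* c :* (f :* g′ :- f′ :* g) := (c :* c :* f) :* g′ :- f′ :* (c :* c :* g)) refl c f g f′ g′ ⟩
          (c * c * f) * g′ - f′ * (c * c * g)
            ≈⟨ +-cong (*-congʳ (at-node m n)) (-‿cong (*-congˡ (at-node m k))) ⟩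
          ((1# + X) * f′ - X * F (node (suc (suc m))) (suc n) - F (node m) (suc n)) * g′
            - f′ * ((1# + X) * g′ - X * F (node (suc (suc m))) (suc k) - F (node m) (suc k))
            ≈⟨ solve 7 (λ x f g p q r s → ((𝟙 :+ x) :* f :- x :* p :- q) :* g :- f :* ((𝟙 :+ x) :* g :- x :* r :- s)
                 := (f :* s :- q :* g) :- x :* (p :* g :- f :* r)) refl X f′ g′ _ _ _ _ ⟩
          W m - X * W (suc m) ∎
          where
          f  = F (node (suc m)) n
          g  = F (node (suc m)) k
          f′ = F (node (suc m)) (suc n)
          g′ = F (node (suc m)) (suc k)

        Σ∞-sub : ∀ f g → Σ∞ (λ m → f m - g m) ≈ Σ∞ f - Σ∞ g
        Σ∞-sub f g = trans (Σ∞-cong (λ m → solve 2 (λ a b → a :- b := a :+ (:- 𝟙) :* b) refl (f m) (g m)))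
          (trans (Σ∞-+ f (λ m → - 1# * g m)) (trans (+-congˡ (Σ∞-* (- 1#) g))
            (solve 2 (λ a b → a :+ (:- 𝟙) :* b := a :- b) refl (Σ∞ f) (Σ∞ g))))

        exchange : J n (suc k) ≈ J (suc n) k
        exchange = trans (solve 2 (λ a b → a := (a :- b) :+ b) refl (J n (suc k)) (J (suc n) k))
          (trans (+-congʳ (c-cancel (c-cancel (trans (sym (*-assoc c c _)) vanishing)))) (+-identityˡ _))
          where
          vanishing : c * c * (J n (suc k) - J (suc n) k) ≈ 0#
          vanishing = begin
            c * c * (J n (suc k) - J (suc n) k)
              ≈⟨ trans (Σ∞-* (c * c) _) (*-congˡ (Σ∞-sub _ _)) ⟨
            Σ∞ (λ m → c * c * (F (node (suc m)) n * F (node (suc m)) (suc k) - F (node (suc m)) (suc n) * F (node (suc m)) k))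
              ≈⟨ Σ∞-cong pointwise ⟩
            Σ∞ (λ m → W m - X * W (suc m))
              ≈⟨ trans (Σ∞-sub W _) (+-congˡ (-‿cong (Σ∞-* X _))) ⟩
            Σ∞ W - X * Σ∞ (λ m → W (suc m))
              ≈⟨ trans (Σ∞-shift W) W₀ ⟩
            0# ∎

    J-+ : ∀ n k → J n k ≈ J (n ℕ.+ k) 0
    J-+ n zero    = reflexive (≡.cong (λ m → J m 0) (≡.sym (ℕ.+-identityʳ n)))
    J-+ n (suc k) = trans (exchange n k) (trans (J-+ (suc n) k)
      (reflexive (≡.cong (λ m → J m 0) (≡.sym (ℕ.+-suc n k)))))

-- Reindexing of finite sums along equal sets

module Reindexing {a ℓ c ℓ′} (S : Setoid a ℓ) (M : CommutativeMonoid c ℓ′) where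
  open Setoid S using (Carrier) renaming (_≈_ to _∼_; refl to ∼-refl; sym to ∼-sym; trans to ∼-trans)
  open CommutativeMonoid M hiding (Carrier)
  open BigOp M

  private
    infix 4 _∈ₛ_
    _∈ₛ_ : Carrier → List Carrier → Set _
    x ∈ₛ ys = Any (x ∼_) ys

    _∖_ : ∀ {x} (ys : List Carrier) → x ∈ₛ ys → List Carrier
    (y ∷ ys) ∖ here _  = ys
    (y ∷ ys) ∖ there p = y ∷ (ys ∖ p)

    module _ {x : Carrier} where
      All-∖ : ∀ {q} {Q : Pred Carrier q} {ys} (p : x ∈ₛ ys) → All Q ys → All Q (ys ∖ p)
      All-∖ (here _)  (_ ∷ qs) = qs
      All-∖ (there p) (q ∷ qs) = q ∷ All-∖ p qs

      Unique-∖ : ∀ {ys} (p : x ∈ₛ ys) → Unique S ys → Unique S (ys ∖ p)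
      Unique-∖ (here _)  (_ ∷ u) = u
      Unique-∖ (there p) (q ∷ u) = All-∖ p q ∷ Unique-∖ p u

      ∈-∖⁻ : ∀ {z ys} (p : x ∈ₛ ys) → z ∈ₛ ys ∖ p → z ∈ₛ ys
      ∈-∖⁻ (here _)  q         = there q
      ∈-∖⁻ (there p) (here e)  = here e
      ∈-∖⁻ (there p) (there q) = there (∈-∖⁻ p q)

      ∈-∖⁺ : ∀ {z ys} (p : x ∈ₛ ys) → z ∈ₛ ys → ¬ (x ∼ z) → z ∈ₛ ys ∖ p
      ∈-∖⁺ (here e)  (here e′) ne = contradiction (∼-trans e (∼-sym e′)) ne
      ∈-∖⁺ (here e)  (there q) ne = q
      ∈-∖⁺ (there p) (here e′) ne = here e′
      ∈-∖⁺ (there p) (there q) ne = there (∈-∖⁺ p q ne)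

      All≁ : ∀ {y} {ys} → x ∈ₛ ys → All (λ z → ¬ (y ∼ z)) ys → ¬ (x ∼ y)
      All≁ (here e)  (ne ∷ _) x∼y = ne (∼-trans (∼-sym x∼y) e)
      All≁ (there p) (_ ∷ ns) x∼y = All≁ p ns x∼y

      ∈-∖-≁ : ∀ {z ys} (p : x ∈ₛ ys) → Unique S ys → z ∈ₛ ys ∖ p → ¬ (x ∼ z)
      ∈-∖-≁ (here e)  (ns ∷ _) q         x∼z = All¬ q ns (∼-trans (∼-sym e) x∼z)
        where
        All¬ : ∀ {z y ys} → z ∈ₛ ys → All (λ v → ¬ (y ∼ v)) ys → ¬ (y ∼ z)
        All¬ (here e)  (n ∷ _)  y∼z = n (∼-trans y∼z e)
        All¬ (there q) (_ ∷ ns) y∼z = All¬ q ns y∼z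
      ∈-∖-≁ (there p) (ns ∷ _) (here e)  x∼z = All≁ p ns (∼-trans x∼z e)
      ∈-∖-≁ (there p) (_ ∷ u)  (there q) x∼z = ∈-∖-≁ p u q x∼z

      ⨁-∖ : ∀ {f} → (∀ {u v} → u ∼ v → f u ≈ f v) → ∀ {ys} (p : x ∈ₛ ys) → ⨁ ys f ≈ f x ∙ ⨁ (ys ∖ p) f
      ⨁-∖ f-cong (here e)  = ∙-congʳ (f-cong (∼-sym e))
      ⨁-∖ {f} f-cong {y ∷ ys} (there p) = trans (∙-congˡ (⨁-∖ {f} f-cong p)) (trans (sym (assoc _ _ _))
        (trans (∙-congʳ (comm (f y) (f x))) (assoc _ _ _)))

  -- Each element of `xs` is located in `ys` and deleted there. A setoid is needed since
  -- permutations are compared pointwise, and since a cycle may be represented by any of its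
  -- elements, so representatives are compared modulo `SameCycle`.
  ⨁-reindex : ∀ {xs ys f} → Unique S xs → Unique S ys →
    (∀ {z} → Any (z ∼_) xs → Any (z ∼_) ys) → (∀ {z} → Any (z ∼_) ys → Any (z ∼_) xs) →
    (∀ {u v} → u ∼ v → f u ≈ f v) → ⨁ xs f ≈ ⨁ ys f
  ⨁-reindex {[]}     {[]}     _ _ _ _ _ = refl
  ⨁-reindex {[]}     {y ∷ ys} _ _ _ ⊇ _ = contradiction (⊇ {y} (here ∼-refl)) λ ()
  ⨁-reindex {x ∷ xs} {ys} {f} (x≁ ∷ u) v ⊆ ⊇ f-cong =
    trans (∙-congˡ (⨁-reindex u (Unique-∖ p v)
        (λ {z} z∈xs → ∈-∖⁺ p (⊆ (there z∈xs)) (λ x∼z → All≁ z∈xs x≁ (∼-sym x∼z)))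
        (λ {z} z∈ → there⁻ (⊇ (∈-∖⁻ p z∈)) (∈-∖-≁ p v z∈))
        f-cong))
      (sym (⨁-∖ f-cong p))
    where
    p : x ∈ₛ ys
    p = ⊆ (here ∼-refl)
    there⁻ : ∀ {z} → z ∈ₛ x ∷ xs → ¬ (x ∼ z) → z ∈ₛ xs
    there⁻ (here e)  ne = contradiction (∼-sym e) ne
    there⁻ (there q) ne = q

length≡sum : ∀ {A : Set} (xs : List A) → length xs ≡ BigOp.⨁ ℕ.+-0-commutativeMonoid xs (λ _ → 1)
length≡sum []       = ≡.refl
length≡sum (x ∷ xs) = ≡.cong suc (length≡sum xs)

private
  -- A length is a sum of ones, so this is reindexing in the additive monoid ℕ.
  length-unique : ∀ {n} {xs ys : List (Fin n)} → Unique (≡.setoid _) xs → Unique (≡.setoid _) ys →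
    (∀ {z} → z ∈ xs → z ∈ ys) → (∀ {z} → z ∈ ys → z ∈ xs) → length xs ≡ length ys
  length-unique {xs = xs} {ys} u v ⊆ ⊇ = ≡.trans (length≡sum xs) (≡.trans
    (Reindexing.⨁-reindex (≡.setoid _) ℕ.+-0-commutativeMonoid {f = λ _ → 1} u v ⊆ ⊇ (λ _ → ≡.refl))
    (≡.sym (length≡sum ys)))

-- The relation of lying in the same cycle

module _ {n} (w : Permutation′ n) where

  sameCycle-refl : ∀ {i} → SameCycle w i i
  sameCycle-refl = 0 , ≡.refl

  sameCycle-step : ∀ i → SameCycle w i (w ⟨$⟩ʳ i)
  sameCycle-step i = 1 , ≡.refl

  sameCycle-trans : ∀ {i j k} → SameCycle w i j → SameCycle w j k → SameCycle w i k
  sameCycle-trans {i} (a , p) (b , q) = b ℕ.+ a ,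
    ≡.trans (fold-+ i (w ⟨$⟩ʳ_) b) (≡.trans (≡.cong (w ⟨$⟩^ b) p) q)

  private
    periodic : ∀ {i} p → (w ⟨$⟩^ p) i ≡ i → ∀ q → (w ⟨$⟩^ (q ℕ.* p)) i ≡ i
    periodic     p eq zero    = ≡.refl
    periodic {i} p eq (suc q) = ≡.trans (fold-+ i (w ⟨$⟩ʳ_) p) (≡.trans (≡.cong (w ⟨$⟩^ p) (periodic p eq q)) eq)

  -- If `i` has period p + 1 and m steps lead from `i` to `j`, then m p further steps close up: the
  -- total m (p + 1) is a multiple of the period.
  sameCycle-sym : ∀ {i j} → SameCycle w i j → SameCycle w j i
  sameCycle-sym {i} {j} (m , eq) with period w i
  ... | suc p , _ , _ , wᵖi≡i = m ℕ.* p , (begin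
    (w ⟨$⟩^ (m ℕ.* p)) j                  ≡⟨ ≡.cong (w ⟨$⟩^ (m ℕ.* p)) eq ⟨
    (w ⟨$⟩^ (m ℕ.* p)) ((w ⟨$⟩^ m) i)     ≡⟨ fold-+ i (w ⟨$⟩ʳ_) (m ℕ.* p) ⟨
    (w ⟨$⟩^ (m ℕ.* p ℕ.+ m)) i            ≡⟨ ≡.cong (λ k → (w ⟨$⟩^ k) i) (≡.trans (ℕ.+-comm (m ℕ.* p) m) (≡.sym (ℕ.*-suc m p))) ⟩
    (w ⟨$⟩^ (m ℕ.* suc p)) i              ≡⟨ periodic (suc p) wᵖi≡i m ⟩
    i                                     ∎)
    where open ≡.≡-Reasoning

-- One step may become a path of any length, including zero. This covers both the embedding `suc`,
-- where a step may be stretched by an inserted point, and the retraction that contracts it again.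
sameCycle-map : ∀ {m n} (w : Permutation′ m) (w′ : Permutation′ n) (f : Fin m → Fin n) →
  (∀ z → SameCycle w′ (f z) (f (w ⟨$⟩ʳ z))) → ∀ {i j} → SameCycle w i j → SameCycle w′ (f i) (f j)
sameCycle-map w w′ f step {i} (m , ≡.refl) = go m
  where
  go : ∀ m → SameCycle w′ (f i) (f ((w ⟨$⟩^ m) i))
  go zero    = (sameCycle-refl w′)
  go (suc m) = sameCycle-trans w′ (go m) (step _)

sameCycleSetoid : ∀ {n} → Permutation′ n → Setoid 0ℓ 0ℓ
sameCycleSetoid w = record
  { _≈_ = SameCycle w
  ; isEquivalence = record { refl = (sameCycle-refl w) ; sym = sameCycle-sym w ; trans = sameCycle-trans w }
  }

cycleLength : ∀ {n} → Permutation′ n → Fin n → ℕ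
cycleLength w i = length (cycle w i)

cycleMins : ∀ {n} → Permutation′ n → List (Fin n)
cycleMins w = filter (isCycleMin? w) (allFin _)

isOtherMin? : ∀ {n} (w : Permutation′ n) (j i : Fin n) → Dec (IsCycleMin w i × ¬ SameCycle w j i)
isOtherMin? w j i = isCycleMin? w i ×-dec ¬? (sameCycle? w j i)

otherMins : ∀ {n} → Permutation′ n → Fin n → List (Fin n)
otherMins w j = filter (isOtherMin? w j) (allFin _)

cycleLength-cong : ∀ {n} (w : Permutation′ n) {i j} → SameCycle w i j → cycleLength w i ≡ cycleLength w j
cycleLength-cong w {i} {j} i∼j = ≡.cong length (List.filter-≐ (sameCycle? w i) (sameCycle? w j)
  (sameCycle-trans w (sameCycle-sym w i∼j) , sameCycle-trans w i∼j) (allFin _))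

cycleMin : ∀ {n} (w : Permutation′ n) i → ∃[ m ] SameCycle w i m × IsCycleMin w m
cycleMin w i = go i (Fin.<-wellFounded i)
  where
  go : ∀ i → Acc Fin._<_ i → ∃[ m ] SameCycle w i m × IsCycleMin w m
  go i (acc rec) with isCycleMin? w i
  ... | yes min = i , (sameCycle-refl w) , min
  ... | no ¬min with Fin.¬∀⟶∃¬ _ _ (λ j → sameCycle? w i j →-dec i Fin.≤? j) ¬min
  ... | j , ¬imp = m , sameCycle-trans w i∼j j∼m , min
    where
    i∼j : SameCycle w i j
    i∼j = decidable-stable (sameCycle? w i j) (λ ≁ → ¬imp (λ ∼ → contradiction ∼ ≁))
    below : ∃[ m ] SameCycle w j m × IsCycleMin w m
    below = go j (rec (ℕ.≰⇒> (λ i≤j → ¬imp (λ _ → i≤j))))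
    m = proj₁ below
    j∼m = proj₁ (proj₂ below)
    min = proj₂ (proj₂ below)

module _ {n} (w : Permutation′ n) where

  private
    mins-unique : ∀ {xs : List (Fin n)} → All (IsCycleMin w) xs → Unique (≡.setoid _) xs → Unique (sameCycleSetoid w) xs
    mins-unique []         []       = []
    mins-unique (m ∷ ms) (x≢ ∷ u) =
      All.zipWith (λ (m′ , x≢y) x∼y → x≢y (Fin.≤-antisym (m _ x∼y) (m′ _ (sameCycle-sym w x∼y)))) (ms , x≢) ∷ mins-unique ms u

  cycleMins-unique : Unique (sameCycleSetoid w) (cycleMins w)
  cycleMins-unique = mins-unique (All.all-filter (isCycleMin? w) (allFin n)) (UniqueP.filter⁺ (isCycleMin? w) (allFin⁺ n))

  otherMins-unique : ∀ j → Unique (sameCycleSetoid w) (otherMins w j)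
  otherMins-unique j = mins-unique (All.map proj₁ (All.all-filter (isOtherMin? w j) (allFin n)))
    (UniqueP.filter⁺ (isOtherMin? w j) (allFin⁺ n))

  private
    shift-∈ : ∀ {i m} {xs : List (Fin n)} → SameCycle w i m → m ∈ xs → Any (SameCycle w i) xs
    shift-∈ i∼m = Any.map λ { ≡.refl → i∼m }

  ∈-cycleMins : ∀ i → Any (SameCycle w i) (cycleMins w)
  ∈-cycleMins i with cycleMin w i
  ... | m , i∼m , min = shift-∈ i∼m (∈-filter⁺ (isCycleMin? w) (∈-allFin m) min)

  ∈-otherMins : ∀ {j i} → ¬ SameCycle w j i → Any (SameCycle w i) (otherMins w j)
  ∈-otherMins {j} {i} j≁i with cycleMin w i
  ... | m , i∼m , min = shift-∈ i∼m (∈-filter⁺ (isOtherMin? w j) (∈-allFin m)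
    (min , λ j∼m → j≁i (sameCycle-trans w j∼m (sameCycle-sym w i∼m))))

  otherMins-∉ : ∀ {j i} → Any (SameCycle w i) (otherMins w j) → ¬ SameCycle w j i
  otherMins-∉ {j} {i} = go (All.all-filter (isOtherMin? w j) (allFin n))
    where
    go : ∀ {xs} → All (λ k → IsCycleMin w k × ¬ SameCycle w j k) xs → Any (SameCycle w i) xs → ¬ SameCycle w j i
    go ((_ , j≁k) ∷ _) (here i∼k) j∼i = j≁k (sameCycle-trans w j∼i i∼k)
    go (_ ∷ ps)        (there p)  j∼i = go ps p j∼i

-- Enumeration of permutations by inserting 0 into a cycle, in front of j (or as a fixed point)

cycleInsert : ∀ {n} → Fin (suc n) → Permutation′ n → Permutation′ (suc n)
cycleInsert j π = lift₀ π ∘ₚ transpose zero j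

cycleInserts : ∀ n → List (Permutation′ (suc n))
cycleInserts n = cartesianProductWith cycleInsert (allFin (suc n)) (permutations n)

private
  injective : ∀ {n} (w : Permutation′ n) {i j} → w ⟨$⟩ʳ i ≡ w ⟨$⟩ʳ j → i ≡ j
  injective w = Injection.injective (↔⇒↣ w)

-- The insertion position is forced to be w(0). Undoing the transposition leaves a permutation `σ`
-- fixing 0, from which 0 can be removed.
cycleInserts-complete : ∀ n (w : Permutation′ (suc n)) → Any (w ≗ₚ_) (cycleInserts n)
cycleInserts-complete n w = Any.cartesianProductWith⁺ cycleInsert hit
  (∈-allFin (w ⟨$⟩ʳ zero)) (permutations-complete n (remove zero σ))
  where
  σ : Permutation′ (suc n)
  σ = w ∘ₚ flip (transpose zero (w ⟨$⟩ʳ zero))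
  σ₀ : σ ⟨$⟩ʳ zero ≡ zero
  σ₀ = Perm.inverseˡ (transpose zero (w ⟨$⟩ʳ zero)) {zero}
  hit : ∀ {j π} → w ⟨$⟩ʳ zero ≡ j → remove zero σ ≗ₚ π → w ≗ₚ cycleInsert j π
  hit {π = π} ≡.refl eq i = begin
    w ⟨$⟩ʳ i
      ≡⟨ Perm.inverseʳ (transpose zero (w ⟨$⟩ʳ zero)) ⟨
    transpose zero (w ⟨$⟩ʳ zero) ⟨$⟩ʳ (σ ⟨$⟩ʳ i)
      ≡⟨ ≡.cong (transpose zero (w ⟨$⟩ʳ zero) ⟨$⟩ʳ_) (Perm.lift₀-remove σ σ₀ i) ⟨
    transpose zero (w ⟨$⟩ʳ zero) ⟨$⟩ʳ (lift₀ (remove zero σ) ⟨$⟩ʳ i)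
      ≡⟨ ≡.cong (transpose zero (w ⟨$⟩ʳ zero) ⟨$⟩ʳ_) (Perm.lift₀-cong (remove zero σ) π eq i) ⟩
    cycleInsert (w ⟨$⟩ʳ zero) π ⟨$⟩ʳ i ∎
    where open ≡.≡-Reasoning

cycleInserts-unique : ∀ n → Unique (permutationSetoid (suc n)) (cycleInserts n)
cycleInserts-unique n = Unique.cartesianProductWith⁺ (≡.setoid _) (permutationSetoid n) (permutationSetoid (suc n))
  cycleInsert (λ {j} {k} {π} {ρ} eq → eq zero , components {π = π} {ρ} (eq zero) eq)
  (allFin⁺ (suc n)) (permutations-unique n)
  where
  components : ∀ {j k : Fin (suc n)} {π ρ : Permutation′ n} → j ≡ k → cycleInsert j π ≗ₚ cycleInsert k ρ → π ≗ₚ ρ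
  components {j} ≡.refl eq i = Fin.suc-injective (injective (transpose zero j) (eq (suc i)))

module _ {n} (π : Permutation′ n) where

  cycleInsert-zero-sameCycle : ∀ {i} → ¬ SameCycle (cycleInsert zero π) zero (suc i)
  cycleInsert-zero-sameCycle (m , eq) = contradiction (≡.trans (≡.sym (fixed m)) eq) λ ()
    where
    fixed : ∀ m → (cycleInsert zero π ⟨$⟩^ m) zero ≡ zero
    fixed zero    = ≡.refl
    fixed (suc m) = ≡.cong (cycleInsert zero π ⟨$⟩ʳ_) (fixed m)

  private
    -- Collapsing 0 onto its successor `j` undoes the insertion: each step upstairs becomes at most
    -- one step of π.
    retract : Fin n → Fin (suc n) → Fin n
    retract j zero    = j
    retract j (suc i) = i

    -- Every step of π survives except the one entering the point before which 0 was inserted; that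
    -- one now passes through 0 and takes two steps.
    step-up : ∀ j i → SameCycle (cycleInsert j π) (suc i) (suc (π ⟨$⟩ʳ i))
    step-up zero    i = sameCycle-step (cycleInsert zero π) (suc i)
    step-up (suc j) i with π ⟨$⟩ʳ i Fin.≟ j in eq
    ... | yes ≡.refl = 2 , ≡.cong (cycleInsert (suc j) π ⟨$⟩ʳ_) at-i
      where
      at-i : cycleInsert (suc j) π ⟨$⟩ʳ suc i ≡ zero
      at-i rewrite eq = ≡.refl
    ... | no  _      = 1 , at-i
      where
      at-i : cycleInsert (suc j) π ⟨$⟩ʳ suc i ≡ suc (π ⟨$⟩ʳ i)
      at-i rewrite eq = ≡.refl

    step-down : ∀ j z → SameCycle π (retract j z) (retract j (cycleInsert (suc j) π ⟨$⟩ʳ z))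
    step-down j zero    = (sameCycle-refl π)
    step-down j (suc i) with π ⟨$⟩ʳ i Fin.≟ j
    ... | yes eq = 1 , eq
    ... | no  _  = sameCycle-step π i

  sameCycle-cycleInsert : ∀ j {i k} → SameCycle π i k → SameCycle (cycleInsert j π) (suc i) (suc k)
  sameCycle-cycleInsert j = sameCycle-map π (cycleInsert j π) suc (step-up j)

  cycleInsert-sameCycle : ∀ j {i k} → SameCycle (cycleInsert j π) (suc i) (suc k) → SameCycle π i k
  cycleInsert-sameCycle (suc j) = sameCycle-map (cycleInsert (suc j) π) π (retract j) (step-down j)
  -- Here 0 is a cycle of its own and has no point to collapse onto. The orbit is followed instead:
  -- it never leaves the image of `suc`.
  cycleInsert-sameCycle zero {i} (m , eq) = go m eq
    where
    above : ∀ m → ∃[ k ] (cycleInsert zero π ⟨$⟩^ m) (suc i) ≡ suc k × SameCycle π i k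
    above zero    = i , ≡.refl , (sameCycle-refl π)
    above (suc m) with above m
    ... | k , eq , i∼k = π ⟨$⟩ʳ k , ≡.cong (cycleInsert zero π ⟨$⟩ʳ_) eq , sameCycle-trans π i∼k (sameCycle-step π k)
    go : ∀ m {k} → (cycleInsert zero π ⟨$⟩^ m) (suc i) ≡ suc k → SameCycle π i k
    go m eq with above m
    ... | k , eq′ , i∼k = ≡.subst (SameCycle π i) (Fin.suc-injective (≡.trans (≡.sym eq′) eq)) i∼k

  cycleInsert-suc-sameCycle : ∀ j {i} → SameCycle (cycleInsert (suc j) π) zero (suc i) → SameCycle π j i
  cycleInsert-suc-sameCycle j = sameCycle-map (cycleInsert (suc j) π) π (retract j) (step-down j)

  sameCycle-cycleInsert-suc : ∀ j {i} → SameCycle π j i → SameCycle (cycleInsert (suc j) π) zero (suc i)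
  sameCycle-cycleInsert-suc j j∼i = sameCycle-trans (cycleInsert (suc j) π) (sameCycle-step (cycleInsert (suc j) π) zero) (sameCycle-cycleInsert (suc j) j∼i)

  private
    filter-suc : ∀ {p q} {P : Pred (Fin (suc n)) p} {Q : Pred (Fin n) q} (P? : Decidable P) (Q? : Decidable Q) →
      (∀ {i} → P (suc i) → Q i) → (∀ {i} → Q i → P (suc i)) → filter P? (map suc (allFin n)) ≡ map suc (filter Q? (allFin n))
    filter-suc P? Q? to from = ≡.trans (filter-map P? suc (allFin n))
      (≡.cong (map suc) (List.filter-≐ (P? ∘ suc) Q? (to , from) (allFin n)))

    filter-reject-zero : ∀ {p q} {P : Pred (Fin (suc n)) p} {Q : Pred (Fin n) q} (P? : Decidable P) (Q? : Decidable Q) →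
      ¬ P zero → (∀ {i} → P (suc i) → Q i) → (∀ {i} → Q i → P (suc i)) →
      filter P? (allFin (suc n)) ≡ map suc (filter Q? (allFin n))
    filter-reject-zero P? Q? ¬P to from = ≡.trans (≡.cong (filter P?) (allFin-suc n))
      (≡.trans (List.filter-reject P? ¬P) (filter-suc P? Q? to from))

    filter-accept-zero : ∀ {p q} {P : Pred (Fin (suc n)) p} {Q : Pred (Fin n) q} (P? : Decidable P) (Q? : Decidable Q) →
      P zero → (∀ {i} → P (suc i) → Q i) → (∀ {i} → Q i → P (suc i)) →
      filter P? (allFin (suc n)) ≡ zero ∷ map suc (filter Q? (allFin n))
    filter-accept-zero P? Q? p to from = ≡.trans (≡.cong (filter P?) (allFin-suc n))
      (≡.trans (List.filter-accept P? p) (≡.cong (zero ∷_) (filter-suc P? Q? to from)))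

  cycleLength-cycleInsert : ∀ j {i} → ¬ SameCycle (cycleInsert j π) zero (suc i) →
    cycleLength (cycleInsert j π) (suc i) ≡ cycleLength π i
  cycleLength-cycleInsert j {i} 0≁i = ≡.trans (≡.cong length (filter-reject-zero (sameCycle? (cycleInsert j π) (suc i)) (sameCycle? π i)
      (λ i∼0 → 0≁i (sameCycle-sym (cycleInsert j π) i∼0)) (cycleInsert-sameCycle j) (sameCycle-cycleInsert j)))
    (List.length-map suc (cycle π i))

  cycleLength-cycleInsert-suc : ∀ j → cycleLength (cycleInsert (suc j) π) zero ≡ suc (cycleLength π j)
  cycleLength-cycleInsert-suc j = ≡.trans (≡.cong length (filter-accept-zero (sameCycle? (cycleInsert (suc j) π) zero) (sameCycle? π j)
      (sameCycle-refl (cycleInsert (suc j) π)) (cycleInsert-suc-sameCycle j) (sameCycle-cycleInsert-suc j)))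
    (≡.cong suc (List.length-map suc (cycle π j)))

  cycleLength-cycleInsert-zero : cycleLength (cycleInsert zero π) zero ≡ 1
  cycleLength-cycleInsert-zero = ≡.cong length (≡.trans
    (filter-accept-zero (sameCycle? (cycleInsert zero π) zero) (λ _ → no (λ ()))
      (sameCycle-refl (cycleInsert zero π)) cycleInsert-zero-sameCycle ⊥-elim)
    (≡.cong (λ xs → zero ∷ map suc xs) (List.filter-none (λ _ → no (λ ())) (All.universal (λ _ ()) (allFin n)))))

  private
    isCycleMin-suc : ∀ j {i} → IsCycleMin (cycleInsert j π) (suc i) → IsCycleMin π i
    isCycleMin-suc j min k i∼k = ℕ.s≤s⁻¹ (min (suc k) (sameCycle-cycleInsert j i∼k))

    suc-isCycleMin : ∀ j {i} → ¬ SameCycle (cycleInsert j π) zero (suc i) → IsCycleMin π i → IsCycleMin (cycleInsert j π) (suc i)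
    suc-isCycleMin j 0≁i min zero    i∼0 = contradiction (sameCycle-sym (cycleInsert j π) i∼0) 0≁i
    suc-isCycleMin j 0≁i min (suc k) i∼k = s≤s (min k (cycleInsert-sameCycle j i∼k))

  otherMins-cycleInsert-zero : otherMins (cycleInsert zero π) zero ≡ map suc (cycleMins π)
  otherMins-cycleInsert-zero = filter-reject-zero (isOtherMin? (cycleInsert zero π) zero) (isCycleMin? π)
    (λ (_ , 0≁0) → 0≁0 (sameCycle-refl (cycleInsert zero π))) (λ (min , _) → isCycleMin-suc zero min)
    (λ min → suc-isCycleMin zero cycleInsert-zero-sameCycle min , cycleInsert-zero-sameCycle)

  otherMins-cycleInsert-suc : ∀ j → otherMins (cycleInsert (suc j) π) zero ≡ map suc (otherMins π j)
  otherMins-cycleInsert-suc j = filter-reject-zero (isOtherMin? (cycleInsert (suc j) π) zero) (isOtherMin? π j)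
    (λ (_ , 0≁0) → 0≁0 (sameCycle-refl (cycleInsert (suc j) π)))
    (λ (min , 0≁i) → isCycleMin-suc (suc j) min , (0≁i ∘ sameCycle-cycleInsert-suc j))
    (λ (min , j≁i) → suc-isCycleMin (suc j) (j≁i ∘ cycleInsert-suc-sameCycle j) min , (j≁i ∘ cycleInsert-suc-sameCycle j))

-- Invariance of cycles under conjugation

module _ {n} (τ w w′ : Permutation′ n) (conjugate : ∀ i → w′ ⟨$⟩ʳ (τ ⟨$⟩ʳ i) ≡ τ ⟨$⟩ʳ (w ⟨$⟩ʳ i)) where

  sameCycle-conjugate⁺ : ∀ {i j} → SameCycle w i j → SameCycle w′ (τ ⟨$⟩ʳ i) (τ ⟨$⟩ʳ j)
  sameCycle-conjugate⁺ = sameCycle-map w w′ (τ ⟨$⟩ʳ_) (λ z → 1 , conjugate z)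

  conjugate-preimage : ∀ {i j} → SameCycle w′ (τ ⟨$⟩ʳ i) j → SameCycle w i (τ ⟨$⟩ˡ j)
  conjugate-preimage i∼j = ≡.subst (λ z → SameCycle w z _) (Perm.inverseˡ τ)
      (sameCycle-map w′ w (τ ⟨$⟩ˡ_) (λ z → 1 , ≡.sym (begin
        τ ⟨$⟩ˡ (w′ ⟨$⟩ʳ z)                        ≡⟨ ≡.cong (λ y → τ ⟨$⟩ˡ (w′ ⟨$⟩ʳ y)) (Perm.inverseʳ τ) ⟨
        τ ⟨$⟩ˡ (w′ ⟨$⟩ʳ (τ ⟨$⟩ʳ (τ ⟨$⟩ˡ z)))      ≡⟨ ≡.cong (τ ⟨$⟩ˡ_) (conjugate (τ ⟨$⟩ˡ z)) ⟩
        τ ⟨$⟩ˡ (τ ⟨$⟩ʳ (w ⟨$⟩ʳ (τ ⟨$⟩ˡ z)))       ≡⟨ Perm.inverseˡ τ ⟩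
        w ⟨$⟩ʳ (τ ⟨$⟩ˡ z)                         ∎)) i∼j)
      where open ≡.≡-Reasoning

  sameCycle-conjugate⁻ : ∀ {i j} → SameCycle w′ (τ ⟨$⟩ʳ i) (τ ⟨$⟩ʳ j) → SameCycle w i j
  sameCycle-conjugate⁻ i∼j = ≡.subst (SameCycle w _) (Perm.inverseˡ τ) (conjugate-preimage i∼j)

  cycleLength-conjugate : ∀ i → cycleLength w′ (τ ⟨$⟩ʳ i) ≡ cycleLength w i
  cycleLength-conjugate i = ≡.trans
    (length-unique (UniqueP.filter⁺ (sameCycle? w′ (τ ⟨$⟩ʳ i)) (allFin⁺ n))
      (UniqueP.map⁺ (injective τ) (UniqueP.filter⁺ (sameCycle? w i) (allFin⁺ n)))
      (λ {z} z∈ → ≡.subst (λ y → y ∈ map (τ ⟨$⟩ʳ_) (cycle w i)) (Perm.inverseʳ τ)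
         (Any.map⁺ (Any.map (≡.cong (τ ⟨$⟩ʳ_)) (∈-filter⁺ (sameCycle? w i) (∈-allFin (τ ⟨$⟩ˡ z))
           (conjugate-preimage (proj₂ (∈-filter⁻ (sameCycle? w′ (τ ⟨$⟩ʳ i)) {xs = allFin n} z∈)))))))
      (λ z∈ → member (Any.map⁻ z∈)))
    (List.length-map (τ ⟨$⟩ʳ_) (cycle w i))
    where
    member : ∀ {z} → Any (λ y → z ≡ τ ⟨$⟩ʳ y) (cycle w i) → z ∈ cycle w′ (τ ⟨$⟩ʳ i)
    member {z} p = go (All.all-filter (sameCycle? w i) (allFin n)) p
      where
      go : ∀ {ys} → All (SameCycle w i) ys → Any (λ y → z ≡ τ ⟨$⟩ʳ y) ys → z ∈ cycle w′ (τ ⟨$⟩ʳ i)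
      go (i∼y ∷ _) (here ≡.refl) = ∈-filter⁺ (sameCycle? w′ (τ ⟨$⟩ʳ i)) (∈-allFin _) (sameCycle-conjugate⁺ i∼y)
      go (_ ∷ ps)  (there q)     = go ps q


-- Recursion for sums of multiplicative cycle weights over the symmetric group

module CycleIndex (R : CommutativeRing 0ℓ 0ℓ) (g : ℕ → CommutativeRing.Carrier R) where
  open CommutativeRing R hiding (zero)
  open IntegerCoefficients R using (ι)
  open RingSums R
  open BigOp *-commutativeMonoid using () renaming (⨁ to ∏; ⨁-map to ∏-map)
  open Relation.Binary.Reasoning.Setoid setoid

  weight : ∀ {n} → Permutation′ n → Carrier
  weight w = ∏ (cycleMins w) (λ i → g (cycleLength w i))

  -- Tracking the cycle of one point makes the recursion close: removing that point from its cycle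
  -- leaves a permutation with the same total weight once a is increased by one.
  marked : ∀ {n} → ℕ → Permutation′ n → Fin n → Carrier
  marked a w j = g (a ℕ.+ cycleLength w j) * ∏ (otherMins w j) (λ i → g (cycleLength w i))

  private
    g-length : ∀ {n} (w : Permutation′ n) {i j} → SameCycle w i j → g (cycleLength w i) ≈ g (cycleLength w j)
    g-length w i∼j = reflexive (≡.cong g (cycleLength-cong w i∼j))

    ∏-congᴬ : ∀ {I : Set} {xs : List I} {f h} → All (λ i → f i ≈ h i) xs → ∏ xs f ≈ ∏ xs h
    ∏-congᴬ []       = refl
    ∏-congᴬ (p ∷ ps) = *-cong p (∏-congᴬ ps)

  -- `j` replaces the minimum as representative of its own cycle. Both lists meet every cycle
  -- exactly once, and the factor depends only on the cycle.
  weight-marked : ∀ {n} (w : Permutation′ n) j → weight w ≈ marked 0 w j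
  weight-marked w j = Reindexing.⨁-reindex (sameCycleSetoid w) *-commutativeMonoid
    {xs = cycleMins w} {ys = j ∷ otherMins w j} {f = λ i → g (cycleLength w i)}
    (cycleMins-unique w)
    (All.map proj₂ (All.all-filter (isOtherMin? w j) (allFin _)) ∷ otherMins-unique w j)
    (λ {i} _ → split i) (λ {i} _ → ∈-cycleMins w i) (g-length w)
    where
    split : ∀ i → Any (SameCycle w i) (j ∷ otherMins w j)
    split i with sameCycle? w j i
    ... | yes j∼i = here (sameCycle-sym w j∼i)
    ... | no  j≁i = there (∈-otherMins w j≁i)

  module _ {n} (τ w w′ : Permutation′ n) (conjugate : ∀ i → w′ ⟨$⟩ʳ (τ ⟨$⟩ʳ i) ≡ τ ⟨$⟩ʳ (w ⟨$⟩ʳ i)) where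

    private
      up : ∀ {i j} → SameCycle w i j → SameCycle w′ (τ ⟨$⟩ʳ i) (τ ⟨$⟩ʳ j)
      up = sameCycle-conjugate⁺ τ w w′ conjugate

      down′ : ∀ {i j} → SameCycle w′ (τ ⟨$⟩ʳ i) (τ ⟨$⟩ʳ j) → SameCycle w i j
      down′ = sameCycle-conjugate⁻ τ w w′ conjugate

    -- Conjugation carries cycles to cycles but not minima to minima, so the images of the old
    -- minima are matched with the new ones only modulo `SameCycle w′`.
    marked-conjugate : ∀ a j → marked a w′ (τ ⟨$⟩ʳ j) ≈ marked a w j
    marked-conjugate a j = *-cong (reflexive (≡.cong (λ m → g (a ℕ.+ m)) (cycleLength-conjugate τ w w′ conjugate j))) (begin
      ∏ (otherMins w′ (τ ⟨$⟩ʳ j)) (λ i → g (cycleLength w′ i))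
        ≈⟨ Reindexing.⨁-reindex (sameCycleSetoid w′) *-commutativeMonoid
             {f = λ i → g (cycleLength w′ i)} (otherMins-unique w′ (τ ⟨$⟩ʳ j))
             (Unique.map⁺ (sameCycleSetoid w) (sameCycleSetoid w′) down′ (otherMins-unique w j))
             (λ i∈ → into (otherMins-∉ w′ i∈)) (λ i∈ → ∈-otherMins w′ (outof (Any.map⁻ i∈)))
             (g-length w′) ⟩
      ∏ (map (τ ⟨$⟩ʳ_) (otherMins w j)) (λ i → g (cycleLength w′ i))
        ≡⟨ ∏-map (τ ⟨$⟩ʳ_) (otherMins w j) _ ⟩
      ∏ (otherMins w j) (λ i → g (cycleLength w′ (τ ⟨$⟩ʳ i)))
        ≈⟨ ∏-congᴬ (All.universal (λ i → reflexive (≡.cong g (cycleLength-conjugate τ w w′ conjugate i))) (otherMins w j)) ⟩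
      ∏ (otherMins w j) (λ i → g (cycleLength w i)) ∎)
      where
      into : ∀ {i} → ¬ SameCycle w′ (τ ⟨$⟩ʳ j) i → Any (SameCycle w′ i) (map (τ ⟨$⟩ʳ_) (otherMins w j))
      into {i} j≁i = Any.map⁺ (Any.map (λ {y} i∼y → ≡.subst (λ z → SameCycle w′ z (τ ⟨$⟩ʳ y)) (Perm.inverseʳ τ) (up i∼y))
        (∈-otherMins w (λ j∼i → j≁i (≡.subst (SameCycle w′ (τ ⟨$⟩ʳ j)) (Perm.inverseʳ τ) (up j∼i)))))
      outof : ∀ {i} → Any (λ y → SameCycle w′ i (τ ⟨$⟩ʳ y)) (otherMins w j) → ¬ SameCycle w′ (τ ⟨$⟩ʳ j) i
      outof {i} p j∼i = otherMins-∉ w (Any.map (λ i∼y → down′ (sameCycle-trans w′ j∼i i∼y)) p) (sameCycle-refl w)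

  -- Pointwise equality is conjugacy by the identity.
  marked-cong : ∀ {n} a {w w′ : Permutation′ n} j → w ≗ₚ w′ → marked a w j ≈ marked a w′ j
  marked-cong a {w} {w′} j eq = sym (marked-conjugate Perm.id w w′ (λ i → ≡.sym (eq i)) a j)

  marked-cycleInsert-zero : ∀ {n} a (π : Permutation′ n) → marked a (cycleInsert zero π) zero ≈ g (suc a) * weight π
  marked-cycleInsert-zero a π = *-cong
    (reflexive (≡.cong g (≡.trans (≡.cong (a ℕ.+_) (cycleLength-cycleInsert-zero π)) (ℕ.+-comm a 1))))
    (trans (reflexive (≡.trans (≡.cong (λ xs → ∏ xs (λ i → g (cycleLength (cycleInsert zero π) i))) (otherMins-cycleInsert-zero π))
        (∏-map suc (cycleMins π) _)))
      (∏-congᴬ (All.universal (λ i → reflexive (≡.cong g (cycleLength-cycleInsert π zero (cycleInsert-zero-sameCycle π)))) (cycleMins π))))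

  marked-cycleInsert-suc : ∀ {n} a (π : Permutation′ n) j → marked a (cycleInsert (suc j) π) zero ≈ marked (suc a) π j
  marked-cycleInsert-suc a π j = *-cong
    (reflexive (≡.cong g (≡.trans (≡.cong (a ℕ.+_) (cycleLength-cycleInsert-suc π j)) (ℕ.+-suc a _))))
    (trans (reflexive (≡.trans (≡.cong (λ xs → ∏ xs (λ i → g (cycleLength (cycleInsert (suc j) π) i))) (otherMins-cycleInsert-suc π j))
        (∏-map suc (otherMins π j) _)))
      (∏-congᴬ (All.map (λ {i} (_ , j≁i) → reflexive (≡.cong g (cycleLength-cycleInsert π (suc j)
          (j≁i ∘ cycleInsert-suc-sameCycle π j)))) (All.all-filter (isOtherMin? π j) (allFin _)))))

  private
    reindex : ∀ {n} {xs : List (Permutation′ n)} {f : Permutation′ n → Carrier} → Unique (permutationSetoid n) xs →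
      (∀ w → Any (w ≗ₚ_) xs) → (∀ {w w′} → w ≗ₚ w′ → f w ≈ f w′) → ⨁ (permutations n) f ≈ ⨁ xs f
    reindex {n} u complete f-cong = Reindexing.⨁-reindex (permutationSetoid n) +-commutativeMonoid
      (permutations-unique n) u (λ {w} _ → complete w) (λ {w} _ → permutations-complete n w)
      (λ {w} {w′} → f-cong {w} {w′})

  -- Conjugation by the transposition of 0 and `j` permutes the symmetric group and moves the mark
  -- from 0 to `j`.
  ⨁-marked-const : ∀ {n} a (j : Fin (suc n)) →
    ⨁ (permutations (suc n)) (λ w → marked a w j) ≈ ⨁ (permutations (suc n)) (λ w → marked a w zero)
  ⨁-marked-const {n} a j = begin
    ⨁ (permutations (suc n)) (λ w → marked a w j)
      ≈⟨ reindex {f = λ w → marked a w j} unique complete (λ {w} {w′} → marked-cong a {w} {w′} j) ⟩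
    ⨁ (map conj (permutations (suc n))) (λ w → marked a w j)
      ≡⟨ ⨁-map conj (permutations (suc n)) _ ⟩
    ⨁ (permutations (suc n)) (λ w → marked a (conj w) j)
      ≈⟨ ⨁-cong (permutations (suc n)) (λ w → marked-conjugate τ w (conj w)
           (λ i → ≡.cong (λ z → τ ⟨$⟩ʳ (w ⟨$⟩ʳ z)) (Perm.inverseˡ τ)) a zero) ⟩
    ⨁ (permutations (suc n)) (λ w → marked a w zero) ∎
    where
    τ = transpose zero j
    conj conj⁻¹ : Permutation′ (suc n) → Permutation′ (suc n)
    conj w   = flip τ ∘ₚ w ∘ₚ τ
    conj⁻¹ w = τ ∘ₚ w ∘ₚ flip τ
    unique : Unique (permutationSetoid (suc n)) (map conj (permutations (suc n)))
    unique = Unique.map⁺ (permutationSetoid (suc n)) (permutationSetoid (suc n)) (λ {w} {w′} eq i →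
        ≡.subst (λ z → w ⟨$⟩ʳ z ≡ w′ ⟨$⟩ʳ z) (Perm.inverseˡ τ) (injective τ (eq (τ ⟨$⟩ʳ i))))
      (permutations-unique (suc n))
    complete : ∀ w → Any (w ≗ₚ_) (map conj (permutations (suc n)))
    complete w = Any.map⁺ (Any.map (λ {w′} eq i → ≡.trans
        (≡.sym (≡.trans (Perm.inverseʳ τ) (≡.cong (w ⟨$⟩ʳ_) (Perm.inverseʳ τ))))
        (≡.cong (τ ⟨$⟩ʳ_) (eq (τ ⟨$⟩ˡ i)))) (permutations-complete (suc n) (conj⁻¹ w)))

  total : ℕ → Carrier
  total n = ⨁ (permutations n) weight

  markedTotal : ℕ → ℕ → Carrier
  markedTotal n a = ⨁ (permutations (suc n)) (λ w → marked a w zero)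

  total-suc : ∀ n → total (suc n) ≈ markedTotal n 0
  total-suc n = ⨁-cong (permutations (suc n)) (λ w → weight-marked w zero)

  private
    markedTotal-split : ∀ n a → markedTotal n a ≈
      g (suc a) * total n + ⨁ (allFin n) (λ j → ⨁ (permutations n) (λ π → marked (suc a) π j))
    markedTotal-split n a = begin
      markedTotal n a
        ≈⟨ reindex {f = λ w → marked a w zero} (cycleInserts-unique n) (cycleInserts-complete n) (λ {w} {w′} → marked-cong a {w} {w′} zero) ⟩
      ⨁ (cycleInserts n) (λ w → marked a w zero)
        ≈⟨ ⨁-cartesianProductWith cycleInsert (allFin (suc n)) (permutations n) _ ⟩
      ⨁ (allFin (suc n)) (λ j → ⨁ (permutations n) (λ π → marked a (cycleInsert j π) zero))
        ≡⟨ ⨁-allFin-suc n _ ⟩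
      ⨁ (permutations n) (λ π → marked a (cycleInsert zero π) zero)
        + ⨁ (allFin n) (λ j → ⨁ (permutations n) (λ π → marked a (cycleInsert (suc j) π) zero))
        ≈⟨ +-cong (trans (⨁-cong (permutations n) (marked-cycleInsert-zero a)) (⨁-*ˡ (permutations n) (g (suc a)) weight))
             (⨁-cong (allFin n) (λ j → ⨁-cong (permutations n) (λ π → marked-cycleInsert-suc a π j))) ⟩
      g (suc a) * total n + ⨁ (allFin n) (λ j → ⨁ (permutations n) (λ π → marked (suc a) π j)) ∎

  markedTotal-zero : ∀ a → markedTotal 0 a ≈ g (suc a) * total 0
  markedTotal-zero a = trans (markedTotal-split 0 a) (+-identityʳ _)

  -- Remove the marked point 0. If it was fixed, its cycle contributes g(a + 1) and the rest is
  -- unmarked; otherwise the mark passes to its successor with `a` raised by one, and by symmetry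
  -- all n + 1 successors contribute equally.
  markedTotal-suc : ∀ n a → markedTotal (suc n) a ≈ g (suc a) * total (suc n) + ι (suc n) * markedTotal n (suc a)
  markedTotal-suc n a = trans (markedTotal-split (suc n) a)
    (+-congˡ (trans (⨁-cong (allFin (suc n)) (⨁-marked-const (suc a))) (⨁-const (suc n) _)))

-- The three-term recurrence of the polynomials Bₙ
module SquaredBinomials (Q : CommutativeRing 0ℓ 0ℓ) where
  open CommutativeRing Q hiding (zero)
  open IntegerCoefficients Q

  module Pascal
    (β : ℕ → ℕ → Carrier)
    (β-0 : ∀ k → β k 0 ≈ 1#) (β-0-suc : ∀ i → β 0 (suc i) ≈ 0#)
    (β-pascal : ∀ k i → β (suc k) (suc i) ≈ β k i + β k (suc i))
    where
    open Relation.Binary.Reasoning.Setoid setoid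

    -- Follows from Pascal's rule inside the ring, where k - i is a true difference; the range i > k
    -- then needs no separate treatment.
    absorption : ∀ k i → ι (suc i) * β k (suc i) ≈ (ι k - ι i) * β k i
    absorption zero zero = begin
      (1# + 0#) * β 0 1   ≈⟨ *-congˡ (β-0-suc 0) ⟩
      (1# + 0#) * 0#      ≈⟨ solve 1 (λ b → (𝟙 :+ 𝟘) :* 𝟘 := (𝟘 :- 𝟘) :* b) refl (β 0 0) ⟩
      (0# - 0#) * β 0 0   ∎
    absorption zero (suc i) = trans (trans (*-congˡ (β-0-suc (suc i))) (zeroʳ _))
      (sym (trans (*-congˡ (β-0-suc i)) (zeroʳ _)))
    absorption (suc k) i = begin
      ι (suc i) * β (suc k) (suc i)
        ≈⟨ *-congˡ (β-pascal k i) ⟩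
      ι (suc i) * (β k i + β k (suc i))
        ≈⟨ distribˡ _ _ _ ⟩
      ι (suc i) * β k i + ι (suc i) * β k (suc i)
        ≈⟨ +-congˡ (absorption k i) ⟩
      (1# + ι i) * β k i + (ι k - ι i) * β k i
        ≈⟨ right i ⟩
      (ι (suc k) - ι i) * β (suc k) i ∎
      where
      right : ∀ i → (1# + ι i) * β k i + (ι k - ι i) * β k i ≈ (ι (suc k) - ι i) * β (suc k) i
      right zero    = trans
        (+-cong (*-congˡ (β-0 k)) (*-congˡ (β-0 k)))
        (trans (solve 1 (λ k → (𝟙 :+ 𝟘) :* 𝟙 :+ (k :- 𝟘) :* 𝟙 := (𝟙 :+ k :- 𝟘) :* 𝟙) refl (ι k))
          (sym (*-congˡ (β-0 (suc k)))))
      right (suc i) = begin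
        (1# + ι (suc i)) * β k (suc i) + (ι k - ι (suc i)) * β k (suc i)
          ≈⟨ solve 3 (λ k i p → (𝟙 :+ (𝟙 :+ i)) :* p :+ (k :- (𝟙 :+ i)) :* p := (𝟙 :+ i) :* p :+ (k :- i) :* p) refl (ι k) (ι i) _ ⟩
        ι (suc i) * β k (suc i) + (ι k - ι i) * β k (suc i)
          ≈⟨ +-congʳ (absorption k i) ⟩
        (ι k - ι i) * β k i + (ι k - ι i) * β k (suc i)
          ≈⟨ trans (*-congˡ (β-pascal k i)) (distribˡ _ _ _) ⟨
        (ι k - ι i) * β (suc k) (suc i)
          ≈⟨ *-congʳ (solve 2 (λ k i → k :- i := 𝟙 :+ k :- (𝟙 :+ i)) refl (ι k) (ι i)) ⟩
        (ι (suc k) - ι (suc i)) * β (suc k) (suc i) ∎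

    private
      -- p, q, r are three consecutive binomial coefficients of row K - 1, and e is the index of p.
      squares : ∀ K e p q r → e * p ≈ (K - e) * q → (K - e + 1#) * r ≈ (e - 1#) * q →
        (1# + K) * ((p + q + (q + r)) * (p + q + (q + r))) + K * (p * p - (q * q + q * q) + r * r)
          ≈ (1# + K + K) * ((p + q) * (p + q) + (q + r) * (q + r))
      squares K e p q r h₁ h₂ = begin
        (1# + K) * ((p + q + (q + r)) * (p + q + (q + r))) + K * (p * p - (q * q + q * q) + r * r)
          -- The two sides differ by a combination of the two absorption relations, with cofactors
          -- 2(q + r) and 2(p + q).
          ≈⟨ solve 5 (λ K e p q r →
               (𝟙 :+ K) :* ((p :+ q :+ (q :+ r)) :* (p :+ q :+ (q :+ r))) :+ K :* (p :* p :- (q :* q :+ q :* q) :+ r :* r)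
               := (𝟙 :+ K :+ K) :* ((p :+ q) :* (p :+ q) :+ (q :+ r) :* (q :+ r))
                 :+ ((r :+ q) :+ (r :+ q)) :* (e :* p :- (K :- e) :* q)
                 :+ ((p :+ q) :+ (p :+ q)) :* ((K :- e :+ 𝟙) :* r :- (e :- 𝟙) :* q)) refl K e p q r ⟩
        main + ((r + q) + (r + q)) * (e * p - (K - e) * q) + ((p + q) + (p + q)) * ((K - e + 1#) * r - (e - 1#) * q)
          ≈⟨ +-cong (+-congˡ (*-congˡ (trans (+-congʳ h₁) (-‿inverseʳ _)))) (*-congˡ (trans (+-congʳ h₂) (-‿inverseʳ _))) ⟩
        main + ((r + q) + (r + q)) * 0# + ((p + q) + (p + q)) * 0#
          ≈⟨ solve 3 (λ m a b → m :+ a :* 𝟘 :+ b :* 𝟘 := m) refl main _ _ ⟩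
        main ∎
        where main = (1# + K + K) * ((p + q) * (p + q) + (q + r) * (q + r))

    open PowerSeries Q hiding (commutativeRing)
    private
      A = PowerSeries.commutativeRing Q
      module A = CommutativeRing A
      module AI = IntegerCoefficients A

    ι-series : ∀ n → AI.ι n ≋ const (ι n)
    ι-series zero    = mk λ { zero → refl ; (suc n) → refl }
    ι-series (suc n) = A.trans (A.+-congˡ (ι-series n)) (A.sym (const-+ 1# (ι n)))

    N : ℕ → Series
    N k i = β k i * β k i

    private
      plus : ∀ k f i → ((A.1# A.+ AI.ι k A.+ AI.ι k) A.* f) i ≈ (1# + ι k + ι k) * f i
      plus k f i = trans (at (A.*-congʳ (A.trans (A.+-cong (A.+-congˡ (ι-series k)) (ι-series k))
        (A.sym (A.trans (const-+ _ _) (A.+-congʳ (const-+ _ _)))))) i) (const-⊛ _ f i)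

      ι-scale : ∀ k f i → (AI.ι k A.* f) i ≈ ι k * f i
      ι-scale k f i = trans (at (A.*-congʳ (ι-series k)) i) (const-⊛ (ι k) f i)

      expandʳ : ∀ f → (A.1# A.+ X) A.* f ≋ f A.+ X A.* f
      expandʳ f = AI.solve 2 (λ x f → (AI.𝟙 AI.:+ x) AI.:* f AI.:= f AI.:+ x AI.:* f) A.refl X f

      expandˡ : ∀ f → (A.1# A.- X) A.* (A.1# A.- X) A.* f ≋ f A.- (X A.* f A.+ X A.* f) A.+ X A.* (X A.* f)
      expandˡ f = AI.solve 2 (λ x f → (AI.𝟙 AI.:- x) AI.:* (AI.𝟙 AI.:- x) AI.:* f
        AI.:= f AI.:- (x AI.:* f AI.:+ x AI.:* f) AI.:+ x AI.:* (x AI.:* f)) A.refl X f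

      -- b₁ k i and b₂ k i stand for β k (i - 1) and β k (i - 2), with 0 at negative indices.
      b₁ : ℕ → ℕ → Carrier
      b₁ k zero    = 0#
      b₁ k (suc i) = β k i
      b₂ : ℕ → ℕ → Carrier
      b₂ k zero    = 0#
      b₂ k (suc i) = b₁ k i

      sq : (ℕ → Carrier) → ℕ → Carrier
      sq f i = f i * f i

      X-N : ∀ k i → (X A.* N k) i ≈ sq (b₁ k) i
      X-N k zero    = trans (at (X-⊛ (N k)) 0) (sym (zeroˡ 0#))
      X-N k (suc i) = at (X-⊛ (N k)) (suc i)

      XX-N : ∀ k i → (X A.* (X A.* N k)) i ≈ sq (b₂ k) i
      XX-N k zero    = trans (at (X-⊛ (X A.* N k)) 0) (sym (zeroˡ 0#))
      XX-N k (suc i) = trans (at (X-⊛ (X A.* N k)) (suc i)) (X-N k i)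

      pascal₀ : ∀ k i → β (suc k) i ≈ β k i + b₁ k i
      pascal₀ k zero    = trans (β-0 (suc k)) (sym (trans (+-congʳ (β-0 k)) (+-identityʳ 1#)))
      pascal₀ k (suc i) = trans (β-pascal k i) (+-comm _ _)

      pascal₁ : ∀ k i → b₁ (suc k) i ≈ b₁ k i + b₂ k i
      pascal₁ k zero    = sym (+-identityʳ 0#)
      pascal₁ k (suc i) = pascal₀ k i

      h₁ : ∀ k i → ι i * β k i ≈ (ι (suc k) - ι i) * b₁ k i
      h₁ k zero    = trans (zeroˡ _) (sym (zeroʳ _))
      h₁ k (suc i) = trans (absorption k i) (*-congʳ (solve 2 (λ k i → k :- i := 𝟙 :+ k :- (𝟙 :+ i)) refl (ι k) (ι i)))

      h₂ : ∀ k i → (ι (suc k) - ι i + 1#) * b₂ k i ≈ (ι i - 1#) * b₁ k i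
      h₂ k zero    = trans (zeroʳ _) (sym (zeroʳ _))
      h₂ k (suc i) = trans (*-congʳ (solve 2 (λ k i → 𝟙 :+ k :- (𝟙 :+ i) :+ 𝟙 := 𝟙 :+ k :- i) refl (ι k) (ι i)))
        (trans (sym (h₁ k i)) (*-congʳ (solve 1 (λ i → i := 𝟙 :+ i :- 𝟙) refl (ι i))))

    -- `N k` is (1 - x)ᵏ times the Legendre polynomial of degree k at (1 + x)/(1 - x), and this is
    -- Bonnet's recursion rescaled accordingly. Coefficient i involves only three adjacent binomials
    -- of row k, for which `squares` is the required identity.
    N-recurrence : ∀ k → AI.ι (suc (suc k)) A.* N (suc (suc k)) A.+ (A.1# A.- X) A.* (A.1# A.- X) A.* (AI.ι (suc k) A.* N k)
                           ≋ (A.1# A.+ X) A.* ((A.1# A.+ AI.ι (suc k) A.+ AI.ι (suc k)) A.* N (suc k))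
    N-recurrence k = mk λ i → begin
      (AI.ι (suc (suc k)) A.* N (suc (suc k))) i + ((A.1# A.- X) A.* (A.1# A.- X) A.* (AI.ι (suc k) A.* N k)) i
        ≈⟨ +-cong (ι-scale (suc (suc k)) (N (suc (suc k))) i) (trans (at (pull-ι ((A.1# A.- X) A.* (A.1# A.- X)) (N k)) i)
             (trans (ι-scale (suc k) _ i) (*-congˡ (trans (at (expandˡ (N k)) i)
               (+-cong (+-congˡ (-‿cong (+-cong (X-N k i) (X-N k i)))) (XX-N k i)))))) ⟩
      ι (suc (suc k)) * N (suc (suc k)) i + ι (suc k) * (sq (β k) i - (sq (b₁ k) i + sq (b₁ k) i) + sq (b₂ k) i)
        ≈⟨ +-congʳ (*-congˡ (*-cong (row₂ i) (row₂ i))) ⟩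
      ι (suc (suc k)) * ((β k i + b₁ k i + (b₁ k i + b₂ k i)) * (β k i + b₁ k i + (b₁ k i + b₂ k i)))
        + ι (suc k) * (sq (β k) i - (sq (b₁ k) i + sq (b₁ k) i) + sq (b₂ k) i)
        ≈⟨ squares (ι (suc k)) (ι i) (β k i) (b₁ k i) (b₂ k i) (h₁ k i) (h₂ k i) ⟩
      (1# + ι (suc k) + ι (suc k)) * ((β k i + b₁ k i) * (β k i + b₁ k i) + (b₁ k i + b₂ k i) * (b₁ k i + b₂ k i))
        ≈⟨ *-congˡ (+-cong (*-cong (pascal₀ k i) (pascal₀ k i)) (*-cong (pascal₁ k i) (pascal₁ k i))) ⟨
      (1# + ι (suc k) + ι (suc k)) * (N (suc k) i + sq (b₁ (suc k)) i)
        ≈⟨ *-congˡ (trans (at (expandʳ (N (suc k))) i) (+-congˡ (X-N (suc k) i))) ⟨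
      (1# + ι (suc k) + ι (suc k)) * ((A.1# A.+ X) A.* N (suc k)) i
        ≈⟨ plus (suc k) _ i ⟨
      ((A.1# A.+ AI.ι (suc k) A.+ AI.ι (suc k)) A.* ((A.1# A.+ X) A.* N (suc k))) i
        ≈⟨ at (AI.solve 3 (λ a b f → a AI.:* (b AI.:* f) AI.:= b AI.:* (a AI.:* f)) A.refl
             (A.1# A.+ AI.ι (suc k) A.+ AI.ι (suc k)) (A.1# A.+ X) (N (suc k))) i ⟩
      ((A.1# A.+ X) A.* ((A.1# A.+ AI.ι (suc k) A.+ AI.ι (suc k)) A.* N (suc k))) i ∎
      where
      row₂ : ∀ i → β (suc (suc k)) i ≈ β k i + b₁ k i + (b₁ k i + b₂ k i)
      row₂ i = trans (pascal₀ (suc k) i) (+-cong (pascal₀ k i) (pascal₁ k i))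
      pull-ι : ∀ a f → a A.* (AI.ι (suc k) A.* f) ≋ AI.ι (suc k) A.* (a A.* f)
      pull-ι a f = AI.solve 3 (λ a k f → a AI.:* (k AI.:* f) AI.:= k AI.:* (a AI.:* f)) A.refl a (AI.ι (suc k)) f

    N-zero : N 0 ≋ A.1#
    N-zero = mk λ { zero → trans (*-cong (β-0 0) (β-0 0)) (*-identityˡ 1#) ; (suc i) → trans (*-congʳ (β-0-suc i)) (zeroˡ _) }

    N-one : N 1 ≋ A.1# A.+ X
    N-one = mk λ
      { zero → trans (*-cong (β-0 1) (β-0 1)) (trans (*-identityˡ 1#) (sym (+-identityʳ 1#)))
      ; (suc zero) → trans (*-cong top top) (trans (*-identityˡ 1#) (sym (+-identityˡ 1#)))
      ; (suc (suc i)) → trans (*-congʳ (trans (β-pascal 0 (suc i)) (trans (+-cong (β-0-suc i) (β-0-suc (suc i))) (+-identityˡ 0#))))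
                          (trans (zeroˡ _) (sym (+-identityˡ 0#)))
      }
      where
      top : β 1 1 ≈ 1#
      top = trans (β-pascal 0 0) (trans (+-cong (β-0 0) (β-0-suc 0)) (+-identityʳ 1#))

-- The exponential formula as a differential equation

module ExponentialFormula (R : CommutativeRing 0ℓ 0ℓ) where
  open CommutativeRing R hiding (zero)
  open IntegerCoefficients R
  open PowerSeries R hiding (commutativeRing)

  module CycleSeries
    (φ : ℕ → Carrier) (φ-zero : φ 0 ≈ 1#) (φ-suc : ∀ n → ι (suc n) * φ (suc n) ≈ φ n)
    (γ : Series) (γ₀ : γ 0 ≈ 0#)
    where
    open Relation.Binary.Reasoning.Setoid setoid

    -- This is Pₙ(t), with φ(n) in the role of 1/n!. Giving every cycle an extra factor t produces
    -- the power of t counting cycles.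
    F : Carrier → Series
    F t n = φ n * CycleIndex.total R (λ m → t * γ m) n

    F₀ : ∀ t → F t 0 ≈ 1#
    F₀ t = trans (*-cong φ-zero (+-identityʳ 1#)) (*-identityˡ 1#)

    module _ (t : Carrier) where
      private module T = CycleIndex R (λ m → t * γ m)

      private
        tails : ℕ → Series
        tails a m = γ (a ℕ.+ m)

        -- Iterating `markedTotal-suc` lowers n and raises `a`, splitting according to the length of
        -- the marked cycle; the remaining points contribute a coefficient of `F t`. The case a = 0
        -- is the exponential formula; general `a` is what the induction needs.
        convolution : ∀ n a → φ n * T.markedTotal n a ≈ t * (tails (suc a) ⊛ F t) n
        convolution zero a = begin
          φ 0 * T.markedTotal 0 a
            ≈⟨ *-congˡ (T.markedTotal-zero a) ⟩
          φ 0 * (t * γ (suc a) * T.total 0)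
            ≈⟨ solve 4 (λ p t g s → p :* (t :* g :* s) := t :* (g :* (p :* s))) refl _ _ _ _ ⟩
          t * (γ (suc a) * F t 0)
            ≡⟨ ≡.cong (λ m → t * (γ (suc m) * F t 0)) (≡.sym (ℕ.+-identityʳ a)) ⟩
          t * (tails (suc a) ⊛ F t) 0 ∎
        convolution (suc n) a = begin
          φ (suc n) * T.markedTotal (suc n) a
            ≈⟨ *-congˡ (T.markedTotal-suc n a) ⟩
          φ (suc n) * (t * γ (suc a) * T.total (suc n) + ι (suc n) * T.markedTotal n (suc a))
            ≈⟨ solve 6 (λ p t g s k m → p :* (t :* g :* s :+ k :* m) := t :* (g :* (p :* s)) :+ k :* p :* m) refl _ _ _ _ _ _ ⟩
          t * (γ (suc a) * F t (suc n)) + ι (suc n) * φ (suc n) * T.markedTotal n (suc a)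
            ≈⟨ +-congˡ (trans (*-congʳ (φ-suc n)) (convolution n (suc a))) ⟩
          t * (γ (suc a) * F t (suc n)) + t * (tails (suc (suc a)) ⊛ F t) n
            ≈⟨ distribˡ t _ _ ⟨
          t * (γ (suc a) * F t (suc n) + (tails (suc (suc a)) ⊛ F t) n)
            ≈⟨ *-congˡ (+-cong (*-congʳ (reflexive (≡.cong (γ ∘ suc) (≡.sym (ℕ.+-identityʳ a)))))
                 (at (CommutativeRing.*-congʳ (PowerSeries.commutativeRing R) (mk λ m → reflexive (≡.cong (γ ∘ suc) (≡.sym (ℕ.+-suc a m))))) n)) ⟩
          t * (tails (suc a) ⊛ F t) (suc n) ∎

      F-exponential : ϑ (F t) ≋ const t ⊛ (γ ⊛ F t)
      F-exponential = mk λ n → trans (coefficient n) (sym (const-⊛ t (γ ⊛ F t) n))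
        where
        coefficient : ∀ n → ι n * F t n ≈ t * (γ ⊛ F t) n
        coefficient zero    = trans (zeroˡ _) (sym (trans (*-congˡ (trans (*-congʳ γ₀) (zeroˡ _))) (zeroʳ t)))
        coefficient (suc n) = begin
          ι (suc n) * (φ (suc n) * T.total (suc n))
            ≈⟨ trans (sym (*-assoc _ _ _)) (*-cong (φ-suc n) (T.total-suc n)) ⟩
          φ n * T.markedTotal n 0
            ≈⟨ convolution n 0 ⟩
          t * (tail γ ⊛ F t) n
            ≈⟨ *-congˡ (trans (+-congʳ (trans (*-congʳ γ₀) (zeroˡ _))) (+-identityˡ _)) ⟨
          t * (γ ⊛ F t) (suc n) ∎

module WeightScaling (R : CommutativeRing 0ℓ 0ℓ) where
  open CommutativeRing R hiding (zero)
  open IntegerCoefficients R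
  open Algebra.Properties.Semiring.Exp semiring using (_^_)
  open BigOp *-commutativeMonoid renaming (⨁ to ∏)

  ∏-scale : ∀ {I : Set} (xs : List I) t f → ∏ xs (λ i → t * f i) ≈ t ^ length xs * ∏ xs f
  ∏-scale []       t f = sym (*-identityˡ 1#)
  ∏-scale (x ∷ xs) t f = trans (*-congˡ (∏-scale xs t f))
    (solve 4 (λ t a b p → t :* a :* (b :* p) := t :* b :* (a :* p)) refl t (f x) _ _)

  weight-scale : ∀ t g {n} (w : Permutation′ n) →
    CycleIndex.weight R (λ m → t * g m) w ≈ CycleIndex.weight R g w * t ^ ℓ w
  weight-scale t g w = trans (∏-scale (cycleMins w) t _) (trans (*-comm _ _)
    (*-congˡ (reflexive (≡.cong (t ^_) (≡.sym (List.length-map (cycleLength w) (cycleMins w)))))))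

-- Rational numbers

ℚ-ring : CommutativeRing 0ℓ 0ℓ
ℚ-ring = ℚ.+-*-commutativeRing

open IntegerCoefficients ℚ-ring using () renaming (ι to ιℚ; ι-+ to ιℚ-+; ι-* to ιℚ-*)

private
  fromℚᵘ-+ : ∀ p q → ℚ.fromℚᵘ (p ℚᵘ.+ q) ≡ ℚ.fromℚᵘ p ℚ.+ ℚ.fromℚᵘ q
  fromℚᵘ-+ p q = ℚ.toℚᵘ-injective (ℚᵘ.≃-trans (ℚ.toℚᵘ-fromℚᵘ (p ℚᵘ.+ q)) (ℚᵘ.≃-sym
    (ℚᵘ.≃-trans (ℚ.toℚᵘ-homo-+ (ℚ.fromℚᵘ p) (ℚ.fromℚᵘ q)) (ℚᵘ.+-cong (ℚ.toℚᵘ-fromℚᵘ p) (ℚ.toℚᵘ-fromℚᵘ q)))))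

  fromℚᵘ-* : ∀ p q → ℚ.fromℚᵘ (p ℚᵘ.* q) ≡ ℚ.fromℚᵘ p ℚ.* ℚ.fromℚᵘ q
  fromℚᵘ-* p q = ℚ.toℚᵘ-injective (ℚᵘ.≃-trans (ℚ.toℚᵘ-fromℚᵘ (p ℚᵘ.* q)) (ℚᵘ.≃-sym
    (ℚᵘ.≃-trans (ℚ.toℚᵘ-homo-* (ℚ.fromℚᵘ p) (ℚ.fromℚᵘ q)) (ℚᵘ.*-cong (ℚ.toℚᵘ-fromℚᵘ p) (ℚ.toℚᵘ-fromℚᵘ q)))))

fromℕ-suc : ∀ m → fromℕ (suc m) ≡ 1ℚ ℚ.+ fromℕ m
fromℕ-suc m = ≡.trans (ℚ.fromℚᵘ-cong {ℚᵘ.mkℚᵘ (ℤ.+ suc m) 0} {ℚᵘ.1ℚᵘ ℚᵘ.+ ℚᵘ.mkℚᵘ (ℤ.+ m) 0}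
    (ℚᵘ.*≡* (≡.cong (ℤ._* ℤ.+ 1) (≡.cong (ℤ._+_ (ℤ.+ 1)) (≡.sym (ℤ.*-identityʳ (ℤ.+ m)))))))
  (fromℚᵘ-+ ℚᵘ.1ℚᵘ (ℚᵘ.mkℚᵘ (ℤ.+ m) 0))

fromℕ≡ι : ∀ m → fromℕ m ≡ ιℚ m
fromℕ≡ι zero    = ≡.refl
fromℕ≡ι (suc m) = ≡.trans (fromℕ-suc m) (≡.cong (1ℚ ℚ.+_) (fromℕ≡ι m))

fromℕ-* : ∀ m n → fromℕ (m ℕ.* n) ≡ fromℕ m ℚ.* fromℕ n
fromℕ-* m n = ≡.trans (fromℕ≡ι (m ℕ.* n)) (≡.trans (ιℚ-* m n) (≡.sym (≡.cong₂ ℚ._*_ (fromℕ≡ι m) (fromℕ≡ι n))))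

fromℕ-+ : ∀ m n → fromℕ (m ℕ.+ n) ≡ fromℕ m ℚ.+ fromℕ n
fromℕ-+ m n = ≡.trans (fromℕ≡ι (m ℕ.+ n)) (≡.trans (ιℚ-+ m n) (≡.sym (≡.cong₂ ℚ._+_ (fromℕ≡ι m) (fromℕ≡ι n))))

inverse-fromℕ : ∀ m .{{_ : NonZero m}} → fromℕ m ℚ.* (ℤ.+ 1 ℚ./ m) ≡ 1ℚ
inverse-fromℕ (suc m) = ≡.trans (≡.sym (fromℚᵘ-* (ℚᵘ.mkℚᵘ (ℤ.+ suc m) 0) (ℚᵘ.mkℚᵘ (ℤ.+ 1) m)))
  (ℚ.fromℚᵘ-cong {ℚᵘ.mkℚᵘ (ℤ.+ suc m) 0 ℚᵘ.* ℚᵘ.mkℚᵘ (ℤ.+ 1) m} {ℚᵘ.1ℚᵘ} (ℚᵘ.*≡* (≡.trans (≡.cong (ℤ._* ℤ.+ 1) (ℤ.*-identityʳ (ℤ.+ suc m)))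
    (≡.trans (ℤ.*-identityʳ (ℤ.+ suc m)) (≡.sym (≡.trans (ℤ.*-identityˡ _) (≡.cong (λ k → ℤ.+ suc k) (ℕ.+-identityʳ m))))))))

inverse-unique : ∀ m .{{_ : NonZero m}} {q} → fromℕ m ℚ.* q ≡ 1ℚ → q ≡ ℤ.+ 1 ℚ./ m
inverse-unique m {q} eq = begin
  q                                     ≡⟨ ℚ.*-identityʳ q ⟨
  q ℚ.* 1ℚ                              ≡⟨ ≡.cong (q ℚ.*_) (inverse-fromℕ m) ⟨
  q ℚ.* (fromℕ m ℚ.* (ℤ.+ 1 ℚ./ m))     ≡⟨ ℚ.*-assoc q _ _ ⟨
  q ℚ.* fromℕ m ℚ.* (ℤ.+ 1 ℚ./ m)       ≡⟨ ≡.cong (ℚ._* (ℤ.+ 1 ℚ./ m)) (≡.trans (ℚ.*-comm q _) eq) ⟩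
  1ℚ ℚ.* (ℤ.+ 1 ℚ./ m)                  ≡⟨ ℚ.*-identityˡ _ ⟩
  ℤ.+ 1 ℚ./ m                           ∎
  where open ≡.≡-Reasoning

ιℚ-cancel : ∀ n {a} → ιℚ (suc n) ℚ.* a ≡ 0ℚ → a ≡ 0ℚ
ιℚ-cancel n {a} eq = begin
  a                                               ≡⟨ ℚ.*-identityˡ a ⟨
  1ℚ ℚ.* a                                        ≡⟨ ≡.cong (ℚ._* a) (≡.trans (ℚ.*-comm _ (fromℕ (suc n))) (inverse-fromℕ (suc n))) ⟨
  (ℤ.+ 1 ℚ./ suc n) ℚ.* fromℕ (suc n) ℚ.* a       ≡⟨ ℚ.*-assoc (ℤ.+ 1 ℚ./ suc n) _ a ⟩
  (ℤ.+ 1 ℚ./ suc n) ℚ.* (fromℕ (suc n) ℚ.* a)     ≡⟨ ≡.cong (λ b → (ℤ.+ 1 ℚ./ suc n) ℚ.* (b ℚ.* a)) (fromℕ≡ι (suc n)) ⟩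
  (ℤ.+ 1 ℚ./ suc n) ℚ.* (ιℚ (suc n) ℚ.* a)        ≡⟨ ≡.cong ((ℤ.+ 1 ℚ./ suc n) ℚ.*_) eq ⟩
  (ℤ.+ 1 ℚ./ suc n) ℚ.* 0ℚ                        ≡⟨ ℚ.*-zeroʳ (ℤ.+ 1 ℚ./ suc n) ⟩
  0ℚ                                              ∎
  where open ≡.≡-Reasoning

1/_! : ℕ → ℚ
1/ n ! = (ℤ.+ 1 ℚ./ (n !)) {{n ℕ.!≢0}}

1/-suc! : ∀ n → fromℕ (suc n) ℚ.* 1/ suc n ! ≡ 1/ n !
1/-suc! n = inverse-unique (n !) {{n ℕ.!≢0}} (begin
  fromℕ (n !) ℚ.* (fromℕ (suc n) ℚ.* 1/ suc n !)   ≡⟨ ℚ.*-assoc (fromℕ (n !)) _ _ ⟨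
  fromℕ (n !) ℚ.* fromℕ (suc n) ℚ.* 1/ suc n !     ≡⟨ ≡.cong (ℚ._* 1/ suc n !) (≡.trans (ℚ.*-comm (fromℕ (n !)) _) (≡.sym (fromℕ-* (suc n) (n !)))) ⟩
  fromℕ (suc n !) ℚ.* 1/ suc n !                   ≡⟨ inverse-fromℕ (suc n !) {{suc n ℕ.!≢0}} ⟩
  1ℚ                                               ∎)
  where open ≡.≡-Reasoning

private
  interchange : ∀ a b c d → a ℚ.* b ℚ.* (c ℚ.* d) ≡ (a ℚ.* c) ℚ.* (b ℚ.* d)
  interchange = solve 4 (λ a b c d → a :* b :* (c :* d) := (a :* c) :* (b :* d)) ≡.refl
    where open IntegerCoefficients ℚ-ring using (solve; _:*_; _:=_)

1/!-* : ∀ n k → 1/ n ! ℚ.* 1/ k ! ≡ (ℤ.+ 1 ℚ./ (n ! ℕ.* k !)) {{n ℕ.!* k !≢0}}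
1/!-* n k = inverse-unique (n ! ℕ.* k !) {{n ℕ.!* k !≢0}} (begin
  fromℕ (n ! ℕ.* k !) ℚ.* (1/ n ! ℚ.* 1/ k !)            ≡⟨ ≡.cong (ℚ._* (1/ n ! ℚ.* 1/ k !)) (fromℕ-* (n !) (k !)) ⟩
  fromℕ (n !) ℚ.* fromℕ (k !) ℚ.* (1/ n ! ℚ.* 1/ k !)    ≡⟨ interchange (fromℕ (n !)) (fromℕ (k !)) (1/ n !) (1/ k !) ⟩
  (fromℕ (n !) ℚ.* 1/ n !) ℚ.* (fromℕ (k !) ℚ.* 1/ k !)  ≡⟨ ≡.cong₂ ℚ._*_ (inverse-fromℕ (n !) {{n ℕ.!≢0}}) (inverse-fromℕ (k !) {{k ℕ.!≢0}}) ⟩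
  1ℚ ∎)
  where open ≡.≡-Reasoning

binomial-factorials : ∀ n k → ((n ℕ.+ k) C n) ℕ.* (n ! ℕ.* k !) ≡ (n ℕ.+ k) !
binomial-factorials n k = ≡.subst (λ m → ((n ℕ.+ k) C n) ℕ.* (n ! ℕ.* m !) ≡ (n ℕ.+ k) !) (ℕ.m+n∸m≡n n k)
  (≡.trans (≡.cong (ℕ._* (n ! ℕ.* ((n ℕ.+ k) ℕ.∸ n) !)) (nCk≡n!/k![n-k]! (ℕ.m≤m+n n k)))
    (m/n*n≡m {{n ℕ.!* ((n ℕ.+ k) ℕ.∸ n) !≢0}} (k![n∸k]!∣n! (ℕ.m≤m+n n k))))

fromℕ-binomial : ∀ n k → fromℕ ((n ℕ.+ k) !) ℚ.* (1/ n ! ℚ.* 1/ k !) ≡ fromℕ ((n ℕ.+ k) C n)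
fromℕ-binomial n k = begin
  fromℕ ((n ℕ.+ k) !) ℚ.* (1/ n ! ℚ.* 1/ k !)
    ≡⟨ ≡.cong₂ ℚ._*_ (≡.trans (≡.cong fromℕ (≡.sym (binomial-factorials n k))) (fromℕ-* ((n ℕ.+ k) C n) (n ! ℕ.* k !))) (1/!-* n k) ⟩
  fromℕ ((n ℕ.+ k) C n) ℚ.* fromℕ (n ! ℕ.* k !) ℚ.* (ℤ.+ 1 ℚ./ (n ! ℕ.* k !)) {{n ℕ.!* k !≢0}}
    ≡⟨ ℚ.*-assoc (fromℕ ((n ℕ.+ k) C n)) _ _ ⟩
  fromℕ ((n ℕ.+ k) C n) ℚ.* (fromℕ (n ! ℕ.* k !) ℚ.* (ℤ.+ 1 ℚ./ (n ! ℕ.* k !)) {{n ℕ.!* k !≢0}})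
    ≡⟨ ≡.cong (fromℕ ((n ℕ.+ k) C n) ℚ.*_) (inverse-fromℕ (n ! ℕ.* k !) {{n ℕ.!* k !≢0}}) ⟩
  fromℕ ((n ℕ.+ k) C n) ℚ.* 1ℚ
    ≡⟨ ℚ.*-identityʳ _ ⟩
  fromℕ ((n ℕ.+ k) C n) ∎
  where open ≡.≡-Reasoning

nC0≡1 : ∀ n → n C 0 ≡ 1
nC0≡1 zero    = ≡.refl
nC0≡1 (suc n) = ≡.refl

-- Both averages as sums over the nodes

module Averages (Q : CommutativeRing 0ℓ 0ℓ) where
  private A = PowerSeries.commutativeRing Q
  open CommutativeRing A hiding (zero)
  open IntegerCoefficients A
  open PowerSeries Q using (X; Σ∞; Σ∞-cong; Σ∞-*)

  module Evaluation
    (ι-cancel : ∀ n {a} → ι (suc n) * a ≈ 0# → a ≈ 0#)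
    (φ : ℕ → Carrier) (φ-zero : φ 0 ≈ 1#) (φ-suc : ∀ n → ι (suc n) * φ (suc n) ≈ φ n)
    (γ : ℕ → Carrier) (γ-zero : γ 0 ≈ 0#) (γ-one : γ 1 ≈ 1#)
    (γ-recurrence : ∀ k → ι (suc k) * γ (suc (suc k)) + (1# - X) * (1# - X) * (ι k * γ k)
                          ≈ (1# + X) * ((1# + ι k + ι k) * γ (suc k)))
    where

    open Algebra.Properties.Semiring.Exp semiring using (_^_; ^-homo-*)
    open RingSums A
    open Eulerian Q using (c; node; Σ∞-⨁; eulerian-series; module Exchange)
    open Relation.Binary.Reasoning.Setoid setoid
    open ExponentialFormula.CycleSeries A φ φ-zero φ-suc γ γ-zero using (F; F₀; F-exponential)
    open Narayana.Recurrence A ι-cancel X γ γ-zero γ-one γ-recurrence using (exponential-unique; exponential-1; module Family)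
    open Family F F₀ F-exponential using (F-cong; difference-equation)

    private
      -- At t = 0 the constant series 1 solves the same equation with the same initial value, so
      -- uniqueness applies.
      F-zero : ∀ n → F 0# (suc n) ≈ 0#
      F-zero n = PowerSeries.at (exponential-unique refl (F-exponential 0#) exponential-1 (F₀ 0#)) (suc n)

    open Exchange F (λ p → PowerSeries.at (F-cong p)) F-zero difference-equation using (J; J-+)

    private
      t : ℕ → Carrier
      t m = node (suc m)

      T : ℕ → ℕ → Carrier
      T m n = CycleIndex.total A (λ a → t m * γ a) n

      b : ∀ {n} → Permutation′ n → Carrier
      b = CycleIndex.weight A γ

      e : ℕ → Carrier
      e n = ⨁ (permutations n) (λ w → X ^ des w)

      W : ℕ → ∀ {n} → Permutation′ n → Carrier
      W m = CycleIndex.weight A (λ a → t m * γ a)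

      W≈ : ∀ m {n} (w : Permutation′ n) → W m w ≈ b w * t m ^ ℓ w
      W≈ m = WeightScaling.weight-scale A (t m) γ

      pull-Σ∞ : ∀ a f → a * (c * Σ∞ f) ≈ c * Σ∞ (λ m → a * f m)
      pull-Σ∞ a f = trans (solve 3 (λ a c s → a :* (c :* s) := c :* (a :* s)) refl a c _) (*-congˡ (sym (Σ∞-* a f)))

      ⨁-cΣ∞ : ∀ {I : Set} (xs : List I) f → ⨁ xs (λ i → c * Σ∞ (f i)) ≈ c * Σ∞ (λ m → ⨁ xs (λ i → f i m))
      ⨁-cΣ∞ xs f = trans (⨁-*ˡ xs c _) (*-congˡ (sym (Σ∞-⨁ xs f)))

    single : ℕ → Carrier
    single n = ⨁ (permutations n) (λ w → b w * e (ℓ w))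

    double : ℕ → ℕ → Carrier
    double n k = ⨁ (permutations n) (λ π → ⨁ (permutations k) (λ σ → b π * b σ * e (ℓ π ℕ.+ ℓ σ)))

    private
      single-series : ∀ n → single n ≈ c * Σ∞ (λ m → T m n)
      single-series n = begin
        single n
          ≈⟨ ⨁-cong (permutations n) (λ w → trans (*-congˡ (eulerian-series (ℓ w))) (pull-Σ∞ (b w) _)) ⟩
        ⨁ (permutations n) (λ w → c * Σ∞ (λ m → b w * t m ^ ℓ w))
          ≈⟨ ⨁-cΣ∞ (permutations n) _ ⟩
        c * Σ∞ (λ m → ⨁ (permutations n) (λ w → b w * t m ^ ℓ w))
          ≈⟨ *-congˡ (Σ∞-cong (λ m → ⨁-cong (permutations n) (W≈ m))) ⟨
        c * Σ∞ (λ m → T m n) ∎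

      double-series : ∀ n k → double n k ≈ c * Σ∞ (λ m → T m n * T m k)
      double-series n k = begin
        double n k
          ≈⟨ ⨁-cong (permutations n) (λ π → ⨁-cong (permutations k) (λ σ →
               trans (*-congˡ (eulerian-series (ℓ π ℕ.+ ℓ σ))) (trans (pull-Σ∞ _ _) (*-congˡ (Σ∞-cong (factor π σ)))))) ⟩
        ⨁ (permutations n) (λ π → ⨁ (permutations k) (λ σ → c * Σ∞ (λ m → W m π * W m σ)))
          ≈⟨ trans (⨁-cong (permutations n) (λ π → ⨁-cΣ∞ (permutations k) _)) (⨁-cΣ∞ (permutations n) _) ⟩
        c * Σ∞ (λ m → ⨁ (permutations n) (λ π → ⨁ (permutations k) (λ σ → W m π * W m σ)))
          ≈⟨ *-congˡ (Σ∞-cong (λ m → trans (⨁-cong (permutations n) (λ π → ⨁-*ˡ (permutations k) (W m π) (W m)))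
               (⨁-*ʳ (permutations n) (T m k) (W m)))) ⟩
        c * Σ∞ (λ m → T m n * T m k) ∎
        where
        factor : ∀ (π : Permutation′ n) (σ : Permutation′ k) m → b π * b σ * t m ^ (ℓ π ℕ.+ ℓ σ) ≈ W m π * W m σ
        factor π σ m = trans (*-congˡ (^-homo-* (t m) (ℓ π) (ℓ σ)))
          (trans (solve 4 (λ a b p q → a :* b :* (p :* q) := (a :* p) :* (b :* q)) refl _ _ _ _)
            (sym (*-cong (W≈ m π) (W≈ m σ))))

    single-double : ∀ n k → φ (n ℕ.+ k) * single (n ℕ.+ k) ≈ φ n * φ k * double n k
    single-double n k = begin
      φ (n ℕ.+ k) * single (n ℕ.+ k)
        ≈⟨ trans (*-congˡ (single-series (n ℕ.+ k))) (pull-Σ∞ _ _) ⟩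
      c * Σ∞ (λ m → F (t m) (n ℕ.+ k))
        -- Since P₀ = 1, the single average is the case k = 0 of J, and both sides of the theorem
        -- become values of J.
        ≈⟨ *-congˡ (Σ∞-cong (λ m → trans (*-congˡ (F₀ (t m))) (*-identityʳ _))) ⟨
      c * J (n ℕ.+ k) 0
        ≈⟨ *-congˡ (J-+ n k) ⟨
      c * J n k
        ≈⟨ *-congˡ (Σ∞-cong (λ m → solve 4 (λ a b p q → (a :* p) :* (b :* q) := a :* b :* (p :* q)) refl (φ n) (φ k) _ _)) ⟩
      c * Σ∞ (λ m → φ n * φ k * (T m n * T m k))
        ≈⟨ trans (*-congˡ (double-series n k)) (pull-Σ∞ _ _) ⟨
      φ n * φ k * double n k ∎

-- Transfer to polynomials with rational coefficients

module Coefficients where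
  open PowerSeries ℚ-ring using (Series; _≋_; mk; at; 𝟎; const; const-⊛; const-*; const-cong; X; X-⊛)

  -- The coefficient function of a polynomial is already an element of this ring, and `p ≈ₚ q` is
  -- literally the content of `coeff p ≋ coeff q`.
  A : CommutativeRing 0ℓ 0ℓ
  A = PowerSeries.commutativeRing ℚ-ring

  open CommutativeRing A hiding (zero)
  open Algebra.Properties.Semiring.Exp semiring using (_^_)
  open IntegerCoefficients A
  open RingSums A

  coeff-+ : ∀ p q → coeff (p +ₚ q) ≋ coeff p + coeff q
  coeff-+ p q = mk (go p q)
    where
    go : ∀ p q i → coeff (p +ₚ q) i ≡ coeff p i ℚ.+ coeff q i
    go []       q        i       = ≡.sym (ℚ.+-identityˡ _)
    go (a ∷ as) []       i       = ≡.sym (ℚ.+-identityʳ _)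
    go (a ∷ as) (b ∷ bs) zero    = ≡.refl
    go (a ∷ as) (b ∷ bs) (suc i) = go as bs i

  private
    coeff-•′ : ∀ a p i → coeff (a • p) i ≡ a ℚ.* coeff p i
    coeff-•′ a []       i       = ≡.sym (ℚ.*-zeroʳ a)
    coeff-•′ a (b ∷ bs) zero    = ≡.refl
    coeff-•′ a (b ∷ bs) (suc i) = coeff-•′ a bs i

  coeff-• : ∀ a p → coeff (a • p) ≋ const a * coeff p
  coeff-• a p = mk λ i → ≡.trans (coeff-•′ a p i) (≡.sym (const-⊛ a (coeff p) i))

  coeff-* : ∀ p q → coeff (p *ₚ q) ≋ coeff p * coeff q
  coeff-* p q = mk (go p)
    where
    go : ∀ p i → coeff (p *ₚ q) i ≡ (coeff p * coeff q) i
    go []       i = ≡.sym (at (trans (*-congʳ (mk {coeff []} {𝟎} λ _ → ≡.refl)) (zeroˡ (coeff q))) i)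
    go (a ∷ as) i = ≡.trans (at (coeff-+ (a • q) (0ℚ ∷ (as *ₚ q))) i) (step i)
      where
      step : ∀ i → coeff (a • q) i ℚ.+ coeff (0ℚ ∷ (as *ₚ q)) i ≡ (coeff (a ∷ as) * coeff q) i
      step zero    = ≡.trans (ℚ.+-identityʳ _) (coeff-•′ a q 0)
      step (suc i) = ≡.cong₂ ℚ._+_ (coeff-•′ a q (suc i)) (go as i)

  coeff-1 : coeff 1ₚ ≋ 1#
  coeff-1 = mk λ { zero → ≡.refl ; (suc i) → ≡.refl }

  coeff-x^ : ∀ k → coeff (x^ k) ≋ X ^ k
  coeff-x^ zero    = coeff-1
  coeff-x^ (suc k) = trans (mk λ { zero → ≡.refl ; (suc i) → ≡.refl })
    (trans (sym (X-⊛ (coeff (x^ k)))) (*-congˡ (coeff-x^ k)))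

  coeff-∑ : ∀ {I : Set} (xs : List I) f → coeff (∑ xs f) ≋ ⨁ xs (coeff ∘ f)
  coeff-∑ []       f = mk λ _ → ≡.refl
  coeff-∑ (x ∷ xs) f = trans (coeff-+ (f x) (∑ xs f)) (+-congˡ {coeff (f x)} (coeff-∑ xs f))

  coeff-E : ∀ n → coeff (E n) ≋ ⨁ (permutations n) (λ w → X ^ des w)
  coeff-E n = trans (coeff-∑ (permutations n) _) (⨁-cong (permutations n) (λ w → coeff-x^ (des w)))

  γ : ℕ → Carrier
  γ n = coeff (B n)

  coeff-B[] : ∀ {n} (w : Permutation′ n) → coeff B[ w ] ≋ CycleIndex.weight A γ w
  coeff-B[] w = go (cycleMins w)
    where
    open BigOp *-commutativeMonoid using () renaming (⨁ to ∏)
    go : ∀ xs → coeff (productₚ (map B (map (cycleLength w) xs))) ≋ ∏ xs (γ ∘ cycleLength w)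
    go []       = coeff-1
    go (x ∷ xs) = trans (coeff-* (B (cycleLength w x)) _) (*-congˡ (go xs))

  private
    ∑-shift : (xs : List ℕ) (a : ℕ → ℚ) → ∀ i → coeff (∑[ m ∈ xs ] a m • x^ (suc m)) (suc i) ≡ coeff (∑[ m ∈ xs ] a m • x^ m) i
    ∑-shift []       a i = ≡.refl
    ∑-shift (m ∷ xs) a i = ≡.trans (at (coeff-+ (a m • x^ (suc m)) (∑[ m ∈ xs ] a m • x^ (suc m))) (suc i))
      (≡.trans (≡.cong (coeff (a m • x^ m) i ℚ.+_) (∑-shift xs a i))
        (≡.sym (at (coeff-+ (a m • x^ m) (∑[ m ∈ xs ] a m • x^ m)) i)))

    ∑-shift-zero : (xs : List ℕ) (a : ℕ → ℚ) → coeff (∑[ m ∈ xs ] a m • x^ (suc m)) 0 ≡ 0ℚ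
    ∑-shift-zero []       a = ≡.refl
    ∑-shift-zero (m ∷ xs) a = ≡.trans (at (coeff-+ (a m • x^ (suc m)) (∑[ m ∈ xs ] a m • x^ (suc m))) 0)
      (≡.cong₂ ℚ._+_ (ℚ.*-zeroʳ (a m)) (∑-shift-zero xs a))

  -- The induction peels off the constant term and shifts `a`. Beyond n the sum has no terms, whence
  -- the vanishing hypothesis, which binomial coefficients satisfy.
  coeff-upTo : ∀ n (a : ℕ → ℚ) → (∀ i → n ≤ i → a i ≡ 0ℚ) → ∀ i → coeff (∑[ m ∈ upTo n ] a m • x^ m) i ≡ a i
  coeff-upTo zero    a a≡0 i = ≡.sym (a≡0 i z≤n)
  coeff-upTo (suc n) a a≡0 i = ≡.trans (≡.cong (λ p → coeff p i) split)
      (≡.trans (at (coeff-+ (a 0 • x^ 0) (∑[ m ∈ upTo n ] a (suc m) • x^ (suc m))) i) (value i))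
    where
    split : (∑[ m ∈ upTo (suc n) ] a m • x^ m) ≡ a 0 • x^ 0 +ₚ (∑[ m ∈ upTo n ] a (suc m) • x^ (suc m))
    split = ≡.cong (a 0 • x^ 0 +ₚ_) (≡.trans (≡.cong (λ xs → ∑ xs (λ m → a m • x^ m)) (≡.sym (List.map-applyUpTo (λ m → m) suc n)))
      (List.foldr-map (λ m p → a m • x^ m +ₚ p) suc 0ₚ (upTo n)))
    value : ∀ i → coeff (a 0 • x^ 0) i ℚ.+ coeff (∑[ m ∈ upTo n ] a (suc m) • x^ (suc m)) i ≡ a i
    value zero    = ≡.trans (≡.cong₂ ℚ._+_ (ℚ.*-identityʳ (a 0)) (∑-shift-zero (upTo n) (a ∘ suc))) (ℚ.+-identityʳ (a 0))
    value (suc i) = ≡.trans (ℚ.+-identityˡ _) (≡.trans (∑-shift (upTo n) (a ∘ suc) i)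
      (coeff-upTo n (a ∘ suc) (λ j n≤j → a≡0 (suc j) (s≤s n≤j)) i))

  open SquaredBinomials.Pascal ℚ-ring (λ k i → fromℕ (k C i))
    (λ k → ≡.cong fromℕ (nC0≡1 k)) (λ i → ≡.cong fromℕ (k>n⇒nCk≡0 {0} {suc i} (s≤s z≤n)))
    (λ k i → ≡.trans (≡.cong fromℕ (≡.sym (nCk+nC[k+1]≡[n+1]C[k+1] k i))) (fromℕ-+ (k C i) (k C suc i)))
    using (N; N-recurrence; N-zero; N-one; ι-series)

  γ-zero : γ 0 ≈ 0#
  γ-zero = mk λ _ → ≡.refl

  γ-suc : ∀ k → γ (suc k) ≈ N k
  γ-suc k = mk λ i → ≡.trans
    (coeff-upTo (suc k) (λ i → fromℕ ((k C i) ℕ.^ 2)) (λ i k<i → ≡.cong (λ m → fromℕ (m ℕ.^ 2)) (k>n⇒nCk≡0 k<i)) i)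
    (≡.trans (≡.cong (λ m → fromℕ ((k C i) ℕ.* m)) (ℕ.*-identityʳ (k C i))) (fromℕ-* (k C i) (k C i)))

  γ-one : γ 1 ≈ 1#
  γ-one = trans (γ-suc 0) N-zero

  γ-recurrence : ∀ k → ι (suc k) * γ (suc (suc k)) + (1# - X) * (1# - X) * (ι k * γ k)
                 ≈ (1# + X) * ((1# + ι k + ι k) * γ (suc k))
  -- `γ 0` is not of the form `N k`, so the recurrence starts with a separate case, B₂ = (1 + x) B₁.
  γ-recurrence zero = trans (+-cong (*-congˡ (trans (γ-suc 1) N-one)) (*-congˡ (zeroˡ _)))
    (trans (solve 1 (λ x → (𝟙 :+ 𝟘) :* (𝟙 :+ x) :+ (𝟙 :- x) :* (𝟙 :- x) :* 𝟘
        := (𝟙 :+ x) :* ((𝟙 :+ 𝟘 :+ 𝟘) :* 𝟙)) refl X)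
      (sym (*-congˡ (*-congˡ γ-one))))
  γ-recurrence (suc k) = trans (+-cong (*-congˡ (γ-suc (suc (suc k)))) (*-congˡ (*-congˡ (γ-suc k))))
    (trans (N-recurrence k) (sym (*-congˡ (*-congˡ (γ-suc (suc k))))))

  ι-cancel : ∀ n {a} → ι (suc n) * a ≈ 0# → a ≈ 0#
  ι-cancel n {a} p = mk λ i → ιℚ-cancel n (≡.trans
    (≡.sym (≡.trans (at (*-congʳ (ι-series (suc n))) i) (const-⊛ (ιℚ (suc n)) a i))) (at p i))

  φ : ℕ → Carrier
  φ n = const (1/ n !)

  φ-suc : ∀ n → ι (suc n) * φ (suc n) ≈ φ n
  φ-suc n = trans (*-congʳ (trans (ι-series (suc n)) (const-cong (≡.sym (fromℕ≡ι (suc n))))))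
    (trans (sym (const-* (fromℕ (suc n)) (1/ suc n !))) (const-cong (1/-suc! n)))

  φ-zero : φ 0 ≈ 1#
  φ-zero = const-cong ≡.refl

  open Averages.Evaluation ℚ-ring ι-cancel φ φ-zero φ-suc γ γ-zero γ-one γ-recurrence using (single; double; single-double)

  private
    singleₚ : ℕ → Poly
    singleₚ n = ∑[ w ∈ permutations n ] B[ w ] *ₚ E (ℓ w)

    doubleₚ : ℕ → ℕ → Poly
    doubleₚ n k = ∑[ π ∈ permutations n ] ∑[ σ ∈ permutations k ] B[ π ] *ₚ B[ σ ] *ₚ E (ℓ π ℕ.+ ℓ σ)

    coeff-single : ∀ n → coeff (singleₚ n) ≋ single n
    coeff-single n = trans (coeff-∑ (permutations n) _) (⨁-cong (permutations n) λ w →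
      trans (coeff-* B[ w ] (E (ℓ w))) (*-cong (coeff-B[] w) (coeff-E (ℓ w))))

    coeff-double : ∀ n k → coeff (doubleₚ n k) ≋ double n k
    coeff-double n k = trans (coeff-∑ (permutations n) _) (⨁-cong (permutations n) λ π →
      trans (coeff-∑ (permutations k) _) (⨁-cong (permutations k) λ σ →
        trans (coeff-* (B[ π ] *ₚ B[ σ ]) (E (ℓ π ℕ.+ ℓ σ)))
          (*-cong (trans (coeff-* B[ π ] B[ σ ]) (*-cong (coeff-B[] π) (coeff-B[] σ))) (coeff-E (ℓ π ℕ.+ ℓ σ)))))

    -- The common source of both forms of the theorem: one rewrites the scalars as fractions, the
    -- other multiplies by (n + k)! to produce the binomial coefficient.
    scaled : ∀ n k → φ (n ℕ.+ k) * coeff (singleₚ (n ℕ.+ k)) ≈ φ n * φ k * coeff (doubleₚ n k)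
    scaled n k = trans (*-congˡ {φ (n ℕ.+ k)} (coeff-single (n ℕ.+ k)))
      (trans (single-double n k) (sym (*-congˡ {φ n * φ k} (coeff-double n k))))

  open Relation.Binary.Reasoning.Setoid setoid

  normalised : ∀ n k → coeff (1/ n ℕ.+ k ! • singleₚ (n ℕ.+ k)) ≈ coeff ((_/_ (ℤ.+ 1) (n ! ℕ.* k !) {{n !* k !≢0}}) • doubleₚ n k)
  normalised n k = begin
    coeff (1/ n ℕ.+ k ! • singleₚ (n ℕ.+ k))
      ≈⟨ coeff-• (1/ n ℕ.+ k !) (singleₚ (n ℕ.+ k)) ⟩
    φ (n ℕ.+ k) * coeff (singleₚ (n ℕ.+ k))
      ≈⟨ scaled n k ⟩
    φ n * φ k * coeff (doubleₚ n k)
      ≈⟨ *-congʳ (trans (sym (const-* (1/ n !) (1/ k !))) (const-cong (1/!-* n k))) ⟩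
    const (_/_ (ℤ.+ 1) (n ! ℕ.* k !) {{n !* k !≢0}}) * coeff (doubleₚ n k)
      ≈⟨ coeff-• _ (doubleₚ n k) ⟨
    coeff ((_/_ (ℤ.+ 1) (n ! ℕ.* k !) {{n !* k !≢0}}) • doubleₚ n k) ∎

  cleared : ∀ n k → coeff (singleₚ (n ℕ.+ k)) ≈ coeff (fromℕ ((n ℕ.+ k) C n) • doubleₚ n k)
  cleared n k = begin
    coeff (singleₚ (n ℕ.+ k))
      ≈⟨ *-identityˡ _ ⟨
    1# * coeff (singleₚ (n ℕ.+ k))
      ≈⟨ *-congʳ (trans (sym (const-* (fromℕ ((n ℕ.+ k) !)) (1/ n ℕ.+ k !))) (const-cong (inverse-fromℕ ((n ℕ.+ k) !) {{(n ℕ.+ k) !≢0}}))) ⟨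
    const (fromℕ ((n ℕ.+ k) !)) * φ (n ℕ.+ k) * coeff (singleₚ (n ℕ.+ k))
      ≈⟨ trans (*-assoc _ _ _) (*-congˡ (scaled n k)) ⟩
    const (fromℕ ((n ℕ.+ k) !)) * (φ n * φ k * coeff (doubleₚ n k))
      ≈⟨ *-assoc _ _ _ ⟨
    const (fromℕ ((n ℕ.+ k) !)) * (φ n * φ k) * coeff (doubleₚ n k)
      ≈⟨ *-congʳ (trans (*-congˡ (sym (const-* (1/ n !) (1/ k !))))
           (trans (sym (const-* (fromℕ ((n ℕ.+ k) !)) (1/ n ! ℚ.* 1/ k !))) (const-cong (fromℕ-binomial n k)))) ⟩
    const (fromℕ ((n ℕ.+ k) C n)) * coeff (doubleₚ n k)
      ≈⟨ coeff-• (fromℕ ((n ℕ.+ k) C n)) (doubleₚ n k) ⟨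
    coeff (fromℕ ((n ℕ.+ k) C n) • doubleₚ n k) ∎

open import Data.Integer using (+_)
open import Data.Nat using (_+_; _*_)

corollary5p6 : (n k : ℕ) → 1 ≤ n → 1 ≤ k →
    ( (_/_ (+ 1) ((n + k) !) {{(n + k) !≢0}}) • (∑[ w ∈ permutations (n + k) ] B[ w ] *ₚ E (ℓ w))
    ≈ₚ
    (_/_ (+ 1) (n ! * k !) {{n !* k !≢0}}) • (∑[ π ∈ permutations n ] ∑[ σ ∈ permutations k ] B[ π ] *ₚ B[ σ ] *ₚ E (ℓ π + ℓ σ)) )
    ×
    ( (∑[ w ∈ permutations (n + k) ] B[ w ] *ₚ E (ℓ w))
    ≈ₚ
    fromℕ ((n + k) C n) • (∑[ π ∈ permutations n ] ∑[ σ ∈ permutations k ] B[ π ] *ₚ B[ σ ] *ₚ E (ℓ π + ℓ σ)) )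
corollary5p6 n k _ _ = at (Coefficients.normalised n k) , at (Coefficients.cleared n k)
  where open PowerSeries ℚ-ring using (at)
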